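{- The bidirectional BFS algorithm $\mathcal{B}$ described in the context, for the shortest $st$-path problem in unweighted (directed or undirected) multigraphs, is instance-optimal, under both query and time complexity, up to the factor of $O(\Delta)$. That is, $\mathcal{B}$ is correct, and there is an absolute constant $c$ such that for every input $(G,s,t)$ with $G$ an unweighted multigraph and $s\ne t$, and for every (possibly randomized) algorithm $A'$ that is correct for the shortest $st$-path problem on unweighted multigraphs, the expected complexities satisfy $$T_{\mathcal{B}}(G,s,t)\le c\cdot\max\{1,\Delta(G)\}\cdot T_{A'}(G,s,t),$$ where $\Delta(G)$ is the maximum degree of $G$; this holds both when $T$ denotes the number of queries and when $T$ denotes the running time.
   Context: Problem. The input is an unweighted (directed or undirected) multigraph $G$ (self-loops and parallel edges allowed; every edge has length $\ell=1$) with vertices numbered $1,\dots,n$, and two vertices $s\ne t$. Let $d(u,v)$ be the distance from $u$ to $v$ ($+\infty$ if unreachable). The task is to return an arbitrary shortest $st$-path, given by its specific edges (or to report that $t$ is unreachable from $s$). The statement is for directed inputs, and likewise for undirected inputs. The degree of a vertex is the number of edges incident to it (in-degree plus out-degree in the directed case). Query model. The graph is accessible only through unit-cost queries. Undirected case: Degree$(i)$ returns the degree of vertex $i$; Edge$(i,j)$, $1\le j\le\deg(i)$, returns the $j$-th edge incident to $i$ with its other end. Directed case: Indegree$(i)$, Outdegree$(i)$, and Inedge$(i,j)$, Outedge$(i,j)$, which return the $j$-th incoming, resp. outgoing, edge of $i$ with its other end. Query complexity is the expected number of queries; in the time complexity every query costs at least one unit of time. In the unweighted case no heap is needed to implement $\mathcal{B}$,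 and its query complexity and time complexity are identified (up to constant factors). An algorithm (possibly randomized) is correct if on every input it returns a correct output with probability at least $0.9$. Algorithm $\mathcal{B}$ (bidirectional BFS: bidirectional Dijkstra with unit lengths). Maintain $\mu$ (initially $+\infty$), $e_{\mathrm{mid}}$ (initially $\bot$), vertices $u_s$ (initially $s$) and $u_t$ (initially $t$), and values $\hat d(s,\cdot),\hat d(\cdot,t)$, initially $+\infty$ except $\hat d(s,s)=\hat d(t,t)=0$. Two executions are run, a forward one and a backward one, alternating between relaxing one edge in the forward execution and one edge in the backward execution, until the whole algorithm is terminated or one of the two executions has no open vertex left. Forward execution: open $s$. While an open vertex exists: let $u$ be the open vertex with smallest $\hat d(s,u)$; close $u$; set $u_s:=u$; if $\hat d(s,u_s)+\hat d(u_t,t)\ge\mu$, terminate the whole algorithm; otherwise, for each edge $uv$ leaving $u$ (incident to $u$ in the undirected case), relax it: (1) if $v$ is not closed in the forward execution, set $\hat d(s,v):=\min(\hat d(s,v),\hat d(s,u)+\ell(uv))$ and make $v$ open if it was unvisited; (2) if $\hat d(s,u)+\ell(uv)+\hat d(v,t)<\mu$, set $\mu:=\hat d(s,u)+\ell(uv)+\hat d(v,t)$ and $e_{\mathrm{mid}}:=uv$. Backward execution: the same with the roles of forward and backward exchanged: it starts from $t$, follows edges in reverse direction, and maintains $\hat d(\cdot,t)$, $u_t$ and its own open/closed statuses; relaxing an edge $vu$ while processing $u$ compares $\hat d(s,v)+\ell(vu)+\hat d(u,t)$ with $\mu$. Output: with $uv=e_{\mathrm{mid}}$, return the concatenation of the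 shortest $su$-path according to the forward execution, the edge $e_{\mathrm{mid}}$, and the shortest $vt$-path according to the backward execution; if $e_{\mathrm{mid}}=\bot$, report that $t$ is unreachable. The edges of a vertex are accessed using one degree query for the vertex (Outdegree in the forward and Indegree in the backward execution for directed graphs) and one edge query per edge relaxation. -}

module Defs where

open import Data.Bool using (Bool; true; false; not; if_then_else_)
open import Data.Fin using (Fin; zero; suc; toℕ; fromℕ<)
import Data.Fin.Properties as Fin
open import Data.Integer using (+_)
open import Data.List using (List; []; _∷_; [_]; _∷ʳ_; length)
open import Data.Maybe using (Maybe; just; nothing; zipWith)
open import Data.Nat as ℕ using (ℕ; zero; suc; _⊔_; _⊓_; _≤_; _<_; _<?_; _<ᵇ_; s≤s)
import Data.Nat.Properties as ℕ
open import Data.Nat.Induction using (<-wellFounded)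
open import Data.Product using (Σ; ∃; _×_; _,_; proj₁; proj₂)
open import Data.Rational as ℚ using (ℚ; 0ℚ; 1ℚ; _/_)
import Data.Rational.Properties as ℚ
open import Data.Vec using (Vec; lookup; replicate; _[_]≔_)
import Data.Vec.Functional as Vector
open import Algebra.Definitions.RawMonoid ℚ.+-0-rawMonoid using (sum)
open import Function using (_∘_; _↔_; Inverse)
open import Induction.WellFounded using (Acc; acc)
open import Relation.Binary.PropositionalEquality using (_≡_; _≢_; refl; sym; trans; cong; subst)
open import Relation.Nullary using (¬_; Dec; yes; no)
open import Relation.Nullary.Decidable using (map′; _×-dec_; ¬?; does)

------------------------------------------------------------------------
-- Multigraphs with ordered incidence lists

data Kind : Set where
  directed undirected : Kind

-- outs lists, for every vertex, its outgoing edges in a fixed order: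
-- position (v , j) holds the j-th edge leaving v; similarly ins.
record Digraph (n : ℕ) : Set where
  field
    size          : ℕ
    outdeg indeg  : Fin n → ℕ
    outs          : Fin size ↔ Σ (Fin n) (Fin ∘ outdeg)
    ins           : Fin size ↔ Σ (Fin n) (Fin ∘ indeg)

  tail head : Fin size → Fin n
  tail = proj₁ ∘ Inverse.to outs
  head = proj₁ ∘ Inverse.to ins

-- Every edge e has the two ends (e , false) and (e , true), and the ends
-- at a vertex are listed in a fixed order.  A self-loop thus occupies two
-- positions at its vertex and contributes 2 to the degree, in agreement
-- with in-degree plus out-degree for directed graphs.
record Ugraph (n : ℕ) : Set where
  field
    size : ℕ
    deg  : Fin n → ℕ
    ends : (Fin size × Bool) ↔ Σ (Fin n) (Fin ∘ deg)

  end : Fin size → Bool → Fin n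
  end e b = proj₁ (Inverse.to ends (e , b))

data Multigraph (n : ℕ) : Kind → Set where
  dir   : Digraph n → Multigraph n directed
  undir : Ugraph n → Multigraph n undirected

Edge : ∀ {n κ} → Multigraph n κ → Set
Edge (dir G)   = Fin (Digraph.size G)
Edge (undir G) = Fin (Ugraph.size G)

edgeId : ∀ {n κ} (G : Multigraph n κ) → Edge G → ℕ
edgeId (dir _)   = toℕ
edgeId (undir _) = toℕ

Arc : ∀ {n κ} (G : Multigraph n κ) → Edge G → Fin n → Fin n → Set
Arc (dir G)   e u v = Digraph.tail G e ≡ u × Digraph.head G e ≡ v
Arc (undir G) e u v = ∃ λ b → Ugraph.end G e b ≡ u × Ugraph.end G e (not b) ≡ v

degree : ∀ {n κ} → Multigraph n κ → Fin n → ℕ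
degree (dir G)   v = Digraph.indeg G v ℕ.+ Digraph.outdeg G v
degree (undir G) v = Ugraph.deg G v

Δ : ∀ {n κ} → Multigraph n κ → ℕ
Δ G = Vector.foldr _⊔_ 0 (degree G)

------------------------------------------------------------------------
-- The shortest st-path problem

data Walk {n κ} (G : Multigraph n κ) : Fin n → List ℕ → Fin n → Set where
  []  : ∀ {u} → Walk G u [] u
  _∷_ : ∀ {e u w v es} → Arc G e u w → Walk G w es v → Walk G u (edgeId G e ∷ es) v

-- A walk of minimum length repeats no vertex, so it is a shortest path.
ShortestPath : ∀ {n κ} → Multigraph n κ → Fin n → List ℕ → Fin n → Set
ShortestPath G s es t =
  Walk G s es t × (∀ es′ → Walk G s es′ t → length es ≤ length es′)

-- nothing reports that t is unreachable from s
Output : Set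
Output = Maybe (List ℕ)

Valid : ∀ {n κ} → Multigraph n κ → Fin n → Fin n → Output → Set
Valid G s t (just es) = ShortestPath G s es t
Valid G s t nothing   = ∀ es → ¬ Walk G s es t

module _ {n κ} (G : Multigraph n κ) where

  anyEdge? : {P : Edge G → Set} → (∀ e → Dec (P e)) → Dec (∃ P)
  anyEdge? = go G
    where
    go : (H : Multigraph n κ) {P : Edge H → Set} → (∀ e → Dec (P e)) → Dec (∃ P)
    go (dir _)   = Fin.any?
    go (undir _) = Fin.any?

  arc? : ∀ e u v → Dec (Arc G e u v)
  arc? = go G
    where
    go : (H : Multigraph n κ) → ∀ e u v → Dec (Arc H e u v)
    go (dir H)   e u v = (Digraph.tail H e Fin.≟ u) ×-dec (Digraph.head H e Fin.≟ v)
    go (undir H) e u v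
      with (Ugraph.end H e false Fin.≟ u) ×-dec (Ugraph.end H e true Fin.≟ v)
         | (Ugraph.end H e true Fin.≟ u) ×-dec (Ugraph.end H e false Fin.≟ v)
    ... | yes p | _     = yes (false , p)
    ... | no _  | yes q = yes (true , q)
    ... | no ¬p | no ¬q = no λ where
      (false , p) → ¬p p
      (true  , q) → ¬q q

  walk? : ∀ u es v → Dec (Walk G u es v)
  walk? u [] v = map′ (λ where refl → []) (λ where [] → refl) (u Fin.≟ v)
  walk? u (i ∷ es) v = map′
    (λ where (e , w , refl , a , p) → a ∷ p)
    (λ where (_∷_ {e} {w = w} a p) → e , w , refl , a , p)
    (anyEdge? λ e → Fin.any? λ w → (edgeId G e ℕ.≟ i) ×-dec (arc? e u w ×-dec walk? w es v))

  WalkOfLength : ℕ → Fin n → Fin n → Set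
  WalkOfLength l u v = ∃ λ es → Walk G u es v × length es ≡ l

  walkOfLength? : ∀ l u v → Dec (WalkOfLength l u v)
  walkOfLength? zero u v = map′
    (λ where refl → [] , [] , refl) (λ where ([] , [] , _) → refl) (u Fin.≟ v)
  walkOfLength? (suc l) u v = map′
    (λ where (e , w , a , es , p , refl) → edgeId G e ∷ es , a ∷ p , refl)
    (λ where (_ , _∷_ {e} {w = w} {es = es} a p , refl) → e , w , a , es , p , refl)
    (anyEdge? λ e → Fin.any? λ w → arc? e u w ×-dec walkOfLength? l w v)

  vertexAt : ∀ {u es v} → Walk G u es v → Fin (suc (length es)) → Fin n
  vertexAt {u} _       zero    = u
  vertexAt     (_ ∷ p) (suc i) = vertexAt p i

  dropWalk : ∀ {u es v} (p : Walk G u es v) (i : Fin (suc (length es))) →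
             ∃ λ l → WalkOfLength l (vertexAt p i) v × l ℕ.+ toℕ i ≡ length es
  dropWalk {es = es} p zero = length es , (es , p , refl) , ℕ.+-identityʳ _
  dropWalk (_ ∷ p) (suc i) with dropWalk p i
  ... | l , q , eq = l , q , trans (ℕ.+-suc l (toℕ i)) (cong suc eq)

  shortcut : ∀ {u es v} (p : Walk G u es v) (i j : Fin (suc (length es))) →
             toℕ i < toℕ j → vertexAt p i ≡ vertexAt p j →
             ∃ λ es′ → Walk G u es′ v × length es′ < length es
  shortcut (a ∷ p) (suc i) (suc j) (s≤s i<j) eq with shortcut p i j i<j eq
  ... | es′ , q , lt = _ ∷ es′ , a ∷ q , s≤s lt
  shortcut {u} {v = v} p zero j 0<j eq with dropWalk p j
  ... | l , (es′ , q , refl) , l+j≡ = es′ , subst (λ x → Walk G x es′ v) (sym eq) q ,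
        subst (l <_) l+j≡ (ℕ.m<m+n l 0<j)

  boundedWalk : ∀ {u es v} → Walk G u es v → ∃ λ es′ → Walk G u es′ v × length es′ < n
  boundedWalk {es = es} = go (<-wellFounded (length es))
    where
    go : ∀ {u es v} → Acc _<_ (length es) → Walk G u es v →
         ∃ λ es′ → Walk G u es′ v × length es′ < n
    go {es = es} (acc rs) p with length es <? n
    ... | yes lt = es , p , lt
    ... | no ≮n with Fin.pigeonhole (s≤s (ℕ.≮⇒≥ ≮n)) (vertexAt p)
    ... | i , j , i<j , eq with shortcut p i j i<j eq
    ... | es′ , q , lt = go (rs lt) q

  valid? : ∀ s t o → Dec (Valid G s t o)
  valid? s t (just es) = map′ forth back
    (walk? s es t ×-dec Fin.all? {n = length es} λ l → ¬? (walkOfLength? (toℕ l) s t))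
    where
    None : Set
    None = (l : Fin (length es)) → ¬ WalkOfLength (toℕ l) s t
    forth : Walk G s es t × None → ShortestPath G s es t
    forth (p , none) = p , λ es′ q → ℕ.≮⇒≥ λ lt →
      none (fromℕ< lt) (es′ , q , sym (Fin.toℕ-fromℕ< lt))
    back : ShortestPath G s es t → Walk G s es t × None
    back (p , min) = p , λ where
      l (es′ , q , eq) → ℕ.<⇒≱ (Fin.toℕ<n l) (subst (length es ≤_) eq (min es′ q))
  valid? s t nothing = map′ forth back
    (Fin.all? {n = n} λ l → ¬? (walkOfLength? (toℕ l) s t))
    where
    None : Set
    None = (l : Fin n) → ¬ WalkOfLength (toℕ l) s t
    forth : None → ∀ es → ¬ Walk G s es t
    forth none es p with boundedWalk p
    ... | es′ , q , lt = none (fromℕ< lt) (es′ , q , sym (Fin.toℕ-fromℕ< lt))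
    back : (∀ es → ¬ Walk G s es t) → None
    back none l (es , p , _) = none es p

------------------------------------------------------------------------
-- Query model

-- The incidence lists that can be queried
data Port : Kind → Set where
  outgoing incoming : Port directed
  incident          : Port undirected

-- Edge queries are numbered from 0.
data Query (n : ℕ) (κ : Kind) : Set where
  degreeOf : Port κ → Fin n → Query n κ
  edgeAt   : Port κ → Fin n → ℕ → Query n κ

-- An edge query returns the identifier of the edge and its other end, or
-- nothing if the index is out of range.
Answer : ∀ {n κ} → Query n κ → Set
Answer         (degreeOf _ _) = ℕ
Answer {n = n} (edgeAt _ _ _) = Maybe (ℕ × Fin n)

nth : ∀ {A : Set} d → (Fin d → A) → ℕ → Maybe A
nth d f j with j <? d
... | yes j<d = just (f (fromℕ< j<d))
... | no  _   = nothing

answer : ∀ {n κ} → Multigraph n κ → (q : Query n κ) → Answer q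
answer (dir G)   (degreeOf outgoing v) = Digraph.outdeg G v
answer (dir G)   (degreeOf incoming v) = Digraph.indeg G v
answer (undir G) (degreeOf incident v) = Ugraph.deg G v
answer (dir G) (edgeAt outgoing v j) = nth (outdeg v)
  (λ i → let e = Inverse.from outs (v , i) in toℕ e , head e) j
  where open Digraph G
answer (dir G) (edgeAt incoming v j) = nth (indeg v)
  (λ i → let e = Inverse.from ins (v , i) in toℕ e , tail e) j
  where open Digraph G
answer (undir G) (edgeAt incident v j) = nth (deg v)
  (λ i → let (e , b) = Inverse.from ends (v , i) in toℕ e , end e (not b)) j
  where open Ugraph G

------------------------------------------------------------------------
-- Randomized algorithms

-- toss d draws uniformly from a set of suc d elements.
data Action (n : ℕ) (κ : Kind) (X : Set) : Set where
  return  : Output → Action n κ X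
  compute : X → Action n κ X
  toss    : (d : ℕ) → (Fin (suc d) → X) → Action n κ X
  query   : (q : Query n κ) → (Answer q → X) → Action n κ X

-- An algorithm knows n, s and t, and accesses the graph through queries
-- only.  It is a transition system, so it need not terminate.
record Algorithm (κ : Kind) : Set₁ where
  field
    State : ℕ → Set
    start : ∀ {n} → (s t : Fin n) → State n
    step  : ∀ {n} → State n → Action n κ (State n)

average : ∀ {d} → (Fin (suc d) → ℚ) → ℚ
average {d} f = (+ 1 / suc d) ℚ.* sum f

module Run {κ} (A : Algorithm κ) {n} (G : Multigraph n κ) where
  open Algorithm A

  mean : Action n κ (State n) → (State n → ℚ) → ℚ
  mean (return _)  f = 0ℚ
  mean (compute σ) f = f σ
  mean (toss d g)  f = average (f ∘ g)
  mean (query q g) f = f (g (answer G q))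

  -- The expected total reward collected in the first k steps from σ
  expected : (Action n κ (State n) → ℚ) → ℕ → State n → ℚ
  expected r zero    σ = 0ℚ
  expected r (suc k) σ = r (step σ) ℚ.+ mean (step σ) (expected r k)

-- The probability of having returned a valid output within k steps
successProbability : ∀ {κ} → Algorithm κ → ∀ {n} → Multigraph n κ → Fin n → Fin n → ℕ → ℚ
successProbability {κ} A {n} G s t k = Run.expected A G reward k (start s t)
  where
  open Algorithm A
  reward : Action n κ (State n) → ℚ
  reward (return o) = if does (valid? G s t o) then 1ℚ else 0ℚ
  reward _          = 0ℚ

data Measure : Set where
  queries time : Measure

-- Every step takes one unit of time.
cost : ∀ {n κ X} → Measure → Action n κ X → ℚ
cost time    _           = 1ℚ
cost queries (query _ _) = 1ℚ
cost queries _           = 0ℚ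

-- The expected complexity over the first k steps
complexity : Measure → ∀ {κ} → Algorithm κ → ∀ {n} → Multigraph n κ → Fin n → Fin n → ℕ → ℚ
complexity M A G s t k = Run.expected A G (cost M) k (Algorithm.start A s t)

-- Probabilities and expected complexities of full runs are, possibly
-- irrational or infinite, suprema of nondecreasing rational sequences.
-- x ≲ y says that sup x ≤ sup y.
infix 4 _≲_
_≲_ : (ℕ → ℚ) → (ℕ → ℚ) → Set
x ≲ y = ∀ k ε → 0ℚ ℚ.< ε → ∃ λ k′ → x k ℚ.≤ y k′ ℚ.+ ε

infixr 7 _·_
_·_ : ℕ → (ℕ → ℚ) → (ℕ → ℚ)
(c · x) k = (+ c / 1) ℚ.* x k

Correct : ∀ {κ} → Algorithm κ → Set
Correct {κ} A = ∀ {n} (G : Multigraph n κ) (s t : Fin n) → s ≢ t →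
  (λ _ → + 9 / 10) ≲ successProbability A G s t

------------------------------------------------------------------------
-- Bidirectional BFS

data Side : Set where
  forward backward : Side

opposite : Side → Side
opposite forward  = backward
opposite backward = forward

port : ∀ κ → Side → Port κ
port directed   forward  = outgoing
port directed   backward = incoming
port undirected _        = incident

ℕ∞ : Set
ℕ∞ = Maybe ℕ

pattern ∞ = nothing

_+∞_ _⊓∞_ : ℕ∞ → ℕ∞ → ℕ∞
_+∞_ = zipWith ℕ._+_
just a ⊓∞ just b = just (a ⊓ b)
just a ⊓∞ ∞      = just a
∞      ⊓∞ b      = b

_<∞_ : ℕ∞ → ℕ∞ → Bool
just a <∞ just b = a <ᵇ b
just _ <∞ ∞      = true
∞      <∞ _      = false

-- relaxing j r: the edges of current with index below j have been relaxed
-- and r more remain.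
data Progress : Set where
  idle     : Progress
  relaxing : (j r : ℕ) → Progress

-- The open vertices form a FIFO queue.  As all edges have length 1, the
-- queue is sorted by dist, hence its front is an open vertex with smallest
-- dist.  The entries of parent are the tree edges of the execution.
record Execution (n : ℕ) : Set where
  constructor execution
  field
    dist     : Vec ℕ∞ n
    parent   : Vec (Maybe (ℕ × Fin n)) n
    closed   : Vec Bool n
    queue    : List (Fin n)
    current  : Fin n
    progress : Progress

-- active is the execution on side turn, and other is the opposite one.
-- mid holds u, the identifier of e_mid, and v, where e_mid = uv.
record Config (n : ℕ) : Set where
  constructor config
  field
    turn         : Side
    active other : Execution n
    μ            : ℕ∞
    mid          : Maybe (Fin n × ℕ × Fin n)

-- Every transition performs a constant number of array accesses and of
-- operations at the ends of a queue (∷ and ∷ʳ), so it takes constant time.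
-- The arrays are taken to be initialized lazily, at no cost depending on n.
data BState (n : ℕ) : Set where
  searching : Config n → BState n
  tracing   : (fromS toT : Execution n) → Fin n → List ℕ → Fin n → BState n

launch : ∀ {n} → Fin n → Execution n
launch v = record
  { dist     = replicate _ ∞ [ v ]≔ just 0
  ; parent   = replicate _ nothing
  ; closed   = replicate _ false
  ; queue    = [ v ]
  ; current  = v
  ; progress = idle
  }

module _ {n : ℕ} where

  -- Step (1) for edge e from the current vertex u to v (v to u if backward)
  reach : ℕ → Fin n → Execution n → Execution n
  reach e v X = if lookup closed v then X else record X
    { dist   = dist [ v ]≔ (lookup dist v ⊓∞ new)
    ; parent = if new <∞ lookup dist v then parent [ v ]≔ just (e , current) else parent
    ; queue  = if lookup dist v <∞ ∞ then queue else queue ∷ʳ v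
    }
    where
    open Execution X
    new : ℕ∞
    new = lookup dist current +∞ just 1

  orient : Side → Fin n → ℕ → Fin n → Fin n × ℕ × Fin n
  orient forward  u e v = u , e , v
  orient backward u e v = v , e , u

  relax : ℕ → Fin n → Config n → Config n
  relax e v (config turn X Y μ mid) =
    if through <∞ μ
    then config turn (reach e v X) Y through (just (orient turn u e v))
    else config turn (reach e v X) Y μ mid
    where
    u : Fin n
    u = Execution.current X
    through : ℕ∞
    through = (lookup (Execution.dist X) u +∞ just 1) +∞ lookup (Execution.dist Y) v

  switch : Config n → Config n
  switch (config turn X Y μ mid) = config (opposite turn) Y X μ mid

  finish : ∀ {κ} → Config n → Action n κ (BState n)
  finish (config _ _ _ _ nothing) = return nothing
  finish (config forward  X Y _ (just (u , e , v))) = compute (tracing X Y u [ e ] v)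
  finish (config backward X Y _ (just (u , e , v))) = compute (tracing Y X u [ e ] v)

  setProgress : Progress → Config n → Config n
  setProgress p c = record c { active = record (Config.active c) { progress = p } }

  close : Fin n → List (Fin n) → Config n → Config n
  close u rest c = record c { active = record X
    { closed = Execution.closed X [ u ]≔ true ; queue = rest ; current = u } }
    where
    X : Execution n
    X = Config.active c

  radius : Execution n → ℕ∞
  radius X = lookup (Execution.dist X) (Execution.current X)

  searchStep : ∀ {κ} → Config n → Action n κ (BState n)
  searchStep {κ} c@(config turn X Y μ _) with Execution.progress X | Execution.queue X
  ... | idle | []       = finish c
  ... | idle | u ∷ rest =
    let c′ = close u rest c in
    if (radius (Config.active c′) +∞ radius Y) <∞ μ
    then query (degreeOf (port κ turn) u) (λ d → searching (setProgress (relaxing 0 d) c′))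
    else finish c′
  ... | relaxing _ zero    | _ = compute (searching (setProgress idle c))
  ... | relaxing j (suc r) | _ =
    query (edgeAt (port κ turn) (Execution.current X) j) λ where
      (just (e , v)) → searching (switch (relax e v c′))
      nothing        → searching (switch c′)   -- never happens, as j < degree
    where
    c′ : Config n
    c′ = setProgress (relaxing (suc j) r) c

  -- The list is a path from x to y; it is extended towards s and then
  -- towards t along the tree edges.
  traceStep : ∀ {κ} (X Y : Execution n) → Fin n → List ℕ → Fin n → Action n κ (BState n)
  traceStep X Y x es y with lookup (Execution.parent X) x | lookup (Execution.parent Y) y
  ... | just (e , x′) | _             = compute (tracing X Y x′ (e ∷ es) y)
  ... | nothing       | just (e , y′) = compute (tracing X Y x (es ∷ʳ e) y′)
  ... | nothing       | nothing       = return (just es)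

bidirectionalBFS : ∀ κ → Algorithm κ
bidirectionalBFS κ = record
  { State = BState
  ; start = λ s t → searching (config forward (launch s) (launch t) ∞ nothing)
  ; step  = λ where
      (searching c)          → searchStep c
      (tracing X Y x es y)   → traceStep X Y x es y
  }

{-# OPTIONS --safe #-}

-- Lower bound.  Exchange the heads of an edge leaving a vertex at distance p
-- from s and of an edge entering a vertex at distance q from t, where p + 1 + q
-- is less than the distance from s to t.  This creates a shorter st-walk, keeps
-- all degrees, and can be noticed only by a query that returns one of the two
-- edges.  A correct algorithm succeeds on both graphs, on which no output is
-- valid simultaneously, so in expectation it returns one of the two edges at
-- least 1/2 times.  Hence all edges leaving the vertices near s, or all edges
-- entering the vertices near t, are returned at least 1/4 times each; as a
-- query returns one edge, that is, at most two directed ones, the total degree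
-- of these vertices is at most 8 times the expected number of queries.
--
-- Upper bound.  Suppose that the forward execution scans a vertex at distance a
-- from s and the backward one a vertex at distance b from t.  Until B stops,
-- every st-walk is longer than a + b, so the lower bound applies to the forward
-- vertices at distance less than a and the closed backward vertices.  The
-- forward execution closes at most one vertex more than there are edges leaving
-- the former, so it relaxes at most Δ times as many edges; and since the
-- executions alternate, the cheaper one of them determines the running time.

module Submission where

open import Defs
open import Data.Bool using (Bool; true; false; not; if_then_else_)
import Data.Bool.Properties as Bool
open import Data.Empty using (⊥; ⊥-elim)
open import Data.Fin using (Fin; zero; suc; toℕ; fromℕ<)
import Data.Fin.Properties as Fin
open import Data.Integer using (+_)
import Data.Integer as ℤ
import Data.Integer.Properties as ℤ
open import Data.List using (List; []; _∷_; [_]; _++_; _∷ʳ_; length; map; allFin; filter)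

import Data.List as List
import Data.List.Properties as List
open import Data.List.Membership.Propositional using (_∈_; _∉_; find)
import Data.List.Membership.Propositional.Properties as ∈
open import Data.List.Relation.Unary.All as All using (All; []; _∷_)
import Data.List.Relation.Unary.All.Properties as All
open import Data.List.Relation.Unary.AllPairs using ([]; _∷_)
open import Data.List.Relation.Unary.Any using (here; there)
open import Data.List.Relation.Unary.Unique.Propositional using (Unique)
import Data.List.Relation.Unary.Unique.Propositional.Properties as Unique
open import Data.Maybe using (Maybe; just; nothing)
open import Data.Maybe.Properties using (just-injective)
open import Data.Nat using (ℕ; zero; suc; _+_; _*_; _∸_; _⊔_; _⊓_; _≤_; _<_; _≤?_; _<?_; _<ᵇ_; z≤n; s≤s; s≤s⁻¹)
import Data.Nat.ListAction as ListAction
import Data.Nat.ListAction.Properties as ListAction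
import Data.Nat.Properties as ℕ
open import Data.Nat.Solver using (module +-*-Solver)
open import Data.Product using (Σ; ∃; ∃₂; _×_; _,_; proj₁; proj₂; ∃-syntax)
open import Data.Rational as ℚ using (ℚ; 0ℚ; 1ℚ; _/_)
import Data.Rational.Properties as ℚ
import Data.Rational.Solver as ℚ-Solver
import Data.Rational.Unnormalised as ℚᵘ
import Data.Rational.Unnormalised.Properties as ℚᵘ
open import Data.Sum using (_⊎_; inj₁; inj₂)
open import Data.Unit using (⊤; tt)
open import Data.Vec using (Vec; lookup; replicate; _[_]≔_)
import Data.Vec.Properties as Vec
import Data.Vec.Functional as Vector
import Data.Product.Properties as Product
open import Algebra.Definitions.RawMonoid ℚ.+-0-rawMonoid using (sum)
open import Function using (_∘_; _↔_; Inverse; mk↔ₛ′)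
open import Function.Construct.Composition using (_↔-∘_)
open import Relation.Binary.Definitions using (DecidableEquality)
open import Relation.Binary.PropositionalEquality using (_≡_; _≢_; refl; sym; trans; cong; cong₂; subst; subst₂; module ≡-Reasoning)
open import Relation.Nullary using (¬_; Dec; yes; no; contradiction)
open import Relation.Nullary.Decidable using (does; from-yes; dec-true; dec-false)

-- Rationals and expectations

-- Expected complexities are suprema over the number of steps, so the lower bound is proved at one
-- finite horizon. Success probabilities are nondecreasing and there are finitely many pairs of
-- darts, hence some number of steps lets the algorithm succeed with probability at least 3/4 on the
-- graph and on all its exchanges at once. The expected number of queries made by then is at most
-- the supremum. Knowing only that every st-walk is longer than a + b, an exchange is conclusive for
-- p + 1 + q ≤ a + b. So one of the two sides has to stay strictly inside its radius; the forward
-- side does, and it is there alone that the factor Δ is lost. The explored degree may be 0 although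
-- B always makes some steps. The additive constants are therefore paid by a separate comparison
-- with a graph that has no valid output in common with the given one, which forces at least half a
-- query in expectation.

⟦_⟧ : ℕ → ℚ
⟦ m ⟧ = + m / 1

⟦⟧-toℚᵘ : ∀ m → ℚ.toℚᵘ ⟦ m ⟧ ℚᵘ.≃ ℚᵘ.mkℚᵘ (+ m) 0
⟦⟧-toℚᵘ m = ℚ.toℚᵘ-fromℚᵘ (ℚᵘ.mkℚᵘ (+ m) 0)

⟦⟧-homo-+ : ∀ m n → ⟦ m + n ⟧ ≡ ⟦ m ⟧ ℚ.+ ⟦ n ⟧
⟦⟧-homo-+ m n = ℚ.toℚᵘ-injective (begin
  ℚ.toℚᵘ ⟦ m + n ⟧                          ≈⟨ ⟦⟧-toℚᵘ (m + n) ⟩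
  ℚᵘ.mkℚᵘ (+ (m + n)) 0                     ≈⟨ ℚᵘ.*≡* (cong (ℤ._* + 1) (sym
    (cong₂ ℤ._+_ (ℤ.*-identityʳ (+ m)) (ℤ.*-identityʳ (+ n))))) ⟩
  ℚᵘ.mkℚᵘ (+ m) 0 ℚᵘ.+ ℚᵘ.mkℚᵘ (+ n) 0      ≈⟨ ℚᵘ.+-cong (⟦⟧-toℚᵘ m) (⟦⟧-toℚᵘ n) ⟨
  ℚ.toℚᵘ ⟦ m ⟧ ℚᵘ.+ ℚ.toℚᵘ ⟦ n ⟧            ≈⟨ ℚ.toℚᵘ-homo-+ ⟦ m ⟧ ⟦ n ⟧ ⟨
  ℚ.toℚᵘ (⟦ m ⟧ ℚ.+ ⟦ n ⟧)                  ∎)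
  where open ℚᵘ.≃-Reasoning

⟦⟧-homo-* : ∀ m n → ⟦ m * n ⟧ ≡ ⟦ m ⟧ ℚ.* ⟦ n ⟧
⟦⟧-homo-* m n = ℚ.toℚᵘ-injective (begin
  ℚ.toℚᵘ ⟦ m * n ⟧                          ≈⟨ ⟦⟧-toℚᵘ (m * n) ⟩
  ℚᵘ.mkℚᵘ (+ (m * n)) 0                     ≈⟨ ℚᵘ.*≡* (cong (ℤ._* + 1) (ℤ.pos-* m n)) ⟩
  ℚᵘ.mkℚᵘ (+ m) 0 ℚᵘ.* ℚᵘ.mkℚᵘ (+ n) 0      ≈⟨ ℚᵘ.*-cong (⟦⟧-toℚᵘ m) (⟦⟧-toℚᵘ n) ⟨
  ℚ.toℚᵘ ⟦ m ⟧ ℚᵘ.* ℚ.toℚᵘ ⟦ n ⟧            ≈⟨ ℚ.toℚᵘ-homo-* ⟦ m ⟧ ⟦ n ⟧ ⟨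
  ℚ.toℚᵘ (⟦ m ⟧ ℚ.* ⟦ n ⟧)                  ∎)
  where open ℚᵘ.≃-Reasoning

0≤⟦⟧ : ∀ m → 0ℚ ℚ.≤ ⟦ m ⟧
0≤⟦⟧ m = ℚ.nonNegative⁻¹ ⟦ m ⟧ {{ℚ.normalize-nonNeg m 1}}

x≤y+x : ∀ {x y} → 0ℚ ℚ.≤ y → x ℚ.≤ y ℚ.+ x
x≤y+x {x} {y} 0≤y = subst (ℚ._≤ y ℚ.+ x) (ℚ.+-identityˡ x) (ℚ.+-monoˡ-≤ x 0≤y)

x≤x+y : ∀ {x y} → 0ℚ ℚ.≤ y → x ℚ.≤ x ℚ.+ y
x≤x+y {x} {y} 0≤y = subst (ℚ._≤ x ℚ.+ y) (ℚ.+-identityʳ x) (ℚ.+-monoʳ-≤ x 0≤y)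

0+x≤1 : ∀ {x} → x ℚ.≤ 1ℚ → 0ℚ ℚ.+ x ℚ.≤ 1ℚ
0+x≤1 {x} = subst (ℚ._≤ 1ℚ) (sym (ℚ.+-identityˡ x))

⟦⟧-mono : ∀ {m n} → m ≤ n → ⟦ m ⟧ ℚ.≤ ⟦ n ⟧
⟦⟧-mono {m} {n} m≤n = subst (⟦ m ⟧ ℚ.≤_)
  (trans (sym (⟦⟧-homo-+ (n ∸ m) m)) (cong ⟦_⟧ (ℕ.m∸n+n≡m m≤n)))
  (x≤y+x (0≤⟦⟧ (n ∸ m)))

+-interchange : ∀ a b c d → (a ℚ.+ b) ℚ.+ (c ℚ.+ d) ≡ (a ℚ.+ c) ℚ.+ (b ℚ.+ d)
+-interchange = solve 4 (λ a b c d → (a :+ b) :+ (c :+ d) := (a :+ c) :+ (b :+ d)) refl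
  where open ℚ-Solver.+-*-Solver

sum-mono : ∀ {n} {f g : Fin n → ℚ} → (∀ i → f i ℚ.≤ g i) → sum f ℚ.≤ sum g
sum-mono {zero}  f≤g = ℚ.≤-refl
sum-mono {suc n} f≤g = ℚ.+-mono-≤ (f≤g zero) (sum-mono (f≤g ∘ suc))

sum-+ : ∀ {n} (f g : Fin n → ℚ) → sum (λ i → f i ℚ.+ g i) ≡ sum f ℚ.+ sum g
sum-+ {zero}  f g = refl
sum-+ {suc n} f g = trans (cong (f zero ℚ.+ g zero ℚ.+_) (sum-+ (f ∘ suc) (g ∘ suc)))
  (+-interchange (f zero) (g zero) (sum (f ∘ suc)) (sum (g ∘ suc)))

sum-const : ∀ n x → sum {n} (λ _ → x) ≡ ⟦ n ⟧ ℚ.* x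
sum-const zero    x = sym (ℚ.*-zeroˡ x)
sum-const (suc n) x = begin
  x ℚ.+ sum {n} (λ _ → x)          ≡⟨ cong₂ ℚ._+_ (sym (ℚ.*-identityˡ x)) (sum-const n x) ⟩
  1ℚ ℚ.* x ℚ.+ ⟦ n ⟧ ℚ.* x         ≡⟨ ℚ.*-distribʳ-+ x 1ℚ ⟦ n ⟧ ⟨
  (1ℚ ℚ.+ ⟦ n ⟧) ℚ.* x             ≡⟨ cong (ℚ._* x) (⟦⟧-homo-+ 1 n) ⟨
  ⟦ suc n ⟧ ℚ.* x                  ∎
  where open ≡-Reasoning

average-mono : ∀ {d} {f g : Fin (suc d) → ℚ} → (∀ i → f i ℚ.≤ g i) → average f ℚ.≤ average g
average-mono {d} f≤g =
  ℚ.*-monoˡ-≤-nonNeg (+ 1 / suc d) {{ℚ.normalize-nonNeg 1 (suc d)}} (sum-mono f≤g)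

average-+ : ∀ {d} (f g : Fin (suc d) → ℚ) → average (λ i → f i ℚ.+ g i) ≡ average f ℚ.+ average g
average-+ {d} f g = trans (cong (+ 1 / suc d ℚ.*_) (sum-+ f g))
  (ℚ.*-distribˡ-+ (+ 1 / suc d) (sum f) (sum g))

average-const : ∀ {d} x → average {d} (λ _ → x) ≡ x
average-const {d} x = begin
  p ℚ.* sum {suc d} (λ _ → x)   ≡⟨ cong (p ℚ.*_) (sum-const (suc d) x) ⟩
  p ℚ.* (⟦ suc d ⟧ ℚ.* x)       ≡⟨ ℚ.*-assoc p ⟦ suc d ⟧ x ⟨
  p ℚ.* ⟦ suc d ⟧ ℚ.* x         ≡⟨ cong (ℚ._* x) p*[1+d]≡1 ⟩
  1ℚ ℚ.* x                      ≡⟨ ℚ.*-identityˡ x ⟩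
  x                             ∎
  where
  open ≡-Reasoning
  p : ℚ
  p = + 1 / suc d
  p*[1+d]≡1 : p ℚ.* ⟦ suc d ⟧ ≡ 1ℚ
  p*[1+d]≡1 = ℚ.toℚᵘ-injective (ℚᵘ.≃-trans (ℚ.toℚᵘ-homo-* p ⟦ suc d ⟧)
    (ℚᵘ.≃-trans (ℚᵘ.*-cong (ℚ.toℚᵘ-fromℚᵘ (ℚᵘ.mkℚᵘ (+ 1) d)) (⟦⟧-toℚᵘ (suc d)))
      (ℚᵘ.*≡* (cong (+_ ∘ suc) (solve 1 (λ d → (d :+ con 0) :* con 1 := d :* con 1 :+ con 0) refl d)))))
    where open +-*-Solver using (solve; con; _:+_; _:*_; _:=_)

sumOver : {X : Set} → List X → (X → ℚ) → ℚ
sumOver []       f = 0ℚ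
sumOver (x ∷ xs) f = f x ℚ.+ sumOver xs f

-- Expected rewards over finitely many steps

module _ {κ} (A : Algorithm κ) {n} (G : Multigraph n κ) where
  open Algorithm A
  open Run A G

  Reward : Set
  Reward = Action n κ (State n) → ℚ

  mean-mono : ∀ a {f g} → (∀ σ → f σ ℚ.≤ g σ) → mean a f ℚ.≤ mean a g
  mean-mono (return _)  f≤g = ℚ.≤-refl
  mean-mono (compute _) f≤g = f≤g _
  mean-mono (toss d h)  f≤g = average-mono {d} (λ i → f≤g (h i))
  mean-mono (query _ _) f≤g = f≤g _

  mean-cong : ∀ a {f g} → (∀ σ → f σ ≡ g σ) → mean a f ≡ mean a g
  mean-cong a f≡g = ℚ.≤-antisym (mean-mono a (ℚ.≤-reflexive ∘ f≡g))
                                (mean-mono a (ℚ.≤-reflexive ∘ sym ∘ f≡g))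

  mean-+ : ∀ a f g → mean a (λ σ → f σ ℚ.+ g σ) ≡ mean a f ℚ.+ mean a g
  mean-+ (return _)  f g = refl
  mean-+ (compute _) f g = refl
  mean-+ (toss _ h)  f g = average-+ (f ∘ h) (g ∘ h)
  mean-+ (query _ _) f g = refl

  -- Only an inequality, since nothing is collected after `return`, where `mean` is 0.
  mean-const≤ : ∀ a {x} → 0ℚ ℚ.≤ x → mean a (λ _ → x) ℚ.≤ x
  mean-const≤ (return _)      0≤x = 0≤x
  mean-const≤ (compute _)     0≤x = ℚ.≤-refl
  mean-const≤ (toss d _)  {x} 0≤x = ℚ.≤-reflexive (average-const {d} x)
  mean-const≤ (query _ _)     0≤x = ℚ.≤-refl

  mean-0 : ∀ a → mean a (λ _ → 0ℚ) ≡ 0ℚ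
  mean-0 (return _)  = refl
  mean-0 (compute _) = refl
  mean-0 (toss d _)  = average-const {d} 0ℚ
  mean-0 (query _ _) = refl

  expected-mono : ∀ {r r′ : Reward} → (∀ a → r a ℚ.≤ r′ a) →
                  ∀ k σ → expected r k σ ℚ.≤ expected r′ k σ
  expected-mono r≤r′ zero    σ = ℚ.≤-refl
  expected-mono r≤r′ (suc k) σ =
    ℚ.+-mono-≤ (r≤r′ (step σ)) (mean-mono (step σ) (expected-mono r≤r′ k))

  expected-cong : ∀ {r r′ : Reward} → (∀ a → r a ≡ r′ a) → ∀ k σ → expected r k σ ≡ expected r′ k σ
  expected-cong r≡r′ k σ = ℚ.≤-antisym (expected-mono (ℚ.≤-reflexive ∘ r≡r′) k σ)
                                       (expected-mono (ℚ.≤-reflexive ∘ sym ∘ r≡r′) k σ)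

  expected-+ : ∀ (r r′ : Reward) k σ →
               expected (λ a → r a ℚ.+ r′ a) k σ ≡ expected r k σ ℚ.+ expected r′ k σ
  expected-+ r r′ zero    σ = refl
  expected-+ r r′ (suc k) σ = trans
    (cong (r (step σ) ℚ.+ r′ (step σ) ℚ.+_)
      (trans (mean-cong (step σ) (expected-+ r r′ k)) (mean-+ (step σ) (expected r k) (expected r′ k))))
    (+-interchange (r (step σ)) (r′ (step σ)) (mean (step σ) (expected r k)) (mean (step σ) (expected r′ k)))

  expected-0 : ∀ k σ → expected (λ _ → 0ℚ) k σ ≡ 0ℚ
  expected-0 zero    σ = refl
  expected-0 (suc k) σ = trans (ℚ.+-identityˡ (mean (step σ) (expected (λ _ → 0ℚ) k)))
    (trans (mean-cong (step σ) (expected-0 k)) (mean-0 (step σ)))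

  expected-sumOver : ∀ {X : Set} (xs : List X) (r : X → Reward) k σ →
    expected (λ a → sumOver xs (λ x → r x a)) k σ ≡ sumOver xs (λ x → expected (r x) k σ)
  expected-sumOver []       r k σ = expected-0 k σ
  expected-sumOver (x ∷ xs) r k σ = trans (expected-+ (r x) (λ a → sumOver xs (λ x → r x a)) k σ)
    (cong (expected (r x) k σ ℚ.+_) (expected-sumOver xs r k σ))

  expected-nonneg : ∀ {r : Reward} → (∀ a → 0ℚ ℚ.≤ r a) → ∀ k σ → 0ℚ ℚ.≤ expected r k σ
  expected-nonneg {r} 0≤r k σ =
    subst (ℚ._≤ expected r k σ) (expected-0 k σ) (expected-mono 0≤r k σ)

  expected-increasing : ∀ {r : Reward} → (∀ a → 0ℚ ℚ.≤ r a) →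
                        ∀ {k l} → k ≤ l → ∀ σ → expected r k σ ℚ.≤ expected r l σ
  expected-increasing 0≤r {l = l} z≤n σ = expected-nonneg 0≤r l σ
  expected-increasing {r} 0≤r (s≤s k≤l) σ =
    ℚ.+-monoʳ-≤ (r (step σ)) (mean-mono (step σ) (expected-increasing 0≤r k≤l))

  onReturn : (Output → ℚ) → Reward
  onReturn p (return o) = p o
  onReturn p _          = 0ℚ

  -- A run returns at most once: a returning step has `mean` 0 and every other step has reward 0, so
  -- one of the two summands always vanishes.
  onReturn≤1 : ∀ {p} → (∀ o → p o ℚ.≤ 1ℚ) → ∀ k σ → expected (onReturn p) k σ ℚ.≤ 1ℚ
  onReturn≤1 {p} p≤1 zero    σ = from-yes (0ℚ ℚ.≤? 1ℚ)
  onReturn≤1 {p} p≤1 (suc k) σ = help (step σ)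
    where
    IH : ∀ a → mean a (expected (onReturn p) k) ℚ.≤ 1ℚ
    IH a = ℚ.≤-trans (mean-mono a (onReturn≤1 p≤1 k)) (mean-const≤ a (from-yes (0ℚ ℚ.≤? 1ℚ)))
    help : ∀ a → onReturn p a ℚ.+ mean a (expected (onReturn p) k) ℚ.≤ 1ℚ
    help (return o)      = subst (ℚ._≤ 1ℚ) (sym (ℚ.+-identityʳ (p o))) (p≤1 o)
    help a@(compute _)   = 0+x≤1 (IH a)
    help a@(toss _ _)    = 0+x≤1 (IH a)
    help a@(query _ _)   = 0+x≤1 (IH a)

-- The runs of A on G and on G′ coincide until a query is made that G and G′
-- answer differently, and w charges for each such query.
coupling : ∀ {κ} (A : Algorithm κ) {n} (G G′ : Multigraph n κ) {p p′ : Output → ℚ} →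
  (∀ o → p o ℚ.≤ 1ℚ) → (∀ o → p′ o ℚ.≤ 1ℚ) → (∀ o → p o ℚ.+ p′ o ℚ.≤ 1ℚ) →
  (w : Reward A G) → (∀ a → 0ℚ ℚ.≤ w a) →
  (∀ q g → answer G q ≡ answer G′ q ⊎ 1ℚ ℚ.≤ w (query q g)) →
  ∀ k σ → Run.expected A G (onReturn A G p) k σ ℚ.+ Run.expected A G′ (onReturn A G′ p′) k σ
          ℚ.≤ 1ℚ ℚ.+ Run.expected A G w k σ
coupling A G G′ {p} {p′} p≤1 p′≤1 p+p′≤1 w 0≤w differ = go
  where
  open Algorithm A
  E E′ W : ∀ k σ → ℚ
  E  = Run.expected A G (onReturn A G p)
  E′ = Run.expected A G′ (onReturn A G′ p′)
  W  = Run.expected A G w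

  skip : ∀ {x x′ y z} → x ℚ.+ x′ ℚ.≤ 1ℚ ℚ.+ z → 0ℚ ℚ.≤ y →
         (0ℚ ℚ.+ x) ℚ.+ (0ℚ ℚ.+ x′) ℚ.≤ 1ℚ ℚ.+ (y ℚ.+ z)
  skip {x} {x′} {y} {z} x+x′≤1+z 0≤y = ℚ.≤-trans
    (subst (ℚ._≤ 1ℚ ℚ.+ z) (cong₂ ℚ._+_ (sym (ℚ.+-identityˡ x)) (sym (ℚ.+-identityˡ x′))) x+x′≤1+z)
    (ℚ.+-monoʳ-≤ 1ℚ (x≤y+x 0≤y))

  go : ∀ k σ → E k σ ℚ.+ E′ k σ ℚ.≤ 1ℚ ℚ.+ W k σ
  go zero    σ = from-yes (0ℚ ℚ.+ 0ℚ ℚ.≤? 1ℚ ℚ.+ 0ℚ)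
  go (suc k) σ = help (step σ)
    where
    help : ∀ a → (onReturn A G p a ℚ.+ Run.mean A G a (E k))
                 ℚ.+ (onReturn A G′ p′ a ℚ.+ Run.mean A G′ a (E′ k))
                 ℚ.≤ 1ℚ ℚ.+ (w a ℚ.+ Run.mean A G a (W k))
    help a@(return o) = ℚ.≤-trans
      (subst (ℚ._≤ 1ℚ) (cong₂ ℚ._+_ (sym (ℚ.+-identityʳ (p o))) (sym (ℚ.+-identityʳ (p′ o)))) (p+p′≤1 o))
      (x≤x+y {1ℚ} (subst (0ℚ ℚ.≤_) (sym (ℚ.+-identityʳ (w a))) (0≤w a)))
    help a@(compute τ) = skip {E k τ} (go k τ) (0≤w a)
    help a@(toss d g)  = skip {average (E k ∘ g)} (begin
      average (E k ∘ g) ℚ.+ average (E′ k ∘ g)       ≡⟨ average-+ (E k ∘ g) (E′ k ∘ g) ⟨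
      average (λ i → E k (g i) ℚ.+ E′ k (g i))       ≤⟨ average-mono (λ i → go k (g i)) ⟩
      average (λ i → 1ℚ ℚ.+ W k (g i))               ≡⟨ average-+ (λ _ → 1ℚ) (W k ∘ g) ⟩
      average {d} (λ _ → 1ℚ) ℚ.+ average (W k ∘ g)   ≡⟨ cong (ℚ._+ average (W k ∘ g)) (average-const {d} 1ℚ) ⟩
      1ℚ ℚ.+ average (W k ∘ g)                       ∎) (0≤w a)
      where open ℚ.≤-Reasoning
    help a@(query q g) with differ q g
    ... | inj₁ same = skip {E k (g (answer G q))}
      (subst (λ x → E k (g (answer G q)) ℚ.+ E′ k (g x) ℚ.≤ 1ℚ ℚ.+ W k (g (answer G q))) same
        (go k (g (answer G q)))) (0≤w a)
    -- From here on the two runs are unrelated. Each contributes at most 1, and the second 1 is paid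
    -- by the charge for this query.
    ... | inj₂ 1≤w = ℚ.+-mono-≤
      (0+x≤1 (onReturn≤1 A G p≤1 k (g (answer G q))))
      (ℚ.≤-trans (0+x≤1 (onReturn≤1 A G′ p′≤1 k (g (answer G′ q))))
        (ℚ.≤-trans 1≤w (x≤x+y (expected-nonneg A G 0≤w k (g (answer G q))))))

-- Darts, paths and the exchange of heads

-- A dart is an edge with a direction in which it can be traversed.
Dart : ∀ {n κ} → Multigraph n κ → Set
Dart (dir G)   = Fin (Digraph.size G)
Dart (undir G) = Fin (Ugraph.size G) × Bool

module _ {n : ℕ} where

  edge : ∀ {κ} (G : Multigraph n κ) → Dart G → Edge G
  edge (dir G)   e       = e
  edge (undir G) (e , _) = e

  ident : ∀ {κ} (G : Multigraph n κ) → Dart G → ℕ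
  ident G δ = edgeId G (edge G δ)

  -- The execution on a given side traverses a dart from near to far.
  near far : ∀ {κ} (G : Multigraph n κ) → Side → Dart G → Fin n
  near (dir G)   forward  e       = Digraph.tail G e
  near (dir G)   backward e       = Digraph.head G e
  near (undir G) forward  (e , b) = Ugraph.end G e b
  near (undir G) backward (e , b) = Ugraph.end G e (not b)
  far G side = near G (opposite side)

  sideDegree : ∀ {κ} (G : Multigraph n κ) → Side → Fin n → ℕ
  sideDegree {κ} G side v = answer G (degreeOf (port κ side) v)

  dartAt : ∀ {κ} (G : Multigraph n κ) side v → Fin (sideDegree G side v) → Dart G
  dartAt (dir G)   forward  v i = Inverse.from (Digraph.outs G) (v , i)
  dartAt (dir G)   backward v i = Inverse.from (Digraph.ins G) (v , i)
  dartAt (undir G) forward  v i = Inverse.from (Ugraph.ends G) (v , i)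
  dartAt (undir G) backward v i = let (e , b) = Inverse.from (Ugraph.ends G) (v , i) in e , not b

  neighbourAt : ∀ {κ} (G : Multigraph n κ) side v → Fin (sideDegree G side v) → ℕ × Fin n
  neighbourAt G side v i = ident G (dartAt G side v i) , far G side (dartAt G side v i)

  answer-edgeAt : ∀ {κ} (G : Multigraph n κ) side v j →
    answer G (edgeAt (port κ side) v j) ≡ nth (sideDegree G side v) (neighbourAt G side v) j
  answer-edgeAt (dir G)   forward  v j = refl
  answer-edgeAt (dir G)   backward v j = refl
  answer-edgeAt (undir G) forward  v j = refl
  answer-edgeAt (undir G) backward v j = refl

  near-dartAt : ∀ {κ} (G : Multigraph n κ) side v i → near G side (dartAt G side v i) ≡ v
  near-dartAt (dir G)   forward  v i = cong proj₁ (Inverse.strictlyInverseˡ (Digraph.outs G) (v , i))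
  near-dartAt (dir G)   backward v i = cong proj₁ (Inverse.strictlyInverseˡ (Digraph.ins G) (v , i))
  near-dartAt (undir G) forward  v i = cong proj₁ (Inverse.strictlyInverseˡ (Ugraph.ends G) (v , i))
  near-dartAt (undir G) backward v i = trans
    (cong (Ugraph.end G _) (Bool.not-involutive _))
    (cong proj₁ (Inverse.strictlyInverseˡ (Ugraph.ends G) (v , i)))

  dartAt-surjective : ∀ {κ} (G : Multigraph n κ) side δ → ∃ λ i → dartAt G side (near G side δ) i ≡ δ
  dartAt-surjective (dir G)   forward  e       = _ , Inverse.strictlyInverseʳ (Digraph.outs G) e
  dartAt-surjective (dir G)   backward e       = _ , Inverse.strictlyInverseʳ (Digraph.ins G) e
  dartAt-surjective (undir G) forward  δ       = _ , Inverse.strictlyInverseʳ (Ugraph.ends G) δ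
  dartAt-surjective (undir G) backward (e , b) = _ , trans
    (cong (λ (e , b) → e , not b) (Inverse.strictlyInverseʳ (Ugraph.ends G) (e , not b)))
    (cong (e ,_) (Bool.not-involutive b))

  from-injective : ∀ {X Y : Set} (f : X ↔ Y) {x y} → Inverse.from f x ≡ Inverse.from f y → x ≡ y
  from-injective f {x} {y} eq = trans (sym (Inverse.strictlyInverseˡ f x))
    (trans (cong (Inverse.to f) eq) (Inverse.strictlyInverseˡ f y))

  dartAt-injective : ∀ {κ} (G : Multigraph n κ) side {v i j} →
                     dartAt G side v i ≡ dartAt G side v j → i ≡ j
  dartAt-injective G side {v} eq = ,-injective (slot-injective G side eq)
    where
    ,-injective : ∀ {i j} → _≡_ {A = Σ (Fin n) (Fin ∘ sideDegree G side)} (v , i) (v , j) → i ≡ j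
    ,-injective refl = refl
    slot-injective : ∀ {κ} (G : Multigraph n κ) side {v i w j} → dartAt G side v i ≡ dartAt G side w j →
      _≡_ {A = Σ (Fin n) (Fin ∘ sideDegree G side)} (v , i) (w , j)
    slot-injective (dir G)   forward  eq = from-injective (Digraph.outs G) eq
    slot-injective (dir G)   backward eq = from-injective (Digraph.ins G) eq
    slot-injective (undir G) forward  eq = from-injective (Ugraph.ends G) eq
    slot-injective (undir G) backward eq = from-injective (Ugraph.ends G)
      (cong₂ _,_ (cong proj₁ eq) (Bool.not-injective (cong proj₂ eq)))

  -- A pigeonhole on the at most two directions of an edge; it bounds how many darts a single edge
  -- query can hit.
  atMostTwoDarts : ∀ {κ} (G : Multigraph n κ) {α β γ} → ident G α ≡ ident G β → ident G β ≡ ident G γ →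
                   α ≡ β ⊎ β ≡ γ ⊎ α ≡ γ
  atMostTwoDarts (dir G) p q = inj₁ (Fin.toℕ-injective p)
  atMostTwoDarts (undir G) {e , a} {f , b} {g , c} p q
    with Fin.toℕ-injective p | Fin.toℕ-injective q
  ... | refl | refl with a Bool.≟ b | b Bool.≟ c
  ... | yes refl | _        = inj₁ refl
  ... | no _     | yes refl = inj₂ (inj₁ refl)
  ... | no a≢b   | no b≢c   = inj₂ (inj₂ (cong (e ,_) (trans (Bool.¬-not a≢b) (sym (Bool.¬-not (b≢c ∘ sym))))))

  -- A path may use an undirected edge against the given dart. The two darts of an edge have their
  -- ends exchanged, hence the two alternatives.
  sameEnds : ∀ {κ} (G : Multigraph n κ) {γ δ} → edge G γ ≡ edge G δ → ∀ s side →
             near G s δ ≡ near G side γ ⊎ near G s δ ≡ far G side γ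
  sameEnds (dir G) refl forward  forward  = inj₁ refl
  sameEnds (dir G) refl forward  backward = inj₂ refl
  sameEnds (dir G) refl backward forward  = inj₂ refl
  sameEnds (dir G) refl backward backward = inj₁ refl
  sameEnds (undir G) {e , b} {_ , c} refl s side = go s side
    where
    one : ∀ x y → Ugraph.end G e x ≡ Ugraph.end G e y ⊎ Ugraph.end G e x ≡ Ugraph.end G e (not y)
    one false false = inj₁ refl
    one false true  = inj₂ refl
    one true  false = inj₂ refl
    one true  true  = inj₁ refl
    other : ∀ x y → Ugraph.end G e x ≡ Ugraph.end G e (not y) ⊎ Ugraph.end G e x ≡ Ugraph.end G e y
    other false false = inj₂ refl
    other false true  = inj₁ refl
    other true  false = inj₁ refl
    other true  true  = inj₂ refl
    go : ∀ s side → near (undir G) s (e , c) ≡ near (undir G) side (e , b)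
                    ⊎ near (undir G) s (e , c) ≡ far (undir G) side (e , b)
    go forward  forward  = one c b
    go forward  backward = other c b
    go backward forward  = one (not c) b
    go backward backward = other (not c) b

  dartArc : ∀ {κ} (G : Multigraph n κ) δ → Arc G (edge G δ) (near G forward δ) (near G backward δ)
  dartArc (dir G)   e       = refl , refl
  dartArc (undir G) (e , b) = b , refl , refl

  arcDart : ∀ {κ} (G : Multigraph n κ) {e u v} → Arc G e u v →
            ∃ λ δ → edge G δ ≡ e × near G forward δ ≡ u × near G backward δ ≡ v
  arcDart (dir G)   {e} (p , q)     = e , refl , p , q
  arcDart (undir G) {e} (b , p , q) = (e , b) , refl , p , q

  edge? : ∀ {κ} (G : Multigraph n κ) → DecidableEquality (Edge G)
  edge? (dir G)   = Fin._≟_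
  edge? (undir G) = Fin._≟_

-- A path follows the direction of the execution on its side: a backward path
-- from t to v is a walk in G from v to t.
data Path {n κ} (G : Multigraph n κ) (P : Dart G → Set) (side : Side) (r : Fin n) : ℕ → Fin n → Set where
  []     : Path G P side r 0 r
  snoc : ∀ {l} (δ : Dart G) → P δ → Path G P side r l (near G side δ) → Path G P side r (suc l) (far G side δ)

Any-dart : ∀ {n κ} (G : Multigraph n κ) → Dart G → Set
Any-dart G _ = ⊤

module _ {n κ} (G : Multigraph n κ) where

  mapPath : ∀ {P Q : Dart G → Set} {side r l v} → (∀ {δ} → P δ → Q δ) →
            Path G P side r l v → Path G Q side r l v
  mapPath f []           = []
  mapPath f (snoc δ p w) = snoc δ (f p) (mapPath f w)

  -- The same dart is traversed from its other end. Matching on `side` lets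
  -- `opposite (opposite side)` reduce.
  move : ∀ {P : Dart G → Set} {side y q} δ → P δ →
         Path G P (opposite side) y q (far G side δ) → Path G P (opposite side) y (suc q) (near G side δ)
  move {side = forward}  δ p w = snoc δ p w
  move {side = backward} δ p w = snoc δ p w

  joinPath : ∀ {P : Dart G → Set} {side x y p q v} → Path G P side x p v →
             Path G P (opposite side) y q v → Path G P (opposite side) y (p + q) x
  joinPath []           w′ = w′
  joinPath {P} {side} {x} {y} {q = q} (snoc {l} δ pδ w) w′ =
    subst (λ k → Path G P (opposite side) y k x) (ℕ.+-suc l q) (joinPath w (move {side = side} δ pδ w′))

  -- Darts move from the first walk to the second one until at most a remain.
  meet : ∀ {P : Dart G → Set} {side x y} p q a {b v} → Path G P side x p v →
         Path G P (opposite side) y q v → q ≤ b → p + q ≤ a + b →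
         ∃₂ λ i j → ∃ λ u → Path G P side x i u × Path G P (opposite side) y j u
                          × i ≤ a × j ≤ b × i + j ≡ p + q
  meet p q a w w′ q≤b le with p ≤? a
  ... | yes p≤a = p , q , _ , w , w′ , p≤a , q≤b , refl
  meet p q a [] w′ q≤b le | no p≰a = contradiction z≤n p≰a
  -- The second walk still has room for a dart: `b ≤ q` and `suc p + q ≤ a + b` would give
  -- `suc p ≤ a`.
  meet {side = side} (suc p) q a {b} (snoc δ pδ w) w′ q≤b le | no p≰a
    with meet p (suc q) a w (move {side = side} δ pδ w′)
           (ℕ.≰⇒> λ b≤q → p≰a (ℕ.+-cancelʳ-≤ q (suc p) a (ℕ.≤-trans le (ℕ.+-monoʳ-≤ a b≤q))))
           (subst (_≤ a + b) (sym (ℕ.+-suc p q)) le)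
  ... | i , j , u , v , v′ , i≤a , j≤b , eq = i , j , u , v , v′ , i≤a , j≤b , trans eq (ℕ.+-suc p q)

  walkPath : ∀ {u es v} → Walk G u es v → Path G (Any-dart G) backward v (length es) u
  walkPath []      = []
  walkPath (a ∷ w) with arcDart G a
  ... | δ , refl , refl , refl = snoc δ tt (walkPath w)

  walkPath′ : ∀ {u es v} → Walk G u es v → Path G (Any-dart G) forward u (length es) v
  walkPath′ {u} {es} {v} w = subst (λ l → Path G (Any-dart G) forward u l v)
    (ℕ.+-identityʳ (length es)) (joinPath {side = backward} (walkPath w) [])

  pathWalk : ∀ {P : Dart G → Set} {u l v} → Path G P backward v l u →
             ∃ λ es → Walk G u es v × length es ≡ l
  pathWalk []           = [] , [] , refl
  pathWalk (snoc δ _ w) with pathWalk w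
  ... | es , w′ , refl = _ , dartArc G δ ∷ w′ , refl

  -- Treating the prefix before the last dart finds the first use of `e`, so the part before it
  -- avoids `e`. The dart found there may traverse `e` in either direction.
  cutPath : ∀ {P : Dart G → Set} {side r l v} e → Path G P side r l v →
            Path G (λ γ → P γ × edge G γ ≢ e) side r l v
            ⊎ ∃₂ λ δ l′ → edge G δ ≡ e × l′ ≤ l × Path G (λ γ → P γ × edge G γ ≢ e) side r l′ (near G side δ)
  cutPath e [] = inj₁ []
  cutPath e (snoc γ p w) with cutPath e w
  ... | inj₂ (δ , l′ , eq , l′≤l , w′) = inj₂ (δ , l′ , eq , ℕ.m≤n⇒m≤1+n l′≤l , w′)
  ... | inj₁ w′ with edge? G (edge G γ) e
  ... | yes eq = inj₂ (γ , _ , eq , ℕ.n≤1+n _ , w′)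
  ... | no ≢e  = inj₁ (snoc γ (p , ≢e) w′)

  -- Whichever way a path traverses an edge, it passes both ends, so both ends of `δ` are available
  -- for a contradiction.
  avoidOrVisit : ∀ {P : Dart G → Set} {side r l v} δ → Path G P side r l v →
                 Path G (λ γ → P γ × edge G γ ≢ edge G δ) side r l v
                 ⊎ ∀ s → ∃ λ l′ → l′ ≤ l × Path G P side r l′ (near G s δ)
  avoidOrVisit δ [] = inj₁ []
  avoidOrVisit {P} {side} {r} δ (snoc γ p w) with avoidOrVisit δ w
  ... | inj₂ visit = inj₂ λ s → let (l′ , l′≤l , w′) = visit s in l′ , ℕ.m≤n⇒m≤1+n l′≤l , w′
  ... | inj₁ w′ with edge? G (edge G γ) (edge G δ)
  ... | no ≢e  = inj₁ (snoc γ (p , ≢e) w′)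
  ... | yes eq = inj₂ visit
    where
    visit : ∀ s → ∃ λ l′ → l′ ≤ suc _ × Path G P side r l′ (near G s δ)
    visit s with sameEnds G eq s side
    ... | inj₁ e≡ = _ , ℕ.n≤1+n _ , subst (Path G P side r _) (sym e≡) w
    ... | inj₂ e≡ = _ , ℕ.≤-refl , subst (Path G P side r _) (sym e≡) (snoc γ p w)

-- Transpositions and the graph with exchanged heads

module _ {X : Set} (_≟_ : DecidableEquality X) where

  transposeAt : X → X → X → X
  transposeAt x y z with z ≟ x | z ≟ y
  ... | yes _ | _     = y
  ... | no _  | yes _ = x
  ... | no _  | no _  = z

  transposeAt-left : ∀ x y → transposeAt x y x ≡ y
  transposeAt-left x y with x ≟ x
  ... | yes _ = refl
  ... | no x≢ = contradiction refl x≢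

  transposeAt-right : ∀ x y → transposeAt x y y ≡ x
  transposeAt-right x y with y ≟ x | y ≟ y
  ... | yes y≡x | _     = y≡x
  ... | no _    | yes _ = refl
  ... | no _    | no y≢ = contradiction refl y≢

  transposeAt-fixed : ∀ {x y z} → z ≢ x → z ≢ y → transposeAt x y z ≡ z
  transposeAt-fixed {x} {y} {z} z≢x z≢y with z ≟ x | z ≟ y
  ... | yes z≡x | _       = contradiction z≡x z≢x
  ... | no _    | yes z≡y = contradiction z≡y z≢y
  ... | no _    | no _    = refl

  transposeAt-involutive : ∀ x y z → transposeAt x y (transposeAt x y z) ≡ z
  transposeAt-involutive x y z with z ≟ x | z ≟ y
  ... | yes z≡x | _       = trans (transposeAt-right x y) (sym z≡x)
  ... | no _    | yes z≡y = trans (transposeAt-left x y) (sym z≡y)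
  ... | no z≢x  | no z≢y  = transposeAt-fixed z≢x z≢y

  transposition : X → X → X ↔ X
  transposition x y = mk↔ₛ′ (transposeAt x y) (transposeAt x y)
    (transposeAt-involutive x y) (transposeAt-involutive x y)

infix 4 _≟ₑ_
_≟ₑ_ : ∀ {m} → DecidableEquality (Fin m × Bool)
_≟ₑ_ = Product.≡-dec Fin._≟_ Bool._≟_

-- Composing an incidence bijection with a transposition exchanges the heads
-- of δ₁ and δ₂ and preserves all degrees.
swap : ∀ {n κ} (G : Multigraph n κ) → Dart G → Dart G → Multigraph n κ
swap (dir G) e f = dir record
  { size = size ; outdeg = outdeg ; indeg = indeg ; outs = outs ; ins = ins ↔-∘ transposition Fin._≟_ e f }
  where open Digraph G
swap (undir G) (e , b) (f , c) = undir record
  { size = size ; deg = deg ; ends = ends ↔-∘ transposition _≟ₑ_ (e , not b) (f , not c) }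
  where open Ugraph G

equalsOneOf : ∀ {m} (g e f : Fin m) → g ≡ e ⊎ g ≡ f ⊎ (g ≢ e × g ≢ f)
equalsOneOf g e f with g Fin.≟ e | g Fin.≟ f
... | yes g≡e | _       = inj₁ g≡e
... | no _    | yes g≡f = inj₂ (inj₁ g≡f)
... | no g≢e  | no g≢f  = inj₂ (inj₂ (g≢e , g≢f))

nth-differ : ∀ {n d} {f g : Fin d → ℕ × Fin n} {a b} →
  (∀ i → f i ≡ g i ⊎ proj₁ (f i) ≡ a ⊎ proj₁ (f i) ≡ b) →
  ∀ j → nth d f j ≡ nth d g j ⊎ (∃ λ w → nth d f j ≡ just (a , w)) ⊎ (∃ λ w → nth d f j ≡ just (b , w))
nth-differ {d = d} h j with j <? d
... | no _ = inj₁ refl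
... | yes j<d with h (fromℕ< j<d)
... | inj₁ eq          = inj₁ (cong just eq)
... | inj₂ (inj₁ refl) = inj₂ (inj₁ (_ , refl))
... | inj₂ (inj₂ refl) = inj₂ (inj₂ (_ , refl))

Mentions : ∀ {n κ} → Multigraph n κ → ℕ → Query n κ → Set
Mentions G i (degreeOf _ _)   = ⊥
Mentions G i q@(edgeAt _ _ _) = ∃ λ w → answer G q ≡ just (i , w)

-- Degrees do not change, and an edge other than the two keeps its slots and its ends. The
-- difference is stated through the answer in `G` alone because the queries are charged in the run
-- on `G`.
swap-answer : ∀ {n κ} (G : Multigraph n κ) δ₁ δ₂ q →
  answer G q ≡ answer (swap G δ₁ δ₂) q ⊎ Mentions G (ident G δ₁) q ⊎ Mentions G (ident G δ₂) q
swap-answer (dir G)   e f (degreeOf outgoing v) = inj₁ refl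
swap-answer (dir G)   e f (degreeOf incoming v) = inj₁ refl
swap-answer (undir G) e f (degreeOf incident v) = inj₁ refl
swap-answer (dir G) e f (edgeAt outgoing v j) = nth-differ go j
  where
  open Digraph G
  τ : Fin size → Fin size
  τ = transposeAt Fin._≟_ e f
  go : ∀ i → let g = Inverse.from outs (v , i) in
       _≡_ {A = ℕ × Fin _} (toℕ g , head g) (toℕ g , proj₁ (Inverse.to ins (τ g)))
       ⊎ toℕ g ≡ toℕ e ⊎ toℕ g ≡ toℕ f
  go i with Inverse.from outs (v , i) Fin.≟ e | Inverse.from outs (v , i) Fin.≟ f
  ... | yes refl | _        = inj₂ (inj₁ refl)
  ... | no _     | yes refl = inj₂ (inj₂ refl)
  ... | no ≢e    | no ≢f    = inj₁ refl
swap-answer (dir G) e f (edgeAt incoming v j) = nth-differ go j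
  where
  open Digraph G
  τ : Fin size → Fin size
  τ = transposeAt Fin._≟_ e f
  go : ∀ i → let g = Inverse.from ins (v , i) in
       _≡_ {A = ℕ × Fin _} (toℕ g , tail g) (toℕ (τ g) , tail (τ g))
       ⊎ toℕ g ≡ toℕ e ⊎ toℕ g ≡ toℕ f
  go i with Inverse.from ins (v , i) Fin.≟ e | Inverse.from ins (v , i) Fin.≟ f
  ... | yes refl | _        = inj₂ (inj₁ refl)
  ... | no _     | yes refl = inj₂ (inj₂ refl)
  ... | no ≢e    | no ≢f    = inj₁ refl
swap-answer (undir G) (e , b) (f , c) (edgeAt incident v j) = nth-differ go j
  where
  open Ugraph G
  τ : Fin size × Bool → Fin size × Bool
  τ = transposeAt _≟ₑ_ (e , not b) (f , not c)
  go : ∀ i → let (g , d) = Inverse.from ends (v , i) ; (g′ , d′) = τ (g , d) in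
       _≡_ {A = ℕ × Fin _} (toℕ g , end g (not d)) (toℕ g′ , proj₁ (Inverse.to ends (τ (g′ , not d′))))
       ⊎ toℕ g ≡ toℕ e ⊎ toℕ g ≡ toℕ f
  go i = case (Inverse.from ends (v , i)) (equalsOneOf (proj₁ (Inverse.from ends (v , i))) e f)
    where
    fixed : ∀ {g} x → g ≢ e → g ≢ f → τ (g , x) ≡ (g , x)
    fixed x ≢e ≢f = transposeAt-fixed _≟ₑ_ (≢e ∘ cong proj₁) (≢f ∘ cong proj₁)
    case : ∀ ((g , d) : Fin size × Bool) → g ≡ e ⊎ g ≡ f ⊎ (g ≢ e × g ≢ f) →
      let (g′ , d′) = τ (g , d) in
      _≡_ {A = ℕ × Fin _} (toℕ g , end g (not d)) (toℕ g′ , proj₁ (Inverse.to ends (τ (g′ , not d′))))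
      ⊎ toℕ g ≡ toℕ e ⊎ toℕ g ≡ toℕ f
    case _       (inj₁ refl)             = inj₂ (inj₁ refl)
    case _       (inj₂ (inj₁ refl))      = inj₂ (inj₂ refl)
    case (g , d) (inj₂ (inj₂ (≢e , ≢f))) = inj₁ (trans
      (cong (λ x → toℕ g , proj₁ (Inverse.to ends x)) (sym (fixed (not d) ≢e ≢f)))
      (cong (λ (g , d) → toℕ g , proj₁ (Inverse.to ends (τ (g , not d)))) (sym (fixed d ≢e ≢f))))

-- swap changes neither the type of darts nor the edge of a dart.
toSwap : ∀ {n κ} (G : Multigraph n κ) {δ₁ δ₂} → Dart G → Dart (swap G δ₁ δ₂)
toSwap (dir G)   δ = δ
toSwap (undir G) δ = δ

toSwap-near : ∀ {n κ} (G : Multigraph n κ) {δ₁ δ₂ γ} side → edge G γ ≢ edge G δ₁ → edge G γ ≢ edge G δ₂ →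
              near (swap G δ₁ δ₂) side (toSwap G γ) ≡ near G side γ
toSwap-near (dir G)   forward  ≢₁ ≢₂ = refl
toSwap-near (dir G)   backward ≢₁ ≢₂ =
  cong (proj₁ ∘ Inverse.to (Digraph.ins G)) (transposeAt-fixed Fin._≟_ ≢₁ ≢₂)
toSwap-near (undir G) forward  ≢₁ ≢₂ =
  cong (proj₁ ∘ Inverse.to (Ugraph.ends G)) (transposeAt-fixed _≟ₑ_ (≢₁ ∘ cong proj₁) (≢₂ ∘ cong proj₁))
toSwap-near (undir G) backward ≢₁ ≢₂ =
  cong (proj₁ ∘ Inverse.to (Ugraph.ends G)) (transposeAt-fixed _≟ₑ_ (≢₁ ∘ cong proj₁) (≢₂ ∘ cong proj₁))

-- If `δ₂` were the reverse of `δ₁`, its head would be the very end that serves as the tail of `δ₁`,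
-- and the transposition would move it.
toSwap-tail : ∀ {n κ} (G : Multigraph n κ) δ₁ δ₂ → edge G δ₁ ≢ edge G δ₂ →
              near (swap G δ₁ δ₂) forward (toSwap G δ₁) ≡ near G forward δ₁
toSwap-tail (dir G)   δ₁ δ₂ ≢ = refl
toSwap-tail (undir G) (e , b) δ₂ ≢ = cong (proj₁ ∘ Inverse.to (Ugraph.ends G))
  (transposeAt-fixed _≟ₑ_ (Bool.not-¬ refl ∘ cong proj₂) (≢ ∘ cong proj₁))

toSwap-head : ∀ {n κ} (G : Multigraph n κ) δ₁ δ₂ →
              near (swap G δ₁ δ₂) backward (toSwap G δ₁) ≡ near G backward δ₂
toSwap-head (dir G)   e f = cong (proj₁ ∘ Inverse.to (Digraph.ins G)) (transposeAt-left Fin._≟_ e f)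
toSwap-head (undir G) (e , b) (f , c) =
  cong (proj₁ ∘ Inverse.to (Ugraph.ends G)) (transposeAt-left _≟ₑ_ (e , not b) (f , not c))

Avoiding : ∀ {n κ} (G : Multigraph n κ) → Dart G → Dart G → Dart G → Set
Avoiding G δ₁ δ₂ γ = edge G γ ≢ edge G δ₁ × edge G γ ≢ edge G δ₂

pathInSwap : ∀ {n κ} (G : Multigraph n κ) {δ₁ δ₂ side r l v} → Path G (Avoiding G δ₁ δ₂) side r l v →
             Path (swap G δ₁ δ₂) (Any-dart (swap G δ₁ δ₂)) side r l v
pathInSwap G [] = []
pathInSwap G {δ₁} {δ₂} {side} {r} (snoc {l} δ (≢₁ , ≢₂) w) =
  subst (Path (swap G δ₁ δ₂) _ side r (suc l)) (toSwap-near G (opposite side) ≢₁ ≢₂)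
    (snoc (toSwap G δ) tt (subst (Path (swap G δ₁ δ₂) _ side r l) (sym (toSwap-near G side ≢₁ ≢₂))
      (pathInSwap G w)))

module _ {n κ} (G : Multigraph n κ) (s t : Fin n) where

  LongerThan : ℕ → Set
  LongerThan d = ∀ {es} → Walk G s es t → d < length es

  -- δ₁ and δ₂ are replaced by the first occurrences of their edges on the
  -- given walks, so that both parts of the new walk survive the exchange.
  swap-shortens : ∀ {p q} δ₁ δ₂ → LongerThan (p + suc q) →
    Path G (Any-dart G) forward s p (near G forward δ₁) →
    Path G (Any-dart G) backward t q (near G backward δ₂) →
    ∃₂ λ γ₁ γ₂ → edge G γ₁ ≡ edge G δ₁ × edge G γ₂ ≡ edge G δ₂ ×
    ∃ λ es → Walk (swap G γ₁ γ₂) s es t × length es ≤ p + suc q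
  swap-shortens {p} {q} δ₁ δ₂ longer w₁ w₂ with firstUse forward δ₁ w₁ | firstUse backward δ₂ w₂
    where
    firstUse : ∀ side {r l} δ → Path G (Any-dart G) side r l (near G side δ) →
      ∃₂ λ γ l′ → edge G γ ≡ edge G δ × l′ ≤ l × Path G (λ α → ⊤ × edge G α ≢ edge G δ) side r l′ (near G side γ)
    firstUse side δ w with cutPath G (edge G δ) w
    ... | inj₁ w′    = δ , _ , refl , ℕ.≤-refl , w′
    ... | inj₂ first = first
  ... | γ₁ , p′ , eq₁ , p′≤p , v₁ | γ₂ , q′ , eq₂ , q′≤q , v₂ =
    γ₁ , γ₂ , eq₁ , eq₂ , newWalk
    where
    noMeeting : ∀ {i j x} → Path G (Any-dart G) forward s i x → Path G (Any-dart G) backward t j x →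
                i ≤ p → j ≤ suc q → ⊥
    -- A common vertex would give an st-walk of `G` that is too short. The extra 1 allowed for `j`
    -- pays for `γ₁` itself in `γ₁≢γ₂`.
    noMeeting {i} {j} w w′ i≤p j≤q with pathWalk G (joinPath G {side = forward} w w′)
    ... | es , u , eq = ℕ.<-irrefl refl (ℕ.<-≤-trans (longer u)
      (subst (_≤ p + suc q) (sym eq) (ℕ.+-mono-≤ i≤p j≤q)))

    forget : ∀ {P : Dart G → Set} {side r l v} → Path G P side r l v → Path G (Any-dart G) side r l v
    forget = mapPath G (λ _ → tt)

    u₁ : Path G (Avoiding G γ₁ γ₂) forward s p′ (near G forward γ₁)
    u₁ with avoidOrVisit G γ₂ v₁
    ... | inj₁ w = mapPath G (λ ((_ , ≢₁) , ≢₂) → subst (_ ≢_) (sym eq₁) ≢₁ , ≢₂) w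
    ... | inj₂ visit with visit backward
    -- Using the edge of `γ₂`, the forward path would pass the head of `γ₂`, where the backward path
    -- ends.
    ... | l , l≤p′ , w = ⊥-elim (noMeeting (forget w) (forget v₂) (ℕ.≤-trans l≤p′ p′≤p) (ℕ.m≤n⇒m≤1+n q′≤q))

    u₂ : Path G (Avoiding G γ₁ γ₂) backward t q′ (near G backward γ₂)
    u₂ with avoidOrVisit G γ₁ v₂
    ... | inj₁ w = mapPath G (λ ((_ , ≢₂) , ≢₁) → ≢₁ , subst (_ ≢_) (sym eq₂) ≢₂) w
    ... | inj₂ visit with visit forward
    ... | l , l≤q′ , w = ⊥-elim (noMeeting (forget v₁) (forget w) p′≤p (ℕ.m≤n⇒m≤1+n (ℕ.≤-trans l≤q′ q′≤q)))

    γ₁≢γ₂ : edge G γ₁ ≢ edge G γ₂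
    γ₁≢γ₂ eq with sameEnds G eq backward forward
    -- Either `γ₂` enters the vertex that `γ₁` leaves, and the two paths meet there, or both enter
    -- the same vertex, and `γ₁` connects the paths.
    ... | inj₁ e≡ = noMeeting (subst (Path G _ forward s p′) (sym e≡) (forget v₁)) (forget v₂) p′≤p (ℕ.m≤n⇒m≤1+n q′≤q)
    ... | inj₂ e≡ = noMeeting (forget v₁) (snoc γ₁ tt (subst (Path G _ backward t q′) e≡ (forget v₂))) p′≤p (s≤s q′≤q)

    newWalk : ∃ λ es → Walk (swap G γ₁ γ₂) s es t × length es ≤ p + suc q
    -- The new walk follows the forward path to the tail of `γ₁`, then `γ₁` to its new head, the old
    -- head of `γ₂`, then the backward path to `t`.
    newWalk with pathWalk G′ (joinPath G′ {side = forward}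
        (subst (Path G′ _ forward s p′) (sym (toSwap-tail G γ₁ γ₂ γ₁≢γ₂)) (pathInSwap G u₁))
        (snoc (toSwap G γ₁) tt (subst (Path G′ _ backward t q′) (sym (toSwap-head G γ₁ γ₂)) (pathInSwap G u₂))))
      where G′ = swap G γ₁ γ₂
    ... | es , w , eq = es , w , subst (_≤ p + suc q) (sym eq) (ℕ.+-mono-≤ p′≤p (s≤s q′≤q))

-- The lower bound for a correct algorithm

-- Bounds on nondecreasing sequences persist once they hold. In this form they are closed under
-- finite conjunction, which yields one horizon common to all graphs considered.
Eventually : (ℕ → Set) → Set
Eventually P = ∃ λ K → ∀ k → K ≤ k → P k

eventually-× : ∀ {P Q} → Eventually P → Eventually Q → Eventually (λ k → P k × Q k)
eventually-× (K , p) (L , q) = K ⊔ L , λ k le →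
  p k (ℕ.≤-trans (ℕ.m≤m⊔n K L) le) , q k (ℕ.≤-trans (ℕ.m≤n⊔m K L) le)

eventually-Fin : ∀ {m} {P : Fin m → ℕ → Set} → (∀ i → Eventually (P i)) → Eventually (λ k → ∀ i → P i k)
eventually-Fin {zero}  f = 0 , λ k _ ()
eventually-Fin {suc m} f with eventually-× (f zero) (eventually-Fin (f ∘ suc))
... | K , p = K , λ where
  k le zero    → proj₁ (p k le)
  k le (suc i) → proj₂ (p k le) i

eventually-Dart : ∀ {n κ} (G : Multigraph n κ) {P : Dart G → ℕ → Set} →
                  (∀ δ → Eventually (P δ)) → Eventually (λ k → ∀ δ → P δ k)
eventually-Dart (dir G)   f = eventually-Fin f
eventually-Dart (undir G) f with eventually-Fin (λ e → eventually-× (f (e , false)) (f (e , true)))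
... | K , p = K , λ where
  k le (e , false) → proj₁ (p k le e)
  k le (e , true)  → proj₂ (p k le e)

𝟙 : ∀ {P : Set} → Dec P → ℚ
𝟙 p = if does p then 1ℚ else 0ℚ

0≤𝟙 : ∀ {P : Set} (p : Dec P) → 0ℚ ℚ.≤ 𝟙 p
0≤𝟙 (yes _) = from-yes (0ℚ ℚ.≤? 1ℚ)
0≤𝟙 (no _)  = ℚ.≤-refl

1≤𝟙 : ∀ {P : Set} (p : Dec P) → P → 1ℚ ℚ.≤ 𝟙 p
1≤𝟙 (yes _) _ = ℚ.≤-refl
1≤𝟙 (no ¬p) p = contradiction p ¬p

𝟙≤1 : ∀ {P : Set} (p : Dec P) → 𝟙 p ℚ.≤ 1ℚ
𝟙≤1 (yes _) = ℚ.≤-refl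
𝟙≤1 (no _)  = from-yes (0ℚ ℚ.≤? 1ℚ)

𝟙-exclusive : ∀ {P Q : Set} (p : Dec P) (q : Dec Q) → ¬ (P × Q) → 𝟙 p ℚ.+ 𝟙 q ℚ.≤ 1ℚ
𝟙-exclusive (yes p) (yes q) ¬pq = contradiction (p , q) ¬pq
𝟙-exclusive (yes _) (no _)  _   = ℚ.≤-refl
𝟙-exclusive (no _)  (yes _) _   = ℚ.≤-refl
𝟙-exclusive (no _)  (no _)  _   = from-yes (0ℚ ℚ.+ 0ℚ ℚ.≤? 1ℚ)

-- Any success bound strictly between 1/2 and 9/10 would do. With `¾`, telling two graphs apart
-- costs `¾` + `¾` - 1 = `½`, of which one of two edges bears at least `¼`.
¾ ½ ¼ : ℚ
¾ = + 3 / 4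
½ = + 1 / 2
¼ = + 1 / 4

totalDegree : ∀ {n κ} → Multigraph n κ → Side → List (Fin n) → ℕ
totalDegree G side = ListAction.sum ∘ map (sideDegree G side)

dartsOf : ∀ {n κ} (G : Multigraph n κ) → Side → List (Fin n) → List (Dart G)
dartsOf G side []       = []
dartsOf G side (v ∷ vs) = map (dartAt G side v) (allFin (sideDegree G side v)) ++ dartsOf G side vs

module _ {n κ} (G : Multigraph n κ) (side : Side) where

  length-dartsOf : ∀ vs → length (dartsOf G side vs) ≡ totalDegree G side vs
  length-dartsOf []       = refl
  length-dartsOf (v ∷ vs) = trans (List.length-++ darts)
    (cong₂ _+_ (trans (List.length-map (dartAt G side v) (allFin d)) (List.length-tabulate {n = d} (λ i → i)))
      (length-dartsOf vs))
    where
    d : ℕ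
    d = sideDegree G side v
    darts : List (Dart G)
    darts = map (dartAt G side v) (allFin d)

  ∈-dartsOf : ∀ vs {δ} → δ ∈ dartsOf G side vs → near G side δ ∈ vs
  ∈-dartsOf (v ∷ vs) δ∈ with ∈.∈-++⁻ (map (dartAt G side v) (allFin (sideDegree G side v))) δ∈
  ... | inj₂ δ∈vs = there (∈-dartsOf vs δ∈vs)
  ... | inj₁ δ∈v with ∈.∈-map⁻ (dartAt G side v) δ∈v
  ... | i , _ , refl = here (near-dartAt G side v i)

  dartsOf-unique : ∀ {vs} → Unique vs → Unique (dartsOf G side vs)
  dartsOf-unique []               = []
  dartsOf-unique {v ∷ vs} (v∉ ∷ u) = Unique.++⁺
    (Unique.map⁺ (dartAt-injective G side) (Unique.allFin⁺ _)) (dartsOf-unique u) λ (δ∈v , δ∈vs) →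
      let (i , _ , eq) = ∈.∈-map⁻ (dartAt G side v) δ∈v in
      All.lookup v∉ (∈-dartsOf vs δ∈vs) (sym (trans (cong (near G side) eq) (near-dartAt G side v i)))

-- Counting the queries that return a given edge

module _ {κ} (A : Algorithm κ) {n} (G : Multigraph n κ) where
  open Algorithm A using (State; start)

  0≤cost : ∀ M (a : Action n κ (State n)) → 0ℚ ℚ.≤ cost M a
  0≤cost time    _           = from-yes (0ℚ ℚ.≤? 1ℚ)
  0≤cost queries (query _ _) = from-yes (0ℚ ℚ.≤? 1ℚ)
  0≤cost queries (return _)  = ℚ.≤-refl
  0≤cost queries (compute _) = ℚ.≤-refl
  0≤cost queries (toss _ _)  = ℚ.≤-refl

  mentions : ℕ → Maybe (ℕ × Fin n) → ℚ
  mentions i (just (j , _)) = 𝟙 (i ℕ.≟ j)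
  mentions i nothing        = 0ℚ

  -- Its expectation is the expected number of queries returning edge `i`, repetitions included, so
  -- that summing over edges is just linearity.
  hits : ℕ → Reward A G
  hits i (query q@(edgeAt _ _ _) _) = mentions i (answer G q)
  hits i _                          = 0ℚ

  0≤hits : ∀ i a → 0ℚ ℚ.≤ hits i a
  0≤hits i (return _)  = ℚ.≤-refl
  0≤hits i (compute _) = ℚ.≤-refl
  0≤hits i (toss _ _)  = ℚ.≤-refl
  0≤hits i (query (degreeOf _ _) _) = ℚ.≤-refl
  0≤hits i (query q@(edgeAt _ _ _) _) with answer G q
  ... | just (j , _) = 0≤𝟙 (i ℕ.≟ j)
  ... | nothing      = ℚ.≤-refl

  1≤hits : ∀ {i} q g → Mentions G i q → 1ℚ ℚ.≤ hits i (query q g)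
  1≤hits {i} q@(edgeAt _ _ _) g (w , eq) rewrite eq = 1≤𝟙 (i ℕ.≟ i) refl

  sumOver-𝟙 : ∀ {X : Set} {P : X → Set} (P? : ∀ x → Dec (P x)) xs →
              sumOver xs (𝟙 ∘ P?) ≡ ⟦ length (filter P? xs) ⟧
  sumOver-𝟙 P? []       = refl
  sumOver-𝟙 P? (x ∷ xs) with P? x
  ... | yes _ = trans (cong (1ℚ ℚ.+_) (sumOver-𝟙 P? xs)) (sym (⟦⟧-homo-+ 1 (length (filter P? xs))))
  ... | no _  = trans (ℚ.+-identityˡ _) (sumOver-𝟙 P? xs)

  sumOver-0 : ∀ {X : Set} (xs : List X) → sumOver xs (λ _ → 0ℚ) ≡ 0ℚ
  sumOver-0 []       = refl
  sumOver-0 (_ ∷ xs) = trans (ℚ.+-identityˡ _) (sumOver-0 xs)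

  sumOver-hits : ∀ {δs} → Unique δs → ∀ a →
                 sumOver δs (λ δ → hits (ident G δ) a) ℚ.≤ cost queries a ℚ.+ cost queries a
  sumOver-hits {δs} u (return _)  = ℚ.≤-reflexive (sumOver-0 δs)
  sumOver-hits {δs} u (compute _) = ℚ.≤-reflexive (sumOver-0 δs)
  sumOver-hits {δs} u (toss _ _)  = ℚ.≤-reflexive (sumOver-0 δs)
  sumOver-hits {δs} u (query (degreeOf _ _) _) = subst (ℚ._≤ 1ℚ ℚ.+ 1ℚ) (sym (sumOver-0 δs)) (from-yes (0ℚ ℚ.≤? 1ℚ ℚ.+ 1ℚ))
  sumOver-hits {δs} u (query q@(edgeAt _ _ _) _) with answer G q
  ... | nothing      = subst (ℚ._≤ 1ℚ ℚ.+ 1ℚ) (sym (sumOver-0 δs)) (from-yes (0ℚ ℚ.≤? 1ℚ ℚ.+ 1ℚ))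
  ... | just (i , _) = subst (ℚ._≤ 1ℚ ℚ.+ 1ℚ) (sym (sumOver-𝟙 (λ δ → ident G δ ℕ.≟ i) δs))
    (⟦⟧-mono (atMostTwo (Unique.filter⁺ (λ δ → ident G δ ℕ.≟ i) u) (All.all-filter (λ δ → ident G δ ℕ.≟ i) δs)))
    where
    atMostTwo : ∀ {γs} → Unique γs → All (λ δ → ident G δ ≡ i) γs → length γs ≤ 2
    atMostTwo []           _ = z≤n
    atMostTwo (_ ∷ [])     _ = s≤s z≤n
    atMostTwo (_ ∷ _ ∷ []) _ = s≤s (s≤s z≤n)
    atMostTwo ((α≢β ∷ α≢γ ∷ _) ∷ (β≢γ ∷ _) ∷ _ ∷ _) (p ∷ q ∷ r ∷ _)
      with atMostTwoDarts G (trans p (sym q)) (trans q (sym r))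
    ... | inj₁ α≡β        = contradiction α≡β α≢β
    ... | inj₂ (inj₁ β≡γ) = contradiction β≡γ β≢γ
    ... | inj₂ (inj₂ α≡γ) = contradiction α≡γ α≢γ

  module _ (s t : Fin n) where

    success : ℕ → ℚ
    success k = Run.expected A G (onReturn A G (𝟙 ∘ valid? G s t)) k (start s t)

    successProbability≡success : ∀ k → successProbability A G s t k ≡ success k
    successProbability≡success k = expected-cong A G (λ where
      (return _)  → refl
      (compute _) → refl
      (toss _ _)  → refl
      (query _ _) → refl) k (start s t)

    eventually-success : Correct A → s ≢ t → Eventually (λ k → ¾ ℚ.≤ success k)
    eventually-success correct s≢t = K , λ k K≤k → ℚ.≤-trans (subst (¾ ℚ.≤_) (successProbability≡success K) (cancel (proj₂ almost)))
      (expected-increasing A G (λ where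
        (return o)  → 0≤𝟙 (valid? G s t o)
        (compute _) → ℚ.≤-refl
        (toss _ _)  → ℚ.≤-refl
        (query _ _) → ℚ.≤-refl) K≤k (start s t))
      where
      almost : ∃ λ K → + 9 / 10 ℚ.≤ successProbability A G s t K ℚ.+ + 3 / 20
      -- The supremum 9/10 need not be attained. The slack 3/20 is 9/10 - 3/4.
      almost = correct G s t s≢t 0 (+ 3 / 20) (from-yes (0ℚ ℚ.<? + 3 / 20))
      K : ℕ
      K = proj₁ almost
      cancel : ∀ {x} → + 9 / 10 ℚ.≤ x ℚ.+ + 3 / 20 → ¾ ℚ.≤ x
      cancel {x} le = subst (¾ ℚ.≤_) (trans (ℚ.+-assoc x (+ 3 / 20) (ℚ.- (+ 3 / 20))) (ℚ.+-identityʳ x))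
        (ℚ.+-monoˡ-≤ (ℚ.- (+ 3 / 20)) le)

-- As long as the runs coincide they return the same output, which is valid on at most one of the
-- graphs. The excess `¾` + `¾` - 1 must come from the charged queries.
distinguish : ∀ {κ} (A : Algorithm κ) {n} (G G′ : Multigraph n κ) {s t : Fin n} →
  (∀ o → ¬ (Valid G s t o × Valid G′ s t o)) →
  (w : Reward A G) → (∀ a → 0ℚ ℚ.≤ w a) →
  (∀ q g → answer G q ≡ answer G′ q ⊎ 1ℚ ℚ.≤ w (query q g)) →
  ∀ {k} → ¾ ℚ.≤ success A G s t k → ¾ ℚ.≤ success A G′ s t k →
  ½ ℚ.≤ Run.expected A G w k (Algorithm.start A s t)
distinguish A G G′ {s} {t} disjoint w 0≤w differ {k} ¾≤ ¾≤′ =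
  ½≤ ¾≤ ¾≤′ (coupling A G G′ (𝟙≤1 ∘ valid? G s t) (𝟙≤1 ∘ valid? G′ s t)
    (λ o → 𝟙-exclusive (valid? G s t o) (valid? G′ s t o) (disjoint o)) w 0≤w differ k
    (Algorithm.start A s t))
  where
  ½≤ : ∀ {x y z} → ¾ ℚ.≤ x → ¾ ℚ.≤ y → x ℚ.+ y ℚ.≤ 1ℚ ℚ.+ z → ½ ℚ.≤ z
  ½≤ {x} {y} {z} ¾≤x ¾≤y x+y≤1+z = begin
    ½                          ≤⟨ ℚ.+-monoʳ-≤ (ℚ.- 1ℚ) (ℚ.≤-trans (ℚ.+-mono-≤ ¾≤x ¾≤y) x+y≤1+z) ⟩
    ℚ.- 1ℚ ℚ.+ (1ℚ ℚ.+ z)      ≡⟨ ℚ.+-assoc (ℚ.- 1ℚ) 1ℚ z ⟨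
    0ℚ ℚ.+ z                   ≡⟨ ℚ.+-identityˡ z ⟩
    z                          ∎
    where open ℚ.≤-Reasoning

-- An output valid on `G′` is no longer than `w`, hence shorter than every st-walk of `G`.
noCommonOutput : ∀ {n κ} {G G′ : Multigraph n κ} {s t es} → Walk G′ s es t →
                 (∀ {es′} → Walk G s es′ t → length es < length es′) →
                 ∀ o → ¬ (Valid G s t o × Valid G′ s t o)
noCommonOutput w longer (just es) ((v , _) , (_ , min)) = ℕ.<⇒≱ (longer v) (min _ w)
noCommonOutput w longer nothing   (_ , none)            = none _ w

-- Distinct vertices are mutually unreachable here. With loops rather than no edges at all, `swap`
-- applied to the loops at `s` and `t` produces a companion graph with an edge from `s` to `t`.
loops : ∀ {n} κ → Multigraph n κ
loops {n} directed = dir record { size = n ; outdeg = λ _ → 1 ; indeg = λ _ → 1 ; outs = slots ; ins = slots }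
  where
  slots : Fin n ↔ Σ (Fin n) (λ _ → Fin 1)
  slots = mk↔ₛ′ (_, zero) proj₁ (λ where (_ , zero) → refl) (λ _ → refl)
loops {n} undirected = undir record { size = n ; deg = λ _ → 2 ; ends = slots }
  where
  slots : (Fin n × Bool) ↔ Σ (Fin n) (λ _ → Fin 2)
  slots = mk↔ₛ′ (λ (v , b) → v , (if b then suc zero else zero))
                (λ where (v , zero) → v , false ; (v , suc zero) → v , true)
                (λ where (v , zero) → refl ; (v , suc zero) → refl)
                (λ where (v , false) → refl ; (v , true) → refl)

loop : ∀ {n} κ → Fin n → Dart (loops {n} κ)
loop directed   v = v
loop undirected v = v , false

near-loop : ∀ {n} κ side (v : Fin n) → near (loops κ) side (loop κ v) ≡ v
near-loop directed   forward  v = refl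
near-loop directed   backward v = refl
near-loop undirected forward  v = refl
near-loop undirected backward v = refl

edge-loop-injective : ∀ {n} κ {v w : Fin n} → edge (loops κ) (loop κ v) ≡ edge (loops κ) (loop κ w) → v ≡ w
edge-loop-injective directed   eq = eq
edge-loop-injective undirected eq = eq

loops-walk : ∀ {n} κ {u es} {v : Fin n} → Walk (loops κ) u es v → u ≡ v
loops-walk κ          []                  = refl
loops-walk directed   ((refl , refl) ∷ w)     = loops-walk directed w
loops-walk undirected ((_ , refl , refl) ∷ w) = loops-walk undirected w

swapLoops-walk : ∀ {n} κ {s t : Fin n} → s ≢ t → ∃ λ es → Walk (swap (loops κ) (loop κ s) (loop κ t)) s es t
swapLoops-walk κ {s} {t} s≢t = _ , subst₂ (Arc G _)
    (trans (toSwap-tail (loops κ) (loop κ s) (loop κ t) (s≢t ∘ edge-loop-injective κ)) (near-loop κ forward s))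
    (trans (toSwap-head (loops κ) (loop κ s) (loop κ t)) (near-loop κ backward t))
    (dartArc G (toSwap (loops κ) (loop κ s)))
  ∷ []
  where
  G : Multigraph _ κ
  G = swap (loops κ) (loop κ s) (loop κ t)

-- The comparison graph is chosen with the opposite reachability. Charging every query against it
-- shows that some queries are unavoidable.
differentGraph : ∀ {n κ} (G : Multigraph n κ) {s t : Fin n} → s ≢ t →
                 ∃ λ (G′ : Multigraph n κ) → ∀ o → ¬ (Valid G s t o × Valid G′ s t o)
differentGraph {κ = κ} G {s} {t} s≢t with valid? G s t nothing
... | yes none = swap (loops κ) (loop κ s) (loop κ t) , λ where
  (just es) ((w , _) , _) → none es w
  nothing   (_ , none′)   → let (es , w) = swapLoops-walk κ s≢t in none′ es w
... | no some = loops κ , λ where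
  (just es) (_ , (w , _)) → s≢t (loops-walk κ w)
  nothing   (none , _)    → some none

-- Explored degree against the queries of a correct algorithm

module LowerBound {κ} (A : Algorithm κ) (correct : Correct A) {n} (G : Multigraph n κ) (s t : Fin n) (s≢t : s ≢ t) where

  Q : ℕ → ℚ
  Q = complexity queries A G s t

  Succeeds : Multigraph n κ → ℕ → Set
  Succeeds H k = ¾ ℚ.≤ success A H s t k

  Queries : ℕ → Set
  Queries k = ½ ℚ.≤ Q k

  -- All pairs of darts are included because the exchanged ones are known only after the walks have
  -- been cut at first occurrences.
  Conclusive : ℕ → Set
  Conclusive k = (Succeeds G k × Queries k) × (∀ δ₁ δ₂ → Succeeds (swap G δ₁ δ₂) k)

  eventually-queries : Eventually (λ k → Succeeds G k × Queries k)
  eventually-queries = fromDifferent (differentGraph G s≢t)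
    where
    fromDifferent : (∃ λ (G′ : Multigraph n κ) → ∀ o → ¬ (Valid G s t o × Valid G′ s t o)) →
                    Eventually (λ k → Succeeds G k × Queries k)
    fromDifferent (G′ , disjoint) = proj₁ both , λ k le → proj₁ (proj₂ both k le) , queriesAt k (proj₂ both k le)
      where
      both : Eventually (λ k → Succeeds G k × Succeeds G′ k)
      both = eventually-× {Succeeds G} {Succeeds G′}
        (eventually-success A G s t correct s≢t) (eventually-success A G′ s t correct s≢t)
      queriesAt : ∀ k → Succeeds G k × Succeeds G′ k → Queries k
      -- The charge is 1 for every query, whether or not the two graphs answer it alike.
      queriesAt k (ok , ok′) = distinguish A G G′ disjoint (cost queries)
        (0≤cost A G queries) (λ _ _ → inj₂ ℚ.≤-refl) {k} ok ok′

  eventually-conclusive : Eventually Conclusive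
  eventually-conclusive = eventually-× {λ k → Succeeds G k × Queries k}
    {λ k → ∀ δ₁ δ₂ → Succeeds (swap G δ₁ δ₂) k} eventually-queries
    (eventually-Dart G {λ δ₁ k → ∀ δ₂ → Succeeds (swap G δ₁ δ₂) k} λ δ₁ →
      eventually-Dart G {λ δ₂ → Succeeds (swap G δ₁ δ₂)} λ δ₂ →
        eventually-success A (swap G δ₁ δ₂) s t correct s≢t)

  module _ {k} (conclusive : Conclusive k) where

    hitting : Dart G → ℚ
    hitting δ = Run.expected A G (hits A G (ident G δ)) k (Algorithm.start A s t)

    hitting-pair : ∀ {p q} δ₁ δ₂ → LongerThan G s t (p + suc q) →
      Path G (Any-dart G) forward s p (near G forward δ₁) →
      Path G (Any-dart G) backward t q (near G backward δ₂) →
      ½ ℚ.≤ hitting δ₁ ℚ.+ hitting δ₂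
    hitting-pair {p} {q} δ₁ δ₂ longer w₁ w₂ = fromSwap (swap-shortens G s t δ₁ δ₂ longer w₁ w₂)
      where
      E : ℕ → ℚ
      E i = Run.expected A G (hits A G i) k (Algorithm.start A s t)
      fromSwap : (∃₂ λ γ₁ γ₂ → edge G γ₁ ≡ edge G δ₁ × edge G γ₂ ≡ edge G δ₂ ×
                  ∃ λ es → Walk (swap G γ₁ γ₂) s es t × length es ≤ p + suc q) →
                 ½ ℚ.≤ hitting δ₁ ℚ.+ hitting δ₂
      -- The exchanged darts may be reverses of the given ones, but hits depend on the edge only.
      fromSwap (γ₁ , γ₂ , eq₁ , eq₂ , es , w , es≤) =
        subst₂ (λ e f → ½ ℚ.≤ E (edgeId G e) ℚ.+ E (edgeId G f)) eq₁ eq₂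
          (subst (½ ℚ.≤_) (expected-+ A G (hits A G (ident G γ₁)) (hits A G (ident G γ₂)) k (Algorithm.start A s t))
            (distinguish A G (swap G γ₁ γ₂) (noCommonOutput w λ v → ℕ.≤-<-trans es≤ (longer v))
              (λ a → hits A G (ident G γ₁) a ℚ.+ hits A G (ident G γ₂) a)
              (λ a → ℚ.≤-trans (0≤hits A G (ident G γ₁) a) (x≤x+y (0≤hits A G (ident G γ₂) a)))
              differ {k} (proj₁ (proj₁ conclusive)) (proj₂ conclusive γ₁ γ₂)))
        where
        differ : ∀ q g → answer G q ≡ answer (swap G γ₁ γ₂) q ⊎
          1ℚ ℚ.≤ hits A G (ident G γ₁) (query q g) ℚ.+ hits A G (ident G γ₂) (query q g)
        differ q g with swap-answer G γ₁ γ₂ q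
        ... | inj₁ same      = inj₁ same
        ... | inj₂ (inj₁ m₁) = inj₂ (ℚ.≤-trans (1≤hits A G q g m₁) (x≤x+y (0≤hits A G (ident G γ₂) (query q g))))
        ... | inj₂ (inj₂ m₂) = inj₂ (ℚ.≤-trans (1≤hits A G q g m₂) (x≤y+x (0≤hits A G (ident G γ₁) (query q g))))

    sumOver-hitting : ∀ {δs} → Unique δs → sumOver δs hitting ℚ.≤ Q k ℚ.+ Q k
    sumOver-hitting {δs} u = subst₂ ℚ._≤_
      (expected-sumOver A G δs (hits A G ∘ ident G) k (Algorithm.start A s t))
      (expected-+ A G (cost queries) (cost queries) k (Algorithm.start A s t))
      (expected-mono A G (sumOver-hits A G u) k (Algorithm.start A s t))

    allHit : ∀ {side vs} → Unique vs → All (λ δ → ¼ ℚ.≤ hitting δ) (dartsOf G side vs) →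
             ⟦ totalDegree G side vs ⟧ ℚ.≤ ⟦ 8 ⟧ ℚ.* Q k
    allHit {side} {vs} u all = quarter {y = Q k} (begin
      ¼ ℚ.* ⟦ totalDegree G side vs ⟧          ≡⟨ cong (λ m → ¼ ℚ.* ⟦ m ⟧) (length-dartsOf G side vs) ⟨
      ¼ ℚ.* ⟦ length (dartsOf G side vs) ⟧     ≤⟨ sumOver-≥ all ⟩
      sumOver (dartsOf G side vs) hitting      ≤⟨ sumOver-hitting (dartsOf-unique G side u) ⟩
      Q k ℚ.+ Q k                              ∎)
      where
      open ℚ.≤-Reasoning
      quarter : ∀ {x y} → ¼ ℚ.* x ℚ.≤ y ℚ.+ y → x ℚ.≤ ⟦ 8 ⟧ ℚ.* y
      quarter {x} {y} le = ℚ.*-cancelˡ-≤-pos ¼ (begin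
        ¼ ℚ.* x                    ≤⟨ le ⟩
        y ℚ.+ y                    ≡⟨ cong₂ ℚ._+_ (ℚ.*-identityˡ y) (ℚ.*-identityˡ y) ⟨
        1ℚ ℚ.* y ℚ.+ 1ℚ ℚ.* y      ≡⟨ ℚ.*-distribʳ-+ y 1ℚ 1ℚ ⟨
        ¼ ℚ.* ⟦ 8 ⟧ ℚ.* y          ≡⟨ ℚ.*-assoc ¼ ⟦ 8 ⟧ y ⟩
        ¼ ℚ.* (⟦ 8 ⟧ ℚ.* y)        ∎)
      sumOver-≥ : ∀ {δs} → All (λ δ → ¼ ℚ.≤ hitting δ) δs → ¼ ℚ.* ⟦ length δs ⟧ ℚ.≤ sumOver δs hitting
      sumOver-≥ []                 = ℚ.≤-refl
      sumOver-≥ {δ ∷ δs} (¼≤ ∷ ps) = begin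
        ¼ ℚ.* ⟦ suc (length δs) ⟧           ≡⟨ cong (¼ ℚ.*_) (⟦⟧-homo-+ 1 (length δs)) ⟩
        ¼ ℚ.* (1ℚ ℚ.+ ⟦ length δs ⟧)        ≡⟨ ℚ.*-distribˡ-+ ¼ 1ℚ ⟦ length δs ⟧ ⟩
        ¼ ℚ.+ ¼ ℚ.* ⟦ length δs ⟧           ≤⟨ ℚ.+-mono-≤ ¼≤ (sumOver-≥ ps) ⟩
        hitting δ ℚ.+ sumOver δs hitting    ∎

    -- If one forward dart is hit less than `¼` times, pairing it with each backward dart forces `¼`
    -- on all of those. The strict `p < a` makes room for the exchanged edge: `p + suc q ≤ a + b`.
    explored≤ : ∀ {a b Z R} → LongerThan G s t (a + b) → Unique Z → Unique R →
      All (λ x → ∃ λ p → p < a × Path G (Any-dart G) forward s p x) Z →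
      All (λ y → ∃ λ q → q ≤ b × Path G (Any-dart G) backward t q y) R →
      ⟦ totalDegree G forward Z ⟧ ℚ.≤ ⟦ 8 ⟧ ℚ.* Q k ⊎ ⟦ totalDegree G backward R ⟧ ℚ.≤ ⟦ 8 ⟧ ℚ.* Q k
    explored≤ {a} {b} {Z} {R} longer uZ uR nearS nearT =
      byCases (All.all? (λ δ → ¼ ℚ.≤? hitting δ) (dartsOf G forward Z))
      where
      missed : ∀ {δ₁} → ¬ ¼ ℚ.≤ hitting δ₁ → δ₁ ∈ dartsOf G forward Z →
               ∀ {δ₂} → δ₂ ∈ dartsOf G backward R → ¼ ℚ.≤ hitting δ₂
      missed {δ₁} ≱¼ δ₁∈ {δ₂} δ₂∈ =
        let (p , p<a , w₁) = All.lookup nearS (∈-dartsOf G forward Z δ₁∈)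
            (q , q≤b , w₂) = All.lookup nearT (∈-dartsOf G backward R δ₂∈)
            longer′ : LongerThan G s t (p + suc q)
            longer′ v = ℕ.≤-<-trans (subst (_≤ a + b) (sym (ℕ.+-suc p q)) (ℕ.+-mono-≤ p<a q≤b)) (longer v)
        in ℚ.≮⇒≥ λ <¼ → ℚ.<-irrefl refl
             (ℚ.<-≤-trans (ℚ.+-mono-< (ℚ.≰⇒> ≱¼) <¼) (hitting-pair δ₁ δ₂ longer′ w₁ w₂))
      byCases : Dec (All (λ δ → ¼ ℚ.≤ hitting δ) (dartsOf G forward Z)) →
        ⟦ totalDegree G forward Z ⟧ ℚ.≤ ⟦ 8 ⟧ ℚ.* Q k ⊎ ⟦ totalDegree G backward R ⟧ ℚ.≤ ⟦ 8 ⟧ ℚ.* Q k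
      byCases (yes all) = inj₁ (allHit uZ all)
      byCases (no ¬all) =
        let (δ₁ , δ₁∈ , ≱¼) = find (All.¬All⇒Any¬ (λ δ → ¼ ℚ.≤? hitting δ) (dartsOf G forward Z) ¬all)
        in inj₂ (allHit uR (All.tabulate (missed ≱¼ δ₁∈)))

-- Invariant of one execution of the breadth-first search

unique-++⁻ˡ : ∀ {A : Set} (xs : List A) {ys} → Unique (xs ++ ys) → Unique xs
unique-++⁻ˡ []       _        = []
unique-++⁻ˡ (x ∷ xs) (x∉ ∷ u) = All.++⁻ˡ xs x∉ ∷ unique-++⁻ˡ xs u

module _ {n : ℕ} where

  Reached : Execution n → Fin n → ℕ → Set
  Reached X v d = lookup (Execution.dist X) v ≡ just d

  reached-unique : ∀ {X v d d′} → Reached X v d → Reached X v d′ → d ≡ d′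
  reached-unique p q = just-injective (trans (sym p) q)

  launch-root : ∀ r → Reached (launch r) r 0
  launch-root r = Vec.lookup∘updateAt r (replicate n ∞)

  launch-reached : ∀ {r v d} → Reached (launch r) v d → v ≡ r × d ≡ 0
  launch-reached {r} {v} x with v Fin.≟ r
  ... | yes refl = refl , reached-unique {launch r} x (launch-root r)
  ... | no v≢ with trans (sym x) (trans (Vec.lookup∘updateAt′ v r v≢ (replicate n ∞)) (Vec.lookup-replicate v ∞))
  ... | ()

  discover : ℕ → Fin n → ℕ → Execution n → Execution n
  discover e v d X = record X
    { dist   = dist [ v ]≔ just d
    ; parent = parent [ v ]≔ just (e , current)
    ; queue  = queue ∷ʳ v
    }
    where open Execution X

  -- As the execution reaches the vertices in the order of their distances,
  -- no distance is ever improved.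
  reach-cases : ∀ e v X {a} → Reached X (Execution.current X) a →
    (lookup (Execution.closed X) v ≡ true → ∃ λ d → Reached X v d) →
    (∀ {d} → Reached X v d → d ≤ suc a) →
    (∃ λ d → Reached X v d) × reach e v X ≡ X
    ⊎ lookup (Execution.dist X) v ≡ nothing × reach e v X ≡ discover e v (suc a) X
  reach-cases e v X {a} current≡ closed-reached ≤1+a with lookup (Execution.closed X) v
  ... | true  = inj₁ (closed-reached refl , refl)
  ... | false rewrite current≡ | ℕ.+-comm a 1 with lookup (Execution.dist X) v in eq
  ... | nothing = inj₂ (refl , refl)
  ... | just d  = inj₁ ((d , refl) , unchanged)
    where
    unchanged : record X
      { dist   = Execution.dist X [ v ]≔ just (d ⊓ suc a)
      ; parent = if suc a <ᵇ d then Execution.parent X [ v ]≔ just (e , Execution.current X) else Execution.parent X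
      } ≡ X
    unchanged
      rewrite ℕ.m≤n⇒m⊓n≡m (≤1+a refl) | dec-false (suc a <? d) (ℕ.≤⇒≯ (≤1+a refl)) | sym eq
      = cong (λ ds → record X { dist = ds }) (Vec.[]≔-lookup (Execution.dist X) v)

module BFS {n κ} (G : Multigraph n κ) (side : Side) (root : Fin n) where

  deg : Fin n → ℕ
  deg = sideDegree G side

  total : List (Fin n) → ℕ
  total = totalDegree G side

  total-∷ʳ : ∀ vs v → total (vs ∷ʳ v) ≡ total vs + deg v
  total-∷ʳ vs v = trans (cong ListAction.sum (List.map-++ deg vs [ v ]))
    (trans (ListAction.sum-++ (map deg vs) [ deg v ]) (cong (λ m → ListAction.sum (map deg vs) + m) (ℕ.+-identityʳ (deg v))))

  head : ∀ v → Fin (deg v) → Fin n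
  head v i = far G side (dartAt G side v i)

  -- The index is the recorded distance. A parent is exactly one closer to the root, so tracing
  -- terminates and gives a path of precisely this length.
  data TreeEntry (X : Execution n) (v : Fin n) : ℕ → Set where
    atRoot : v ≡ root → lookup (Execution.parent X) v ≡ nothing → TreeEntry X v 0
    via    : ∀ {d} δ → far G side δ ≡ v → lookup (Execution.parent X) v ≡ just (ident G δ , near G side δ) →
             Reached X (near G side δ) d → TreeEntry X v (suc d)

  -- An inequality, because the head of a scanned edge may already have been reached from elsewhere
  -- at a smaller distance.
  ScannedTo : Execution n → Fin n → ℕ → Set
  ScannedTo X v j = ∀ i → toℕ i < j → ∀ {d} → Reached X v d → ∃ λ d′ → d′ ≤ suc d × Reached X (head v i) d′

  Scanned : Execution n → Fin n → Set
  Scanned X v = ScannedTo X v (deg v)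

  -- closed lists the closed vertices, relaxed counts the relaxations, and
  -- steps counts the steps of the algorithm spent in this execution.
  data Phase (X : Execution n) (closed : List (Fin n)) (relaxed steps : ℕ) : Progress → Set where
    -- Besides its relaxations a closed vertex costs two steps, the degree query and the return to
    -- `idle`; the latter is still due while `relaxing`.
    idle     : All (Scanned X) closed → relaxed ≡ total closed → steps ≡ relaxed + 2 * length closed →
               Phase X closed relaxed steps idle
    relaxing : ∀ {j r} done → closed ≡ done ∷ʳ Execution.current X → All (Scanned X) done →
               ScannedTo X (Execution.current X) j → j + r ≡ deg (Execution.current X) →
               relaxed ≡ total done + j → suc steps ≡ relaxed + 2 * length closed →
               Phase X closed relaxed steps (relaxing j r)

  -- The reached vertices, in the order of their discovery: closed vertices
  -- at a distance less than level and equal to level, and open ones at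
  -- distance level and level + 1.
  record Inv (X : Execution n) : Set where
    field
      level relaxed steps    : ℕ
      inner rim front beyond : List (Fin n)

    closedVertices : List (Fin n)
    closedVertices = inner ++ rim

    vertices : List (Fin n)
    vertices = inner ++ rim ++ front ++ beyond

    field
      current-reached : Reached X (Execution.current X) level
      root-reached    : Reached X root 0
      queue≡          : Execution.queue X ≡ front ++ beyond
      unique          : Unique vertices
      inner-reached   : All (λ v → ∃ λ d → d < level × Reached X v d) inner
      rim-reached    : All (λ v → Reached X v level) rim
      front-reached   : All (λ v → Reached X v level) front
      beyond-reached  : All (λ v → Reached X v (suc level)) beyond
      reached-∈       : ∀ {v d} → Reached X v d → v ∈ vertices
      closed-reached  : ∀ {v} → lookup (Execution.closed X) v ≡ true → ∃ λ d → Reached X v d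
      tree            : ∀ {v d} → Reached X v d → TreeEntry X v d
      -- This bounds the later tracing of tree paths by the work already done.
      dist≤relaxed    : ∀ {v d} → Reached X v d → d ≤ relaxed
      -- Each vertex up to distance `level` except the root was discovered by its own edge leaving
      -- `inner`.
      count-level     : length closedVertices + length front ≤ suc (total inner)
      count-all       : length vertices ≤ suc relaxed
      phase           : Phase X closedVertices relaxed steps (Execution.progress X)

    open Execution X using (current; queue; progress)

    byPart : ∀ {v} → v ∈ vertices → v ∈ inner ⊎ v ∈ rim ⊎ v ∈ front ⊎ v ∈ beyond
    byPart v∈ with ∈.∈-++⁻ inner v∈
    ... | inj₁ p = inj₁ p
    ... | inj₂ v∈ with ∈.∈-++⁻ rim v∈
    ... | inj₁ p = inj₂ (inj₁ p)
    ... | inj₂ v∈ with ∈.∈-++⁻ front v∈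
    ... | inj₁ p = inj₂ (inj₂ (inj₁ p))
    ... | inj₂ p = inj₂ (inj₂ (inj₂ p))

    reached≤ : ∀ {v d} → Reached X v d → d ≤ suc level
    reached≤ r with byPart (reached-∈ r)
    ... | inj₁ p with All.lookup inner-reached p
    ...   | d′ , d′<a , r′ rewrite reached-unique {X = X} r r′ = ℕ.m≤n⇒m≤1+n (ℕ.<⇒≤ d′<a)
    reached≤ r | inj₂ (inj₁ p) rewrite reached-unique {X = X} r (All.lookup rim-reached p) = ℕ.n≤1+n level
    reached≤ r | inj₂ (inj₂ (inj₁ p)) rewrite reached-unique {X = X} r (All.lookup front-reached p) = ℕ.n≤1+n level
    reached≤ r | inj₂ (inj₂ (inj₂ p)) = ℕ.≤-reflexive (reached-unique {X = X} r (All.lookup beyond-reached p))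

    reached< : ∀ {v d} → Reached X v d → d < level → v ∈ inner
    reached< r d<a with byPart (reached-∈ r)
    ... | inj₁ p = p
    ... | inj₂ (inj₁ p) = contradiction (reached-unique {X = X} r (All.lookup rim-reached p)) (ℕ.<⇒≢ d<a)
    ... | inj₂ (inj₂ (inj₁ p)) = contradiction (reached-unique {X = X} r (All.lookup front-reached p)) (ℕ.<⇒≢ d<a)
    ... | inj₂ (inj₂ (inj₂ p)) =
      contradiction (reached-unique {X = X} r (All.lookup beyond-reached p)) (ℕ.<⇒≢ (ℕ.m≤n⇒m≤1+n d<a))

    inner-scanned : ∀ {v d} → Reached X v d → d < level → Scanned X v
    inner-scanned r d<a = go phase
      where
      go : ∀ {p} → Phase X closedVertices relaxed steps p → Scanned X _
      go (idle scanned _ _) = All.lookup scanned (∈.∈-++⁺ˡ (reached< r d<a))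
      go (relaxing done eq scanned _ _ _ _)
        with ∈.∈-++⁻ done (subst (_ ∈_) eq (∈.∈-++⁺ˡ (reached< r d<a)))
      ... | inj₁ p           = All.lookup scanned p
      -- The vertex still being relaxed is at distance `level`, not less.
      ... | inj₂ (here refl) = contradiction (reached-unique {X = X} r current-reached) (ℕ.<⇒≢ d<a)

    extend : ∀ {l} δ → (∃ λ d → d ≤ l × Reached X (near G side δ) d) →
             (∀ {d} → Reached X (near G side δ) d → d ≤ l → Scanned X (near G side δ)) →
             ∃ λ d → d ≤ suc l × Reached X (far G side δ) d
    extend δ (d , d≤l , r) scanned with dartAt-surjective G side δ
    ... | i , eq with scanned r d≤l i (Fin.toℕ<n i) r
    ... | d′ , d′≤ , r′ = d′ , ℕ.≤-trans d′≤ (s≤s d≤l) , subst (λ γ → Reached X (far G side γ) d′) eq r′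

    -- Along the path every vertex before the last is recorded at a distance less than `level`,
    -- hence fully scanned, and the bound passes to the next vertex.
    complete : ∀ {P l v} → Path G P side root l v → l ≤ level → ∃ λ d → d ≤ l × Reached X v d
    complete []           _   = 0 , z≤n , root-reached
    complete (snoc δ _ w) l<a = extend δ (complete w (ℕ.<⇒≤ l<a))
      λ r d≤l → inner-scanned r (ℕ.≤-<-trans d≤l l<a)

    -- With no open vertex left all reached vertices are scanned, so the induction of `complete`
    -- runs without a limit on the length.
    exhausted : progress ≡ idle → queue ≡ [] → ∀ {P l v} → Path G P side root l v → ∃ λ d → d ≤ l × Reached X v d
    exhausted p≡ q≡ []           = 0 , z≤n , root-reached
    exhausted p≡ q≡ (snoc δ _ w) = extend δ (exhausted p≡ q≡ w) λ r _ → allScanned r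
      where
      allScanned : ∀ {v d} → Reached X v d → Scanned X v
      allScanned r with subst (Phase X closedVertices relaxed steps) p≡ phase
      ... | idle scanned _ _ = All.lookup scanned (subst (_ ∈_)
        (trans (cong (λ vs → inner ++ rim ++ vs) (trans (sym queue≡) q≡)) (cong (inner ++_) (List.++-identityʳ rim)))
        (reached-∈ r))

    treePath : ∀ {d v} → Reached X v d → Path G (Any-dart G) side root d v
    treePath {d} r with tree r
    ... | atRoot refl _     = []
    ... | via δ refl _ r′   = snoc δ tt (treePath r′)

    closed≤relaxed : length closedVertices ≤ suc relaxed
    closed≤relaxed = ℕ.≤-trans (ℕ.≤-trans (ℕ.m≤m+n _ (length (front ++ beyond)))
      (ℕ.≤-reflexive (trans (sym (List.length-++ closedVertices))
        (cong length (List.++-assoc inner rim (front ++ beyond)))))) count-all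

    steps≤ : steps ≤ relaxed + 2 * suc relaxed
    steps≤ = ℕ.≤-trans (go phase) (ℕ.+-monoʳ-≤ relaxed (ℕ.*-monoʳ-≤ 2 closed≤relaxed))
      where
      go : ∀ {p} → Phase X closedVertices relaxed steps p → steps ≤ relaxed + 2 * length closedVertices
      go (idle _ _ eq)             = ℕ.≤-reflexive eq
      go (relaxing _ _ _ _ _ _ eq) = ℕ.≤-trans (ℕ.n≤1+n steps) (ℕ.≤-reflexive eq)

    relaxed≤total : relaxed ≤ total closedVertices
    relaxed≤total = go phase
      where
      go : ∀ {p} → Phase X closedVertices relaxed steps p → relaxed ≤ total closedVertices
      go (idle _ eq _) = ℕ.≤-reflexive eq
      go (relaxing {j} {r} done eq _ _ j+r≡ N≡ _) = ℕ.≤-trans (ℕ.≤-reflexive N≡) (ℕ.≤-trans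
        (ℕ.+-monoʳ-≤ (total done) (ℕ.≤-trans (ℕ.m≤m+n j r) (ℕ.≤-reflexive j+r≡)))
        (ℕ.≤-reflexive (sym (trans (cong total eq) (total-∷ʳ done current)))))

    closed-near : All (λ v → ∃ λ d → d ≤ level × Path G (Any-dart G) side root d v) closedVertices
    closed-near = All.++⁺
      (All.map (λ (d , d<a , r) → d , ℕ.<⇒≤ d<a , treePath r) inner-reached)
      (All.map (λ r → level , ℕ.≤-refl , treePath r) rim-reached)

    closed-unique : Unique closedVertices
    closed-unique = unique-++⁻ˡ closedVertices
      (subst Unique (sym (List.++-assoc inner rim (front ++ beyond))) unique)

-- Preservation of the invariant by the steps of one execution

module Transitions {n κ} (G : Multigraph n κ) (side : Side) (root : Fin n) where
  open BFS G side root
  open Inv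

  record Successor {X : Execution n} (I : Inv X) (X′ : Execution n) (relaxed′ : ℕ) : Set where
    constructor successor
    field
      inv      : Inv X′
      relaxed≡ : relaxed inv ≡ relaxed′
      steps≡   : steps inv ≡ suc (steps I)

  setExecutionProgress : Progress → Execution n → Execution n
  setExecutionProgress p X = record X { progress = p }

  finishVertex : ∀ {X j} (I : Inv X) → Execution.progress X ≡ relaxing j 0 →
                 Σ (Successor I (setExecutionProgress idle X) (relaxed I)) λ S → level (Successor.inv S) ≡ level I
  finishVertex {X} {j} I p≡ with subst (Phase X (closedVertices I) (relaxed I) (steps I)) p≡ (phase I)
  ... | relaxing done eq scanned to-j j+r≡ N≡ t≡ = successor (record
    { level = level I ; relaxed = relaxed I ; steps = suc (steps I)
    ; inner = inner I ; rim = rim I ; front = front I ; beyond = beyond I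
    ; current-reached = current-reached I ; root-reached = root-reached I ; queue≡ = queue≡ I
    ; unique = unique I ; inner-reached = inner-reached I ; rim-reached = rim-reached I
    ; front-reached = front-reached I ; beyond-reached = beyond-reached I ; reached-∈ = reached-∈ I
    ; closed-reached = closed-reached I ; tree = oldTree ; dist≤relaxed = dist≤relaxed I
    ; count-level = count-level I ; count-all = count-all I
    ; phase = idle (subst (All (Scanned X)) (sym eq) (All.∷ʳ⁺ scanned
                     (subst (ScannedTo X u) j≡ to-j)))
                   (trans N≡ (trans (cong (λ m → total done + m) j≡)
                     (trans (sym (total-∷ʳ done u)) (cong total (sym eq)))))
                   t≡
    }) refl refl , refl
    where
    u : Fin n
    u = Execution.current X
    j≡ : j ≡ deg u
    j≡ = trans (sym (ℕ.+-identityʳ j)) j+r≡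
    oldTree : ∀ {v d} → Reached X v d → TreeEntry (setExecutionProgress idle X) v d
    oldTree r with tree I r
    ... | atRoot v≡ p≡ = atRoot v≡ p≡
    ... | via δ f p r′ = via δ f p r′

  closeVertex : Fin n → List (Fin n) → Execution n → Execution n
  closeVertex u rest X = record X
    { closed = Execution.closed X [ u ]≔ true ; queue = rest ; current = u ; progress = relaxing 0 (deg u) }

  openNext : ∀ {X u rest} (I : Inv X) → Execution.progress X ≡ idle → Execution.queue X ≡ u ∷ rest →
             Successor I (closeVertex u rest X) (relaxed I)
  openNext {X} {u} {rest} I p≡ q≡ with subst (Phase X (closedVertices I) (relaxed I) (steps I)) p≡ (phase I)
  ... | idle scanned N≡ t≡ = go (front I) (beyond I) refl refl
    where
    X′ : Execution n
    X′ = closeVertex u rest X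

    newTree : ∀ {v d} → Reached X v d → TreeEntry X′ v d
    newTree r with tree I r
    ... | atRoot v≡ p≡ = atRoot v≡ p≡
    ... | via δ f p r′ = via δ f p r′

    newClosed : ∀ {d} → Reached X u d → ∀ {v} → lookup (Execution.closed X′) v ≡ true → ∃ λ d → Reached X v d
    newClosed {d} r {v} c with v Fin.≟ u
    ... | yes refl = d , r
    ... | no v≢u   = closed-reached I (trans (sym (Vec.lookup∘updateAt′ v u v≢u (Execution.closed X))) c)

    newPhase : ∀ {vs} → vs ≡ closedVertices I ∷ʳ u → Phase X′ vs (relaxed I) (suc (steps I)) (relaxing 0 (deg u))
    newPhase refl = relaxing (closedVertices I) refl scanned (λ i ()) refl
      (trans N≡ (sym (ℕ.+-identityʳ _)))
      (trans (cong (λ m → suc (suc m)) t≡) (trans (arith (relaxed I) (length (closedVertices I)))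
        (cong (λ m → relaxed I + 2 * m) (sym (trans (List.length-++ (closedVertices I)) (ℕ.+-comm _ 1))))))
      where
      open +-*-Solver using (solve; con; _:+_; _:*_; _:=_)
      arith : ∀ N p → suc (suc (N + 2 * p)) ≡ N + 2 * suc p
      arith = solve 2 (λ N p → con 2 :+ (N :+ con 2 :* p) := N :+ con 2 :* (con 1 :+ p)) refl

    go : ∀ qa qb → front I ≡ qa → beyond I ≡ qb → Successor I X′ (relaxed I)
    -- The level stays; `u` moves from `front` to `rim`.
    go (u′ ∷ qa) qb fr≡ be≡ with trans (sym q≡) (trans (queue≡ I) (cong₂ _++_ fr≡ be≡))
    ... | refl = successor (record
      { level = level I ; relaxed = relaxed I ; steps = suc (steps I)
      ; inner = inner I ; rim = rim I ∷ʳ u ; front = qa ; beyond = qb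
      ; current-reached = u-reached ; root-reached = root-reached I ; queue≡ = refl
      ; unique = subst Unique vertices≡ (unique I)
      ; inner-reached = inner-reached I ; rim-reached = All.∷ʳ⁺ (rim-reached I) u-reached
      ; front-reached = All.tail front′ ; beyond-reached = subst (All _) be≡ (beyond-reached I)
      ; reached-∈ = λ r → subst (_ ∈_) vertices≡ (reached-∈ I r)
      ; closed-reached = newClosed u-reached ; tree = newTree ; dist≤relaxed = dist≤relaxed I
      ; count-level = subst (_≤ suc (total (inner I))) count≡ (count-level I)
      ; count-all = subst (λ vs → length vs ≤ suc (relaxed I)) vertices≡ (count-all I)
      ; phase = newPhase (sym (List.++-assoc (inner I) (rim I) [ u ]))
      }) refl refl
      where
      front′ : All (λ v → Reached X v (level I)) (u ∷ qa)
      front′ = subst (All _) fr≡ (front-reached I)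
      u-reached : Reached X u (level I)
      u-reached = All.head front′
      vertices≡ : vertices I ≡ inner I ++ (rim I ∷ʳ u) ++ qa ++ qb
      vertices≡ = trans (cong₂ (λ x y → inner I ++ rim I ++ x ++ y) fr≡ be≡)
        (cong (inner I ++_) (sym (List.++-assoc (rim I) [ u ] (qa ++ qb))))
      count≡ : length (closedVertices I) + length (front I) ≡ length (inner I ++ (rim I ∷ʳ u)) + length qa
      count≡ rewrite fr≡ | sym (List.++-assoc (inner I) (rim I) [ u ]) | List.length-++ (inner I ++ rim I) {[ u ]} =
        sym (ℕ.+-assoc (length (inner I ++ rim I)) 1 (length qa))
    -- The level rises: the closed vertices become `inner`, `u` alone forms `rim`, and the rest of
    -- `beyond` becomes `front`. All closed vertices being scanned, `relaxed` is their total degree,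
    -- so the old `count-all` is the new `count-level`.
    go [] (u′ ∷ qb) fr≡ be≡ with trans (sym q≡) (trans (queue≡ I) (cong₂ _++_ fr≡ be≡))
    ... | refl = successor (record
      { level = suc (level I) ; relaxed = relaxed I ; steps = suc (steps I)
      ; inner = closedVertices I ; rim = [ u ] ; front = qb ; beyond = []
      ; current-reached = u-reached ; root-reached = root-reached I ; queue≡ = sym (List.++-identityʳ qb)
      ; unique = subst Unique vertices≡ (unique I)
      ; inner-reached = All.++⁺ (All.map (λ (d , d<a , r) → d , ℕ.m≤n⇒m≤1+n d<a , r) (inner-reached I))
                               (All.map (λ r → level I , ℕ.≤-refl , r) (rim-reached I))
      ; rim-reached = u-reached ∷ []
      ; front-reached = All.tail beyond′ ; beyond-reached = []
      ; reached-∈ = λ r → subst (_ ∈_) vertices≡ (reached-∈ I r)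
      ; closed-reached = newClosed u-reached ; tree = newTree ; dist≤relaxed = dist≤relaxed I
      ; count-level = subst₂ _≤_
          (trans (cong length (trans vertices≡ (sym (List.++-assoc (closedVertices I) [ u ] (qb ++ [])))))
            (trans (List.length-++ (closedVertices I ++ [ u ])) (cong (λ m → length (closedVertices I ++ [ u ]) + m)
              (cong length (List.++-identityʳ qb)))))
          (cong suc N≡) (count-all I)
      ; count-all = subst (λ vs → length vs ≤ suc (relaxed I)) vertices≡ (count-all I)
      ; phase = newPhase refl
      }) refl refl
      where
      beyond′ : All (λ v → Reached X v (suc (level I))) (u ∷ qb)
      beyond′ = subst (All _) be≡ (beyond-reached I)
      u-reached : Reached X u (suc (level I))
      u-reached = All.head beyond′
      vertices≡ : vertices I ≡ closedVertices I ++ [ u ] ++ qb ++ []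
      vertices≡ = trans (cong₂ (λ x y → inner I ++ rim I ++ x ++ y) fr≡ be≡)
        (trans (sym (List.++-assoc (inner I) (rim I) (u ∷ qb)))
          (cong (λ vs → closedVertices I ++ u ∷ vs) (sym (List.++-identityʳ qb))))
    go [] [] fr≡ be≡ with trans (sym q≡) (trans (queue≡ I) (cong₂ _++_ fr≡ be≡))
    ... | ()

  -- Covers both outcomes of a relaxation, no change and one vertex newly reached. In either case no
  -- recorded distance is revised.
  record Grows (X X′ : Execution n) (v : Fin n) (d : ℕ) : Set where
    constructor grows
    field
      old : ∀ {w e} → Reached X w e → Reached X′ w e
      new : ∀ {w e} → Reached X′ w e → Reached X w e ⊎ (w ≡ v × e ≡ d)

  scanned-grows : ∀ {X X′ v d w j} → Grows X X′ v d → (∃ λ e → Reached X w e) → ScannedTo X w j → ScannedTo X′ w j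
  scanned-grows {X} {X′} g (e , r) scanned i i<j r′ with scanned i i<j r
  ... | d′ , d′≤ , r″ rewrite reached-unique {X = X′} r′ (Grows.old g r) = d′ , d′≤ , Grows.old g r″

  closed-are-reached : ∀ {X} (I : Inv X) {v} → v ∈ closedVertices I → ∃ λ d → Reached X v d
  closed-are-reached I v∈ with ∈.∈-++⁻ (inner I) v∈
  ... | inj₁ p = let (d , _ , r) = All.lookup (inner-reached I) p in d , r
  ... | inj₂ p = level I , All.lookup (rim-reached I) p

  ∷ʳ-unique : ∀ {xs : List (Fin n)} {v} → Unique xs → v ∉ xs → Unique (xs ∷ʳ v)
  ∷ʳ-unique {v = v} u v∉ = Unique.++⁺ u ([] ∷ []) λ where (x∈ , here refl) → v∉ x∈

  module _ {X : Execution n} (I : Inv X) {j r} (p≡ : Execution.progress X ≡ relaxing j (suc r))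
           (i : Fin (deg (Execution.current X))) (j≡ : toℕ i ≡ j) where

    private
      u v : Fin n
      u = Execution.current X
      v = head u i
      δ : Dart G
      δ = dartAt G side u i
      X₁ : Execution n
      X₁ = setExecutionProgress (relaxing (suc j) r) X

      growPhase : ∀ {X′} → Execution.current X′ ≡ u → Grows X X′ v (suc (level I)) →
                  (∃ λ d → d ≤ suc (level I) × Reached X′ v d) →
                  Phase X′ (closedVertices I) (suc (relaxed I)) (suc (steps I)) (relaxing (suc j) r)
      growPhase {X′} refl g (d , d≤ , v-reached) with subst (Phase X (closedVertices I) (relaxed I) (steps I)) p≡ (phase I)
      ... | relaxing done eq scanned to-j j+r≡ N≡ t≡ = relaxing done eq
        (All.tabulate λ {w} w∈ → scanned-grows {X} {X′} {v} {suc (level I)} g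
          (closed-are-reached I (subst (w ∈_) (sym eq) (∈.∈-++⁺ˡ w∈))) (All.lookup scanned w∈))
        to-1+j (trans (sym (ℕ.+-suc j r)) j+r≡)
        (trans (cong suc N≡) (sym (ℕ.+-suc (total done) j))) (cong suc t≡)
        where
        to-1+j : ScannedTo X′ u (suc j)
        to-1+j i′ i′<1+j u-reached with toℕ i′ <? j
        ... | yes i′<j = scanned-grows {X} {X′} {v} {suc (level I)} {u} {j} g (level I , current-reached I) to-j i′ i′<j u-reached
        ... | no i′≮j with Fin.toℕ-injective {i = i′} {j = i} (trans (ℕ.≤-antisym (s≤s⁻¹ i′<1+j) (ℕ.≮⇒≥ i′≮j)) (sym j≡))
        ... | refl rewrite reached-unique {X = X′} u-reached (Grows.old g (current-reached I)) = d , d≤ , v-reached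

    RelaxResult : Execution n → Set
    RelaxResult X′ = (Σ (Successor I X′ (suc (relaxed I))) λ S → level (Successor.inv S) ≡ level I)
                   × Grows X X′ v (suc (level I))

    relaxOld : ∀ {d} → Reached X v d → RelaxResult X₁
    relaxOld {d} v-reached = (successor (record
      { level = level I ; relaxed = suc (relaxed I) ; steps = suc (steps I)
      ; inner = inner I ; rim = rim I ; front = front I ; beyond = beyond I
      ; current-reached = current-reached I ; root-reached = root-reached I ; queue≡ = queue≡ I
      ; unique = unique I ; inner-reached = inner-reached I ; rim-reached = rim-reached I
      ; front-reached = front-reached I ; beyond-reached = beyond-reached I ; reached-∈ = reached-∈ I
      ; closed-reached = closed-reached I ; tree = oldTree
      ; dist≤relaxed = λ r → ℕ.m≤n⇒m≤1+n (dist≤relaxed I r)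
      ; count-level = count-level I ; count-all = ℕ.m≤n⇒m≤1+n (count-all I)
      ; phase = growPhase {X₁} refl same (d , reached≤ I v-reached , v-reached)
      }) refl refl , refl) , same
      where
      same : Grows X X₁ v (suc (level I))
      same = grows (λ r → r) inj₁
      oldTree : ∀ {w d} → Reached X w d → TreeEntry X₁ w d
      oldTree r with tree I r
      ... | atRoot v≡ p≡ = atRoot v≡ p≡
      ... | via γ f p r′ = via γ f p r′

    relaxNew : lookup (Execution.dist X) v ≡ nothing → RelaxResult (discover (ident G δ) v (suc (level I)) X₁)
    relaxNew unreached = (successor (record
      { level = level I ; relaxed = suc (relaxed I) ; steps = suc (steps I)
      ; inner = inner I ; rim = rim I ; front = front I ; beyond = beyond I ∷ʳ v
      ; current-reached = old (current-reached I) ; root-reached = old (root-reached I)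
      ; queue≡ = trans (cong (_∷ʳ v) (queue≡ I)) (List.++-assoc (front I) (beyond I) [ v ])
      ; unique = subst Unique vertices≡ (∷ʳ-unique (unique I) v∉)
      ; inner-reached = All.map (λ (d , d<a , r) → d , d<a , old r) (inner-reached I)
      ; rim-reached = All.map old (rim-reached I)
      ; front-reached = All.map old (front-reached I)
      ; beyond-reached = All.∷ʳ⁺ (All.map old (beyond-reached I)) v-reached
      ; reached-∈ = λ r → subst (_ ∈_) vertices≡ (newReached-∈ (new r))
      ; closed-reached = λ c → let (d , r) = closed-reached I c in d , old r
      ; tree = λ r → newTree (new r)
      ; dist≤relaxed = λ r → newDist (new r)
      ; count-level = count-level I
      ; count-all = subst (_≤ suc (suc (relaxed I)))
          (trans (sym (ℕ.+-comm (length (vertices I)) 1)) (trans (sym (List.length-++ (vertices I))) (cong length vertices≡)))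
          (s≤s (count-all I))
      ; phase = growPhase {X′} refl grown (suc (level I) , ℕ.≤-refl , v-reached)
      }) refl refl , refl) , grown
      where
      X′ : Execution n
      X′ = discover (ident G δ) v (suc (level I)) X₁
      v-reached : Reached X′ v (suc (level I))
      v-reached = Vec.lookup∘updateAt v (Execution.dist X)
      ≢v : ∀ {w d} → Reached X w d → w ≢ v
      ≢v r refl with trans (sym unreached) r
      ... | ()
      old : ∀ {w d} → Reached X w d → Reached X′ w d
      old {w} r = trans (Vec.lookup∘updateAt′ w v (≢v r) (Execution.dist X)) r
      new : ∀ {w d} → Reached X′ w d → Reached X w d ⊎ (w ≡ v × d ≡ suc (level I))
      new {w} r with w Fin.≟ v
      ... | yes refl = inj₂ (refl , reached-unique {X = X′} r v-reached)
      ... | no w≢v   = inj₁ (trans (sym (Vec.lookup∘updateAt′ w v w≢v (Execution.dist X))) r)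
      grown : Grows X X′ v (suc (level I))
      grown = grows old new
      v∉ : v ∉ vertices I
      v∉ v∈ with byPart I v∈
      ... | inj₁ p                      = ≢v (proj₂ (proj₂ (All.lookup (inner-reached I) p))) refl
      ... | inj₂ (inj₁ p)               = ≢v (All.lookup (rim-reached I) p) refl
      ... | inj₂ (inj₂ (inj₁ p))        = ≢v (All.lookup (front-reached I) p) refl
      ... | inj₂ (inj₂ (inj₂ p))        = ≢v (All.lookup (beyond-reached I) p) refl
      vertices≡ : vertices I ∷ʳ v ≡ inner I ++ rim I ++ front I ++ (beyond I ∷ʳ v)
      vertices≡ = trans (List.++-assoc (inner I) _ [ v ]) (cong (inner I ++_)
        (trans (List.++-assoc (rim I) _ [ v ]) (cong (rim I ++_) (List.++-assoc (front I) (beyond I) [ v ]))))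
      newReached-∈ : ∀ {w d} → Reached X w d ⊎ (w ≡ v × d ≡ suc (level I)) → w ∈ vertices I ∷ʳ v
      newReached-∈ (inj₁ r)          = ∈.∈-++⁺ˡ (reached-∈ I r)
      newReached-∈ (inj₂ (refl , _)) = ∈.∈-++⁺ʳ (vertices I) (here refl)
      parent-old : ∀ {w d} → Reached X w d → lookup (Execution.parent X′) w ≡ lookup (Execution.parent X) w
      parent-old {w} r = Vec.lookup∘updateAt′ w v (≢v r) (Execution.parent X)
      newTree : ∀ {w d} → Reached X w d ⊎ (w ≡ v × d ≡ suc (level I)) → TreeEntry X′ w d
      newTree (inj₁ r) with tree I r
      ... | atRoot w≡ p≡ = atRoot w≡ (trans (parent-old r) p≡)
      ... | via γ f p r′ = via γ f (trans (parent-old r) p) (old r′)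
      newTree (inj₂ (refl , refl)) = via δ refl
        (trans (Vec.lookup∘updateAt v (Execution.parent X)) (cong (λ w → just (ident G δ , w)) (sym (near-dartAt G side u i))))
        (subst (λ w → Reached X′ w (level I)) (sym (near-dartAt G side u i)) (old (current-reached I)))
      newDist : ∀ {w d} → Reached X w d ⊎ (w ≡ v × d ≡ suc (level I)) → d ≤ suc (relaxed I)
      newDist (inj₁ r)          = ℕ.m≤n⇒m≤1+n (dist≤relaxed I r)
      newDist (inj₂ (_ , refl)) = s≤s (dist≤relaxed I (current-reached I))

    relaxEdge : RelaxResult (reach (ident G δ) v X₁)
    relaxEdge with reach-cases (ident G δ) v X₁ (current-reached I) (closed-reached I) (reached≤ I)
    ... | inj₁ ((d , r) , eq)     = subst RelaxResult (sym eq) (relaxOld r)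
    ... | inj₂ (unreached , eq)   = subst RelaxResult (sym eq) (relaxNew unreached)

  initial : Inv (launch root)
  initial = record
    { level = 0 ; relaxed = 0 ; steps = 0 ; inner = [] ; rim = [] ; front = [ root ] ; beyond = []
    ; current-reached = launch-root root ; root-reached = launch-root root ; queue≡ = refl ; unique = [] ∷ []
    ; inner-reached = [] ; rim-reached = [] ; front-reached = launch-root root ∷ [] ; beyond-reached = []
    ; reached-∈ = λ r → here (proj₁ (launch-reached {r = root} r))
    ; closed-reached = λ {v} c → contradiction (trans (sym (Vec.lookup-replicate v false)) c) λ ()
    ; tree = λ r → rootTree (launch-reached {r = root} r)
    ; dist≤relaxed = λ r → ℕ.≤-reflexive (proj₂ (launch-reached {r = root} r))
    ; count-level = s≤s z≤n ; count-all = s≤s z≤n ; phase = idle [] refl refl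
    }
    where
    rootTree : ∀ {v d} → v ≡ root × d ≡ 0 → TreeEntry (launch root) v d
    rootTree {v} (v≡ , refl) = atRoot v≡ (Vec.lookup-replicate v nothing)

-- Invariant of the bidirectional search

if-elim : ∀ {X : Set} (P : X → Set) b {x y} → (b ≡ true → P x) → (b ≡ false → P y) → P (if b then x else y)
if-elim P true  p q = p refl
if-elim P false p q = q refl

-- A toss is mapped to `⊥` because B is deterministic; a single successor state then describes the
-- run.
Leads : ∀ {n κ} (G : Multigraph n κ) {X : Set} → (Output → Set) → (X → Set) → Action n κ X → Set
Leads G V P (return o)  = V o
Leads G V P (compute σ) = P σ
Leads G V P (toss _ _)  = ⊥
Leads G V P (query q g) = P (g (answer G q))

nth-just : ∀ {A : Set} {d} (f : Fin d → A) {j} (j<d : j < d) → nth d f j ≡ just (f (fromℕ< j<d))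
nth-just {d = d} f {j} j<d with j <? d
... | yes _  = refl
... | no j≮d = contradiction j<d j≮d

snocWalk : ∀ {n κ} (G : Multigraph n κ) {u es v w e} → Walk G u es v → Arc G e v w → Walk G u (es ∷ʳ edgeId G e) w
snocWalk G []      a = a ∷ []
snocWalk G (b ∷ w) a = b ∷ snocWalk G w a

<∞-false : ∀ {a μ} → just a <∞ μ ≡ false → ∃ λ m → μ ≡ just m × m ≤ a
<∞-false {a} {just m} eq = m , refl , ℕ.≮⇒≥ λ a<m → contradiction (trans (sym (dec-true (a <? m) a<m)) eq) λ ()

<∞-true : ∀ {a m} → just a <∞ just m ≡ true → a < m
<∞-true {a} {m} eq with a <? m
... | yes a<m = a<m
... | no a≮m  = contradiction (trans (sym eq) (dec-false (a <? m) a≮m)) λ ()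

module Search {n κ} (G : Multigraph n κ) (s t : Fin n) where
  open BFS.Inv
  open Transitions using (module Successor)

  rootOf : Side → Fin n
  rootOf forward  = s
  rootOf backward = t

  stPath : ∀ side {es} → Walk G s es t → Path G (Any-dart G) side (rootOf side) (length es) (rootOf (opposite side))
  stPath forward  w = walkPath′ G w
  stPath backward w = walkPath G w

  Invariant : Side → Execution n → Set
  Invariant side = BFS.Inv G side (rootOf side)

  -- It suffices that `μ` is updated on relaxations only: the second execution to reach a vertex
  -- does so along an edge, and the value tested there is the sum of both distances.
  Meeting : Execution n → Execution n → ℕ∞ → Set
  Meeting X Y μ = ∀ {v α β} → Reached X v α → Reached Y v β → ∃ λ m → μ ≡ just m × m ≤ α + β

  -- As recorded distances are never revised, the equation for `m` survives all later relaxations.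
  data Middle (turn : Side) (X Y : Execution n) : ℕ∞ → Maybe (Fin n × ℕ × Fin n) → Set where
    none : Middle turn X Y ∞ nothing
    some : ∀ {α β m} δ → Reached X (near G turn δ) α → Reached Y (far G turn δ) β → m ≡ suc (α + β) →
           Middle turn X Y (just m) (just (near G forward δ , ident G δ , near G backward δ))

  record Joint (turn : Side) (X Y : Execution n) (μ : ℕ∞) (mid : Maybe (Fin n × ℕ × Fin n)) : Set where
    field
      active  : Invariant turn X
      other   : Invariant (opposite turn) Y
      meeting : Meeting X Y μ
      middle  : Middle turn X Y μ mid
      gap     : LongerThan G s t (level active + level other)

    totalSteps : ℕ
    totalSteps = steps active + steps other

  open Joint

  record Flipped {turn X Y μ mid} (J : Joint turn X Y μ mid) : Set where
    field
      joint          : Joint (opposite turn) Y X μ mid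
      active-relaxed : relaxed (active joint) ≡ relaxed (other J)
      other-relaxed  : relaxed (other joint) ≡ relaxed (active J)
      same-steps     : totalSteps joint ≡ totalSteps J

  flip : ∀ {turn X Y μ mid} (J : Joint turn X Y μ mid) → Flipped J
  flip {turn} {X} {Y} {μ} J = go turn J
    where
    meeting′ : Meeting X Y μ → Meeting Y X μ
    meeting′ meet {α = α} {β} y x = let (m , μ≡ , m≤) = meet x y in m , μ≡ , subst (m ≤_) (ℕ.+-comm β α) m≤
    middle-forward : ∀ {μ mid} → Middle forward X Y μ mid → Middle backward Y X μ mid
    middle-forward none = none
    middle-forward (some {α} {β} δ x y eq) = some δ y x (trans eq (cong suc (ℕ.+-comm α β)))
    middle-backward : ∀ {μ mid} → Middle backward X Y μ mid → Middle forward Y X μ mid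
    middle-backward none = none
    middle-backward (some {α} {β} δ x y eq) = some δ y x (trans eq (cong suc (ℕ.+-comm α β)))
    go : ∀ turn {mid} (J : Joint turn X Y μ mid) → Flipped J
    go forward J = record
      { joint = record
        { active = other J ; other = active J ; meeting = meeting′ (meeting J)
        ; middle = middle-forward (middle J)
        ; gap = subst (LongerThan G s t) (ℕ.+-comm (level (active J)) (level (other J))) (gap J) }
      ; active-relaxed = refl ; other-relaxed = refl
      ; same-steps = ℕ.+-comm (steps (other J)) (steps (active J)) }
    go backward J = record
      { joint = record
        { active = other J ; other = active J ; meeting = meeting′ (meeting J)
        ; middle = middle-backward (middle J)
        ; gap = subst (LongerThan G s t) (ℕ.+-comm (level (active J)) (level (other J))) (gap J) }
      ; active-relaxed = refl ; other-relaxed = refl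
      ; same-steps = ℕ.+-comm (steps (other J)) (steps (active J)) }

  Optimal : ℕ∞ → Set
  Optimal μ = ∀ {es} → Walk G s es t → ∃ λ m → μ ≡ just m × m ≤ length es

  -- A walk this short has a vertex within the level of either side, which both executions have
  -- reached. In `closing` this makes `μ` optimal if the test stops the search, and establishes
  -- `gap` if it does not.
  meetBound : ∀ {turn X Y μ es} (I : Invariant turn X) (I′ : Invariant (opposite turn) Y) → Meeting X Y μ →
              Walk G s es t → length es ≤ level I + level I′ → ∃ λ m → μ ≡ just m × m ≤ length es
  meetBound {turn} {es = es} I I′ meeting w le
    with meet G (length es) 0 (level I) (stPath turn w) [] z≤n (subst (_≤ level I + level I′) (sym (ℕ.+-identityʳ _)) le)
  ... | i , j , u , v , v′ , i≤a , j≤b , i+j≡ with complete I v i≤a | complete I′ v′ j≤b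
  ... | α , α≤i , x | β , β≤j , y with meeting x y
  ... | m , μ≡ , m≤ = m , μ≡ , ℕ.≤-trans m≤ (ℕ.≤-trans (ℕ.+-mono-≤ α≤i β≤j)
    (ℕ.≤-reflexive (trans i+j≡ (ℕ.+-identityʳ _))))

  -- The stopping step closes a vertex without relaxing its edges, a state outside `Inv`. Tracing
  -- reads only the tree, so the invariant of the preceding state can be used.
  record SameTree (X X₀ : Execution n) : Set where
    constructor sameTree
    field
      dist≡   : Execution.dist X ≡ Execution.dist X₀
      parent≡ : Execution.parent X ≡ Execution.parent X₀

  Balanced : ℕ → ℕ → Set
  Balanced N N′ = N ≤ suc N′ × N′ ≤ suc N

  record Trace (m : ℕ) (X Y : Execution n) (x : Fin n) (es : List ℕ) (y : Fin n) : Set where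
    field
      {X₀ Y₀}  : Execution n
      {μ}      : ℕ∞
      {mid}    : Maybe (Fin n × ℕ × Fin n)
      {α β}    : ℕ
      joint    : Joint forward X₀ Y₀ μ mid
      balanced : Balanced (relaxed (active joint)) (relaxed (other joint))
      sameX    : SameTree X X₀
      sameY    : SameTree Y Y₀
      x-at     : Reached X₀ x α
      y-at     : Reached Y₀ y β
      walk     : Walk G x es y
      -- The sum `α + length es + β` is constant during tracing and equals the length of the output
      -- at the end.
      shortest : ∀ {es′} → Walk G s es′ t → α + length es + β ≤ length es′
      -- Each tracing step lowers `α + β` by one, so the left side is constant as well.
      budget   : m + (α + β) ≤ suc (totalSteps joint + (relaxed (active joint) + relaxed (other joint)))

  record Searching (m : ℕ) (c : Config n) : Set where
    open Config c renaming (active to X; other to Y)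
    field
      joint    : Joint turn X Y μ mid
      -- Only a relaxation passes the turn; opening and finishing a vertex leave both counts alone.
      balance₁ : relaxed (active joint) ≤ relaxed (other joint)
      balance₂ : relaxed (other joint) ≤ suc (relaxed (active joint))
      steps≡   : m ≡ totalSteps joint

  BInv : ℕ → BState n → Set
  BInv m (searching c)        = Searching m c
  BInv m (tracing X Y x es y) = Trace m X Y x es y

  Continues : ℕ → Action n κ (BState n) → Set
  Continues m = Leads G (Valid G s t) (BInv m)

  startTrace : ∀ {X Y X₀ Y₀ m α β δ mid} (J : Joint forward X₀ Y₀ (just m) mid) →
    Balanced (relaxed (active J)) (relaxed (other J)) → SameTree X X₀ → SameTree Y Y₀ → Optimal (just m) →
    Reached X₀ (near G forward δ) α → Reached Y₀ (near G backward δ) β → m ≡ suc (α + β) →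
    Trace (suc (totalSteps J)) X Y (near G forward δ) [ ident G δ ] (near G backward δ)
  startTrace {m = m} {α} {β} {δ} J balanced sameX sameY optimal x y m≡ = record
    { joint = J ; balanced = balanced ; sameX = sameX ; sameY = sameY ; x-at = x ; y-at = y
    ; walk = dartArc G δ ∷ [] ; shortest = λ w → shorter (optimal w)
    ; budget = s≤s (ℕ.+-monoʳ-≤ (totalSteps J) (ℕ.+-mono-≤ (dist≤relaxed (active J) x) (dist≤relaxed (other J) y))) }
    where
    shorter : ∀ {l} → (∃ λ m′ → just m ≡ just m′ × m′ ≤ l) → α + 1 + β ≤ l
    shorter (_ , refl , m≤l) = ℕ.≤-trans (ℕ.≤-reflexive (trans (cong (_+ β) (ℕ.+-comm α 1)) (sym m≡))) m≤l

  finishes : ∀ {turn X Y X″ μ mid} (J : Joint turn X Y μ mid) → Balanced (relaxed (active J)) (relaxed (other J)) →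
             SameTree X″ X → Optimal μ → Continues (suc (totalSteps J)) (finish (config turn X″ Y μ mid))
  finishes {turn} J balanced same optimal = go turn J balanced same optimal (middle J)
    where
    go : ∀ turn {X Y X″ μ mid} (J : Joint turn X Y μ mid) → Balanced (relaxed (active J)) (relaxed (other J)) →
         SameTree X″ X → Optimal μ → Middle turn X Y μ mid →
         Continues (suc (totalSteps J)) (finish (config turn X″ Y μ mid))
    -- With `μ` infinite, optimality excludes every st-walk.
    go _ J balanced same optimal none es w with optimal w
    ... | _ , () , _
    go forward J balanced same optimal (some δ x y m≡) =
      startTrace {δ = δ} J balanced same (sameTree refl refl) optimal x y m≡
    go backward {X} {Y} {X″} J balanced same optimal (some {α} {β} δ x y m≡) =
      subst (λ m → Trace (suc m) Y X″ (near G forward δ) [ ident G δ ] (near G backward δ)) (Flipped.same-steps F)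
        (startTrace {δ = δ} (Flipped.joint F)
          (subst₂ Balanced (sym (Flipped.active-relaxed F)) (sym (Flipped.other-relaxed F)) (proj₂ balanced , proj₁ balanced))
          (sameTree refl refl) same optimal y x (trans m≡ (cong suc (ℕ.+-comm α β))))
      where
      F : Flipped J
      F = flip J

  traceContinues : ∀ {m X Y x es y} → Trace m X Y x es y → Continues (suc m) (traceStep X Y x es y)
  traceContinues {m} {X} {Y} {x} {es} {y} T = go refl refl (BFS.Inv.tree (active J) (x-at T)) (BFS.Inv.tree (other J) (y-at T))
    where
    open Trace
    J : Joint forward (X₀ T) (Y₀ T) (μ T) (mid T)
    J = joint T

    inX : ∀ {p} → lookup (Execution.parent (X₀ T)) x ≡ p → lookup (Execution.parent X) x ≡ p
    inX = trans (cong (λ ps → lookup ps x) (SameTree.parent≡ (sameX T)))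
    inY : ∀ {p} → lookup (Execution.parent (Y₀ T)) y ≡ p → lookup (Execution.parent Y) y ≡ p
    inY = trans (cong (λ ps → lookup ps y) (SameTree.parent≡ (sameY T)))

    B : ℕ
    B = suc (totalSteps J + (relaxed (active J) + relaxed (other J)))

    go : ∀ {α β} → α ≡ Trace.α T → β ≡ Trace.β T →
         BFS.TreeEntry G forward s (X₀ T) x α → BFS.TreeEntry G backward t (Y₀ T) y β →
         Continues (suc m) (traceStep X Y x es y)
    go refl _ (BFS.via {d} δ refl p r) _ rewrite inX p = record
      { joint = J ; balanced = balanced T ; sameX = sameX T ; sameY = sameY T ; x-at = r ; y-at = y-at T
      ; walk = dartArc G δ ∷ walk T
      ; shortest = λ {es′} w → subst (λ l → l + Trace.β T ≤ length es′) (sym (ℕ.+-suc d (length es))) (shortest T w)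
      ; budget = subst (_≤ B) (ℕ.+-suc m (d + Trace.β T)) (budget T) }
    go refl refl (BFS.atRoot refl p) (BFS.via {d} δ refl q r) rewrite inX p | inY q = record
      { joint = J ; balanced = balanced T ; sameX = sameX T ; sameY = sameY T ; x-at = x-at T ; y-at = r
      ; walk = snocWalk G (walk T) (dartArc G δ)
      ; shortest = λ {es′} w → subst (_≤ length es′)
          (trans (ℕ.+-suc (length es) d) (cong (_+ d) (sym (trans (List.length-++ es) (ℕ.+-comm (length es) 1)))))
          (shortest T w)
      ; budget = subst (_≤ B) (ℕ.+-suc m d) (budget T) }
    go refl refl (BFS.atRoot refl p) (BFS.atRoot refl q) rewrite inX p | inY q =
      walk T , λ es′ w → subst (_≤ length es′) (ℕ.+-identityʳ (length es)) (shortest T w)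

  growMiddle : ∀ {turn X X′ Y μ mid} → (∀ {w d} → Reached X w d → Reached X′ w d) →
               Middle turn X Y μ mid → Middle turn X′ Y μ mid
  growMiddle old none            = none
  growMiddle old (some δ x y m≡) = some δ (old x) y m≡

  orient≡ : ∀ turn δ {u} → near G turn δ ≡ u →
            orient turn u (ident G δ) (far G turn δ) ≡ (near G forward δ , ident G δ , near G backward δ)
  orient≡ forward  δ refl = refl
  orient≡ backward δ refl = refl

  closing : ∀ {m turn X Y μ mid u rest} → Searching m (config turn X Y μ mid) →
    Execution.progress X ≡ idle → Execution.queue X ≡ u ∷ rest →
    let c = close u rest (config turn X Y μ mid) in
    Continues (suc m) (if (radius (Config.active c) +∞ radius Y) <∞ μ
      then query (degreeOf (port κ turn) u) (λ d → searching (setProgress (relaxing 0 d) c))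
      else finish c)
  closing {m} {turn} {X} {Y} {μ} {mid} {u} {rest} Σ p≡ q≡ =
    if-elim (Continues (suc m)) ((lookup (Execution.dist X) u +∞ radius Y) <∞ μ) goOn stop
    where
    open Searching Σ
    J : Joint turn X Y μ mid
    J = joint
    S : Transitions.Successor G turn (rootOf turn) (active J) (Transitions.closeVertex G turn (rootOf turn) u rest X) (relaxed (active J))
    S = Transitions.openNext G turn (rootOf turn) (active J) p≡ q≡
    I : Invariant turn _
    I = Successor.inv S
    a b : ℕ
    a = level I
    b = level (other J)
    radius≡ : ∀ {x} → (lookup (Execution.dist X) u +∞ radius Y) <∞ μ ≡ x → just (a + b) <∞ μ ≡ x
    radius≡ = trans (sym (cong₂ (λ x y → (x +∞ y) <∞ μ) (current-reached I) (current-reached (other J))))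

    stop : (lookup (Execution.dist X) u +∞ radius Y) <∞ μ ≡ false →
           Continues (suc m) (finish (close u rest (config turn X Y μ mid)))
    stop eq = subst (λ k → Continues (suc k) (finish (close u rest (config turn X Y μ mid)))) (sym steps≡)
      (finishes J (ℕ.m≤n⇒m≤1+n balance₁ , balance₂) (sameTree refl refl) optimal)
      where
      optimal : Optimal μ
      -- Short walks are handled by a common vertex, the others by the failed test, which says that
      -- `μ` is at most `a + b`.
      optimal {es} w with length es ≤? a + b | <∞-false {a + b} {μ} (radius≡ eq)
      ... | yes le | _ = meetBound I (other J) (meeting J) w le
      ... | no ≰   | m′ , μ≡ , m′≤ = m′ , μ≡ , ℕ.≤-trans m′≤ (ℕ.<⇒≤ (ℕ.≰⇒> ≰))

    goOn : (lookup (Execution.dist X) u +∞ radius Y) <∞ μ ≡ true → Searching (suc m) _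
    goOn eq = record
      { joint = record
        { active = I ; other = other J ; meeting = meeting J ; middle = growMiddle (λ r → r) (middle J)
        ; gap = λ w → ℕ.≰⇒> λ le → contradict (meetBound I (other J) (meeting J) w le) le }
      ; balance₁ = subst (_≤ relaxed (other J)) (sym (Successor.relaxed≡ S)) balance₁
      ; balance₂ = subst (λ N → relaxed (other J) ≤ suc N) (sym (Successor.relaxed≡ S)) balance₂
      ; steps≡ = trans (cong suc steps≡) (cong (_+ steps (other J)) (sym (Successor.steps≡ S)))
      }
      where
      contradict : ∀ {l} → (∃ λ m → μ ≡ just m × m ≤ l) → l ≤ a + b → ⊥
      contradict (m , refl , m≤l) l≤ = ℕ.<⇒≱ (<∞-true {a + b} {m} (radius≡ eq)) (ℕ.≤-trans m≤l l≤)

  relaxContinues : ∀ {m turn X Y μ mid j r} → Searching m (config turn X Y μ mid) →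
    Execution.progress X ≡ relaxing j (suc r) →
    (i : Fin (sideDegree G turn (Execution.current X))) → toℕ i ≡ j →
    let (e , v) = neighbourAt G turn (Execution.current X) i in
    Searching (suc m) (switch (relax e v (setProgress (relaxing (suc j) r) (config turn X Y μ mid))))
  relaxContinues {m} {turn} {X} {Y} {μ} {mid} {j} {r} Σ p≡ i j≡ =
    if-elim (Searching (suc m) ∘ switch) (through <∞ μ)
      (λ eq → let (meet , mids) = improved _ refl (through≡ eq) in
        after (subst (Meeting X′ Y) (sym through-eq) meet) 
          (subst (λ μ → Middle turn X′ Y μ (just (orient turn u (ident G δ) v))) (sym through-eq) mids))
      (λ eq → after (kept _ refl (through≡ eq)) (growMiddle old (middle J)))
    where
    open Searching Σ
    J : Joint turn X Y μ mid
    J = joint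
    u : Fin n
    u = Execution.current X
    δ : Dart G
    δ = dartAt G turn u i
    v : Fin n
    v = far G turn δ
    a : ℕ
    a = level (active J)
    X′ : Execution n
    X′ = reach (ident G δ) v (record X { progress = relaxing (suc j) r })
    R : Transitions.RelaxResult G turn (rootOf turn) (active J) p≡ i j≡ X′
    R = Transitions.relaxEdge G turn (rootOf turn) (active J) p≡ i j≡
    S : Transitions.Successor G turn (rootOf turn) (active J) X′ (suc (relaxed (active J)))
    S = proj₁ (proj₁ R)
    old : ∀ {w d} → Reached X w d → Reached X′ w d
    old = Transitions.Grows.old (proj₂ R)
    through : ℕ∞
    through = (lookup (Execution.dist X) u +∞ just 1) +∞ lookup (Execution.dist Y) v
    through-eq : through ≡ just (a + 1) +∞ lookup (Execution.dist Y) v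
    through-eq = cong (λ x → (x +∞ just 1) +∞ lookup (Execution.dist Y) v) (current-reached (active J))
    through≡ : ∀ {x} → through <∞ μ ≡ x → (just (a + 1) +∞ lookup (Execution.dist Y) v) <∞ μ ≡ x
    through≡ = trans (cong (_<∞ μ) (sym through-eq))

    improved : ∀ y → lookup (Execution.dist Y) v ≡ y → (just (a + 1) +∞ y) <∞ μ ≡ true →
      Meeting X′ Y (just (a + 1) +∞ y) × Middle turn X′ Y (just (a + 1) +∞ y) (just (orient turn u (ident G δ) v))
    improved (just β) y≡ lt = (λ x y → meetAt (Transitions.Grows.new (proj₂ R) x) y) ,
      subst (Middle turn X′ Y (just (a + 1 + β)) ∘ just) (sym (orient≡ turn δ (near-dartAt G turn u i)))
        (some δ (subst (λ w → Reached X′ w a) (sym (near-dartAt G turn u i)) (old (current-reached (active J)))) y≡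
          (cong (_+ β) (ℕ.+-comm a 1)))
      where
      -- Pairs known before are covered by the old `μ`, which has just decreased. The only new pair
      -- is at `v`, where the sum is the value tested.
      meetAt : ∀ {w α β′} → Reached X w α ⊎ (w ≡ v × α ≡ suc a) → Reached Y w β′ →
             ∃ λ m → just (a + 1 + β) ≡ just m × m ≤ α + β′
      meetAt (inj₁ x) y with meeting J x y
      ... | m′ , refl , m′≤ = _ , refl , ℕ.≤-trans (ℕ.<⇒≤ (<∞-true {a + 1 + β} {m′} lt)) m′≤
      meetAt (inj₂ (refl , refl)) y rewrite reached-unique {X = Y} y y≡ =
        _ , refl , ℕ.≤-reflexive (cong (_+ β) (ℕ.+-comm a 1))

    kept : ∀ y → lookup (Execution.dist Y) v ≡ y → (just (a + 1) +∞ y) <∞ μ ≡ false → Meeting X′ Y μ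
    kept y y≡ ge x = meetAt y y≡ ge (Transitions.Grows.new (proj₂ R) x)
      where
      meetAt : ∀ {w α β′} y → lookup (Execution.dist Y) v ≡ y → (just (a + 1) +∞ y) <∞ μ ≡ false →
             Reached X w α ⊎ (w ≡ v × α ≡ suc a) → Reached Y w β′ → ∃ λ m → μ ≡ just m × m ≤ α + β′
      meetAt _ _ _ (inj₁ x) y = meeting J x y
      meetAt nothing y≡ _ (inj₂ (refl , _)) y = contradiction (trans (sym y≡) y) λ ()
      meetAt (just β) y≡ ge (inj₂ (refl , refl)) y with <∞-false {a + 1 + β} {μ} ge
      ... | m′ , μ≡ , m′≤ rewrite reached-unique {X = Y} y y≡ =
        m′ , μ≡ , ℕ.≤-trans m′≤ (ℕ.≤-reflexive (cong (_+ β) (ℕ.+-comm a 1)))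

    after : ∀ {μ′ mid′} → Meeting X′ Y μ′ → Middle turn X′ Y μ′ mid′ →
            Searching (suc m) (config (opposite turn) Y X′ μ′ mid′)
    after {μ′} {mid′} meeting′ middle′ = record
      { joint = Flipped.joint F
      ; balance₁ = subst₂ _≤_ (sym (Flipped.active-relaxed F)) (sym other≡) balance₂
      ; balance₂ = subst₂ (λ N N′ → N ≤ suc N′) (sym other≡) (sym (Flipped.active-relaxed F)) (s≤s balance₁)
      ; steps≡ = trans (cong suc steps≡)
          (trans (cong (_+ steps (other J)) (sym (Successor.steps≡ S))) (sym (Flipped.same-steps F)))
      }
      where
      J′ : Joint turn X′ Y μ′ mid′
      J′ = record
        { active = Successor.inv S ; other = other J ; meeting = meeting′ ; middle = middle′
        ; gap = subst (λ k → LongerThan G s t (k + level (other J))) (sym (proj₂ (proj₁ R))) (gap J) }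
      F : Flipped J′
      F = flip J′
      other≡ : relaxed (other (Flipped.joint F)) ≡ suc (relaxed (active J))
      other≡ = trans (Flipped.other-relaxed F) (Successor.relaxed≡ S)

  ending : ∀ {m turn X Y μ mid j} → Searching m (config turn X Y μ mid) → Execution.progress X ≡ relaxing j zero →
           Searching (suc m) (setProgress idle (config turn X Y μ mid))
  ending {m} {turn} Σ p≡ with Transitions.finishVertex G turn (rootOf turn) (active (Searching.joint Σ)) p≡
  ... | S , level≡ = record
    { joint = record
      { active = Successor.inv S ; other = other J ; meeting = meeting J ; middle = growMiddle (λ r → r) (middle J)
      ; gap = subst (λ k → LongerThan G s t (k + level (other J))) (sym level≡) (gap J) }
    ; balance₁ = subst (_≤ relaxed (other J)) (sym (Successor.relaxed≡ S)) (Searching.balance₁ Σ)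
    ; balance₂ = subst (λ N → relaxed (other J) ≤ suc N) (sym (Successor.relaxed≡ S)) (Searching.balance₂ Σ)
    ; steps≡ = trans (cong suc (Searching.steps≡ Σ)) (cong (_+ steps (other J)) (sym (Successor.steps≡ S)))
    }
    where
    J : Joint turn _ _ _ _
    J = Searching.joint Σ

  -- Rules out the `nothing` branch of the edge query in `searchStep`.
  slot<degree : ∀ {m turn X Y μ mid j r} → Searching m (config turn X Y μ mid) →
                Execution.progress X ≡ relaxing j (suc r) → j < sideDegree G turn (Execution.current X)
  slot<degree {turn = turn} {X} {j = j} {r} Σ p≡ = go (subst (BFS.Phase G turn (rootOf turn) X _ _ _) p≡ (phase (active (Searching.joint Σ))))
    where
    go : ∀ {vs N k} → BFS.Phase G turn (rootOf turn) X vs N k (relaxing j (suc r)) → j < sideDegree G turn (Execution.current X)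
    go (BFS.relaxing _ _ _ _ j+r≡ _ _) = subst (j <_) j+r≡ (ℕ.m<m+n j (s≤s z≤n))

  searchContinues : ∀ {m} c → Searching m c → Continues (suc m) (searchStep c)
  searchContinues {m} (config turn X Y μ mid) Σ with Execution.progress X in p≡ | Execution.queue X in q≡
  ... | idle | [] = subst (λ k → Continues (suc k) (finish (config turn X Y μ mid))) (sym (Searching.steps≡ Σ))
    (finishes J (ℕ.m≤n⇒m≤1+n (Searching.balance₁ Σ) , Searching.balance₂ Σ) (sameTree refl refl) optimal)
    where
    J : Joint turn X Y μ mid
    J = Searching.joint Σ
    optimal : Optimal μ
    -- The exhausted side has reached the opposite root, which the other side holds at distance 0,
    -- so `Meeting` applies there.
    optimal w = let (d , d≤l , r) = exhausted (active J) p≡ q≡ (stPath turn w)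
                    (m , μ≡ , m≤) = meeting J r (root-reached (other J))
                in m , μ≡ , ℕ.≤-trans m≤ (subst (_≤ _) (sym (ℕ.+-identityʳ d)) d≤l)
  ... | idle | u ∷ rest = closing Σ p≡ q≡
  ... | relaxing j zero | _ = ending Σ p≡
  ... | relaxing j (suc r) | _
    rewrite answer-edgeAt G turn (Execution.current X) j
          | nth-just (neighbourAt G turn (Execution.current X)) (slot<degree Σ p≡)
    = relaxContinues Σ p≡ (fromℕ< (slot<degree Σ p≡)) (Fin.toℕ-fromℕ< (slot<degree Σ p≡))

  start-inv : s ≢ t → BInv 0 (searching (config forward (launch s) (launch t) ∞ nothing))
  start-inv s≢t = record
    { joint = record
      { active = Transitions.initial G forward s ; other = Transitions.initial G backward t
      ; meeting = λ x y → contradiction (trans (sym (proj₁ (launch-reached {r = s} x))) (proj₁ (launch-reached {r = t} y))) s≢t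
      ; middle = none
      ; gap = λ where
        []      → contradiction refl s≢t
        (_ ∷ _) → s≤s z≤n }
    ; balance₁ = z≤n ; balance₂ = z≤n ; steps≡ = refl }

  continues : ∀ {m} σ → BInv m σ → Continues (suc m) (Algorithm.step (bidirectionalBFS κ) σ)
  continues (searching c)        Σ = searchContinues c Σ
  continues (tracing X Y x es y) T = traceContinues T

-- Comparison of the running times

module _ {κ} (A : Algorithm κ) {n} (G : Multigraph n κ) {V : Output → Set}
         {P : ℕ → Algorithm.State A n → Set}
         (next : ∀ {m σ} → P m σ → Leads G V (P (suc m)) (Algorithm.step A σ)) where
  open Run A G

  -- `P` carries the number of steps already made, so bounding it in every visited state bounds the
  -- whole run; `suc m` includes the step about to be made.
  expectedTime≤ : ∀ {B} → (∀ {m σ} → P m σ → ⟦ suc m ⟧ ℚ.≤ B) →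
                  ∀ k {m σ} → P m σ → ⟦ m ⟧ ℚ.+ expected (cost time) k σ ℚ.≤ B
  expectedTime≤ bound zero    {m} p = subst (ℚ._≤ _) (sym (ℚ.+-identityʳ ⟦ m ⟧)) (ℚ.≤-trans (⟦⟧-mono (ℕ.n≤1+n m)) (bound p))
  expectedTime≤ {B} bound (suc k) {m} {σ} p = help (Algorithm.step A σ) (next p)
    where
    count : ∀ {e} → ⟦ suc m ⟧ ℚ.+ e ℚ.≤ B → ⟦ m ⟧ ℚ.+ (1ℚ ℚ.+ e) ℚ.≤ B
    count {e} = subst (ℚ._≤ B) (trans (cong (ℚ._+ e) (trans (⟦⟧-homo-+ 1 m) (ℚ.+-comm 1ℚ ⟦ m ⟧))) (ℚ.+-assoc ⟦ m ⟧ 1ℚ e))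
    help : ∀ a → Leads G V (P (suc m)) a → ⟦ m ⟧ ℚ.+ (1ℚ ℚ.+ mean a (expected (cost time) k)) ℚ.≤ B
    help (return _)  _ = count {0ℚ} (subst (ℚ._≤ B) (sym (ℚ.+-identityʳ ⟦ suc m ⟧)) (bound p))
    help (compute τ) q = count {expected (cost time) k τ} (expectedTime≤ bound k q)
    help (query q g) r = count {expected (cost time) k (g (answer G q))} (expectedTime≤ bound k r)

  -- No state can satisfy `P` after `N` steps, so the run has returned by then, with an output in
  -- `V`.
  surelyReturns : ∀ {f N} → (∀ {o} → V o → 1ℚ ℚ.≤ f o) → (∀ {m σ} → P m σ → suc m ≤ N) →
                  ∀ k {m σ} → m + k ≡ N → P m σ → 1ℚ ℚ.≤ expected (onReturn A G f) k σ
  surelyReturns good bound zero    {m} m+0≡N p =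
    contradiction (bound p) (ℕ.<⇒≱ (s≤s (ℕ.≤-reflexive (trans (sym m+0≡N) (ℕ.+-identityʳ m)))))
  surelyReturns {f} good bound (suc k) {m} {σ} m+1+k≡N p = help (Algorithm.step A σ) (next p)
    where
    wait : ∀ {e} → 1ℚ ℚ.≤ e → 1ℚ ℚ.≤ 0ℚ ℚ.+ e
    wait {e} = subst (1ℚ ℚ.≤_) (sym (ℚ.+-identityˡ e))
    1+m+k≡N : suc m + k ≡ _
    1+m+k≡N = trans (sym (ℕ.+-suc m k)) m+1+k≡N
    help : ∀ a → Leads G V (P (suc m)) a → 1ℚ ℚ.≤ onReturn A G f a ℚ.+ mean a (expected (onReturn A G f) k)
    help (return o)  v = subst (1ℚ ℚ.≤_) (sym (ℚ.+-identityʳ (f o))) (good v)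
    help (compute τ) q = wait {expected (onReturn A G f) k τ} (surelyReturns good bound k 1+m+k≡N q)
    help (query q g) r = wait {expected (onReturn A G f) k (g (answer G q))} (surelyReturns good bound k 1+m+k≡N r)

degree≤Δ : ∀ {n κ} (G : Multigraph n κ) v → degree G v ≤ Δ G
degree≤Δ G = go (degree G)
  where
  go : ∀ {n} (f : Fin n → ℕ) v → f v ≤ Vector.foldr _⊔_ 0 f
  go f zero    = ℕ.m≤m⊔n (f zero) _
  go f (suc v) = ℕ.≤-trans (go (f ∘ suc) v) (ℕ.m≤n⊔m (f zero) _)

sideDegree≤degree : ∀ {n κ} (G : Multigraph n κ) side v → sideDegree G side v ≤ degree G v
sideDegree≤degree (dir G)   forward  v = ℕ.m≤n+m _ (Digraph.indeg G v)
sideDegree≤degree (dir G)   backward v = ℕ.m≤m+n (Digraph.indeg G v) _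
sideDegree≤degree (undir G) side     v = ℕ.≤-refl

totalDegree≤ : ∀ {n κ} (G : Multigraph n κ) side vs → totalDegree G side vs ≤ length vs * Δ G
totalDegree≤ G side []       = z≤n
totalDegree≤ G side (v ∷ vs) =
  ℕ.+-mono-≤ (ℕ.≤-trans (sideDegree≤degree G side v) (degree≤Δ G v)) (totalDegree≤ G side vs)

unique-length≤ : ∀ {n} {vs : List (Fin n)} → Unique vs → length vs ≤ n
unique-length≤ u = Fin.injective⇒≤ (lookup-injective u)
  where
  lookup-injective : ∀ {vs} → Unique vs → ∀ {i j} → List.lookup vs i ≡ List.lookup vs j → i ≡ j
  lookup-injective (_ ∷ _)  {zero}  {zero}  _  = refl
  lookup-injective (v∉ ∷ _) {zero}  {suc j} eq = contradiction eq (All.lookup v∉ (∈.∈-lookup j))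
  lookup-injective (v∉ ∷ _) {suc i} {zero}  eq = contradiction (sym eq) (All.lookup v∉ (∈.∈-lookup i))
  lookup-injective (_ ∷ u)  {suc i} {suc j} eq = cong suc (lookup-injective u eq)

-- Running time in terms of the explored degree

module Bounds {n κ} (G : Multigraph n κ) (s t : Fin n) where
  open Search G s t
  open BFS.Inv
  open Joint

  D : ℕ
  D = 1 ⊔ Δ G

  Δ≤D : Δ G ≤ D
  Δ≤D = ℕ.m≤n⊔m 1 (Δ G)

  record Summary (m : ℕ) : Set where
    field
      {X Y}    : Execution n
      {μ}      : ℕ∞
      {mid}    : Maybe (Fin n × ℕ × Fin n)
      joint    : Joint forward X Y μ mid
      balanced : Balanced (relaxed (active joint)) (relaxed (other joint))
      time≤    : m ≤ suc (totalSteps joint + (relaxed (active joint) + relaxed (other joint)))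

  summary : ∀ {m} σ → BInv m σ → Summary m
  summary (tracing _ _ _ _ _) T = record
    { joint = joint ; balanced = balanced ; time≤ = ℕ.≤-trans (ℕ.m≤m+n _ (α + β)) budget }
    where open Trace T
  summary (searching (config forward _ _ _ _)) Σ = record
    { joint = joint ; balanced = ℕ.m≤n⇒m≤1+n balance₁ , balance₂
    ; time≤ = ℕ.m≤n⇒m≤1+n (ℕ.≤-trans (ℕ.≤-reflexive steps≡) (ℕ.m≤m+n _ _)) }
    where open Searching Σ
  summary (searching (config backward _ _ _ _)) Σ = record
    { joint = Flipped.joint F
    ; balanced = subst₂ Balanced (sym (Flipped.active-relaxed F)) (sym (Flipped.other-relaxed F))
                   (balance₂ , ℕ.m≤n⇒m≤1+n balance₁)
    ; time≤ = ℕ.m≤n⇒m≤1+n (ℕ.≤-trans (ℕ.≤-reflexive (trans steps≡ (sym (Flipped.same-steps F)))) (ℕ.m≤m+n _ _)) }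
    where
    open Searching Σ
    F : Flipped joint
    F = flip joint

  -- Each execution makes at most 3N + 2 steps, tracing adds at most N + N′, and the two steps
  -- counted by `suc` give 6 + 4N + 4N′. Balance replaces either count by the other plus 1.
  time≤relaxed : ∀ {m} (S : Summary m) → let J = Summary.joint S in
    suc m ≤ 10 + 8 * relaxed (active J) × suc m ≤ 10 + 8 * relaxed (other J)
  time≤relaxed {m} S =
      ℕ.≤-trans small (ℕ.≤-trans (ℕ.+-monoʳ-≤ (6 + 4 * N) (ℕ.*-monoʳ-≤ 4 (proj₂ balanced)))
        (ℕ.≤-reflexive (solve 1 (λ N → con 6 :+ con 4 :* N :+ con 4 :* (con 1 :+ N) := con 10 :+ con 8 :* N) refl N)))
    , ℕ.≤-trans small (ℕ.≤-trans (ℕ.+-monoˡ-≤ (4 * N′) (ℕ.+-monoʳ-≤ 6 (ℕ.*-monoʳ-≤ 4 (proj₁ balanced))))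
        (ℕ.≤-reflexive (solve 1 (λ N → con 6 :+ con 4 :* (con 1 :+ N) :+ con 4 :* N := con 10 :+ con 8 :* N) refl N′)))
    where
    open Summary S
    open +-*-Solver using (solve; con; _:+_; _:*_; _:=_)
    N N′ : ℕ
    N  = relaxed (active joint)
    N′ = relaxed (other joint)
    small : suc m ≤ 6 + 4 * N + 4 * N′
    small = ℕ.≤-trans (s≤s time≤) (ℕ.≤-trans
      (s≤s (s≤s (ℕ.+-monoˡ-≤ (N + N′) (ℕ.+-mono-≤ (steps≤ (active joint)) (steps≤ (other joint))))))
      (ℕ.≤-reflexive (solve 2 (λ N N′ → con 2 :+ ((N :+ con 2 :* (con 1 :+ N)) :+ (N′ :+ con 2 :* (con 1 :+ N′)) :+ (N :+ N′))
        := con 6 :+ con 4 :* N :+ con 4 :* N′) refl N N′)))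

  -- A crude bound by the input alone, which supplies the number of steps after which B has surely
  -- returned.
  time≤size : ∀ {m σ} → BInv m σ → suc m ≤ 10 + 8 * (n * Δ G)
  time≤size {σ = σ} p = ℕ.≤-trans (proj₁ (time≤relaxed S)) (ℕ.+-monoʳ-≤ 10 (ℕ.*-monoʳ-≤ 8
    (ℕ.≤-trans (relaxed≤total I) (ℕ.≤-trans (totalDegree≤ G forward (closedVertices I))
      (ℕ.*-monoˡ-≤ (Δ G) (unique-length≤ (closed-unique I)))))))
    where
    S : Summary _
    S = summary σ p
    I : Invariant forward (Summary.X S)
    I = active (Summary.joint S)

  -- Every vertex that the forward execution has closed is s or was discovered
  -- by an edge leaving one of the inner vertices.
  time≤explored : ∀ {m} (S : Summary m) → let J = Summary.joint S in
    ∀ {z} → totalDegree G forward (inner (active J)) ≤ z ⊎ totalDegree G backward (closedVertices (other J)) ≤ z →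
    suc m ≤ D * (18 + 8 * z)
  time≤explored S {z} (inj₁ x≤z) = ℕ.≤-trans (proj₁ (time≤relaxed S)) (ℕ.≤-trans
    (ℕ.+-mono-≤ (ℕ.*-monoˡ-≤ 10 (ℕ.m≤m⊔n 1 (Δ G))) (ℕ.*-monoʳ-≤ 8 relaxed≤))
    (ℕ.≤-reflexive (solve 2 (λ D z → D :* con 10 :+ con 8 :* ((con 1 :+ z) :* D) := D :* (con 18 :+ con 8 :* z)) refl D z)))
    where
    open +-*-Solver using (solve; con; _:+_; _:*_; _:=_)
    I : Invariant forward (Summary.X S)
    I = active (Summary.joint S)
    relaxed≤ : relaxed I ≤ suc z * D
    relaxed≤ = ℕ.≤-trans (relaxed≤total I) (ℕ.≤-trans (totalDegree≤ G forward (closedVertices I))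
      (ℕ.*-mono-≤ (ℕ.≤-trans (ℕ.m≤m+n _ (length (front I))) (ℕ.≤-trans (count-level I) (s≤s x≤z))) Δ≤D))
  -- On the backward side the explored degree already includes every closed vertex, so it bounds the
  -- relaxations directly.
  time≤explored S {z} (inj₂ y≤z) = ℕ.≤-trans (proj₂ (time≤relaxed S)) (ℕ.≤-trans
    (ℕ.+-mono-≤ (ℕ.m≤m+n 10 8) (ℕ.*-monoʳ-≤ 8 (ℕ.≤-trans (relaxed≤total (other (Summary.joint S))) y≤z)))
    (ℕ.≤-trans (ℕ.≤-reflexive (sym (ℕ.*-identityˡ _))) (ℕ.*-monoˡ-≤ (18 + 8 * z) (ℕ.m≤m⊔n 1 (Δ G)))))

  module _ (A : Algorithm κ) (correct : Correct A) (s≢t : s ≢ t) where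
    open LowerBound A correct G s t s≢t

    -- Origin of the constant: 18 = 36 · `½` ≤ 36q and 8z ≤ 64q, together 100q.
    charge : ∀ {z q} → ½ ℚ.≤ q → ⟦ z ⟧ ℚ.≤ ⟦ 8 ⟧ ℚ.* q → ⟦ D * (18 + 8 * z) ⟧ ℚ.≤ ⟦ 100 * D ⟧ ℚ.* q
    charge {z} {q} ½≤q z≤8q = begin
      ⟦ D * (18 + 8 * z) ⟧                             ≡⟨ ⟦⟧-homo-* D (18 + 8 * z) ⟩
      ⟦ D ⟧ ℚ.* ⟦ 18 + 8 * z ⟧                         ≡⟨ cong (⟦ D ⟧ ℚ.*_) (⟦⟧-homo-+ 18 (8 * z)) ⟩
      ⟦ D ⟧ ℚ.* (⟦ 18 ⟧ ℚ.+ ⟦ 8 * z ⟧)                 ≡⟨ cong (λ x → ⟦ D ⟧ ℚ.* (⟦ 18 ⟧ ℚ.+ x)) (⟦⟧-homo-* 8 z) ⟩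
      ⟦ D ⟧ ℚ.* (⟦ 36 ⟧ ℚ.* ½ ℚ.+ ⟦ 8 ⟧ ℚ.* ⟦ z ⟧)     ≤⟨ ℚ.*-monoˡ-≤-nonNeg ⟦ D ⟧ {{ℚ.normalize-nonNeg D 1}}
                                                            (ℚ.+-mono-≤ (ℚ.*-monoˡ-≤-nonNeg ⟦ 36 ⟧ ½≤q)
                                                                        (ℚ.*-monoˡ-≤-nonNeg ⟦ 8 ⟧ z≤8q)) ⟩
      ⟦ D ⟧ ℚ.* (⟦ 36 ⟧ ℚ.* q ℚ.+ ⟦ 8 ⟧ ℚ.* (⟦ 8 ⟧ ℚ.* q)) ≡⟨ cong (λ x → ⟦ D ⟧ ℚ.* (⟦ 36 ⟧ ℚ.* q ℚ.+ x)) (ℚ.*-assoc ⟦ 8 ⟧ ⟦ 8 ⟧ q) ⟨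
      ⟦ D ⟧ ℚ.* (⟦ 36 ⟧ ℚ.* q ℚ.+ ⟦ 64 ⟧ ℚ.* q)        ≡⟨ cong (⟦ D ⟧ ℚ.*_) (ℚ.*-distribʳ-+ q ⟦ 36 ⟧ ⟦ 64 ⟧) ⟨
      ⟦ D ⟧ ℚ.* (⟦ 100 ⟧ ℚ.* q)                        ≡⟨ ℚ.*-assoc ⟦ D ⟧ ⟦ 100 ⟧ q ⟨
      ⟦ D ⟧ ℚ.* ⟦ 100 ⟧ ℚ.* q                          ≡⟨ cong (ℚ._* q) (ℚ.*-comm ⟦ D ⟧ ⟦ 100 ⟧) ⟩
      ⟦ 100 ⟧ ℚ.* ⟦ D ⟧ ℚ.* q                          ≡⟨ cong (ℚ._* q) (⟦⟧-homo-* 100 D) ⟨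
      ⟦ 100 * D ⟧ ℚ.* q                                ∎
      where open ℚ.≤-Reasoning

    time≤queries : ∀ {K} → Conclusive K → ∀ {m σ} → BInv m σ → ⟦ suc m ⟧ ℚ.≤ ⟦ 100 * D ⟧ ℚ.* Q K
    time≤queries {K} conclusive {m} {σ} p = byCases (explored≤ {K} conclusive {level I} {level I′} (gap J)
        (unique-++⁻ˡ (inner I) (closed-unique I)) (closed-unique I′)
        (All.map (λ (d , d<a , r) → d , d<a , treePath I r) (inner-reached I)) (closed-near I′))
      where
      S : Summary m
      S = summary σ p
      J : Joint forward (Summary.X S) (Summary.Y S) (Summary.μ S) (Summary.mid S)
      J = Summary.joint S
      I : Invariant forward (Summary.X S)
      I = active J
      I′ : Invariant backward (Summary.Y S)
      I′ = other J
      byCases : ⟦ totalDegree G forward (inner I) ⟧ ℚ.≤ ⟦ 8 ⟧ ℚ.* Q K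
                ⊎ ⟦ totalDegree G backward (closedVertices I′) ⟧ ℚ.≤ ⟦ 8 ⟧ ℚ.* Q K →
                ⟦ suc m ⟧ ℚ.≤ ⟦ 100 * D ⟧ ℚ.* Q K
      byCases (inj₁ le) = ℚ.≤-trans (⟦⟧-mono (time≤explored S (inj₁ ℕ.≤-refl)))
        (charge {totalDegree G forward (inner I)} {Q K} (proj₂ (proj₁ conclusive)) le)
      byCases (inj₂ le) = ℚ.≤-trans (⟦⟧-mono (time≤explored S (inj₂ ℕ.≤-refl)))
        (charge {totalDegree G backward (closedVertices I′)} {Q K} (proj₂ (proj₁ conclusive)) le)

-- Correctness and instance optimality of B

cost≤time : ∀ {n κ X} M (a : Action n κ X) → cost M a ℚ.≤ cost time a
cost≤time time    _           = ℚ.≤-refl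
cost≤time queries (query _ _) = ℚ.≤-refl
cost≤time queries (return _)  = from-yes (0ℚ ℚ.≤? 1ℚ)
cost≤time queries (compute _) = from-yes (0ℚ ℚ.≤? 1ℚ)
cost≤time queries (toss _ _)  = from-yes (0ℚ ℚ.≤? 1ℚ)

queries≤cost : ∀ {n κ X} M (a : Action n κ X) → cost queries a ℚ.≤ cost M a
queries≤cost time    a = cost≤time queries a
queries≤cost queries _ = ℚ.≤-refl

bidirectionalBFS-correct : ∀ κ → Correct (bidirectionalBFS κ)
bidirectionalBFS-correct κ {n} G s t s≢t k ε 0<ε = N , (begin
  + 9 / 10                                       ≤⟨ from-yes (+ 9 / 10 ℚ.≤? 1ℚ) ⟩
  1ℚ                                             ≤⟨ sure ⟩
  successProbability B G s t N                   ≤⟨ x≤x+y (ℚ.<⇒≤ 0<ε) ⟩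
  successProbability B G s t N ℚ.+ ε             ∎)
  where
  open ℚ.≤-Reasoning
  open Search G s t
  B : Algorithm κ
  B = bidirectionalBFS κ
  N : ℕ
  N = 10 + 8 * (n * Δ G)
  sure : 1ℚ ℚ.≤ successProbability B G s t N
  sure = subst (1ℚ ℚ.≤_) (sym (successProbability≡success B G s t N))
    (surelyReturns B G {V = Valid G s t} {P = BInv} (λ {m} {σ} → continues {m} σ) {𝟙 ∘ valid? G s t} {N}
      (λ {o} v → 1≤𝟙 (valid? G s t o) v) (λ {m} {σ} → Bounds.time≤size G s t {m} {σ}) N refl (start-inv s≢t))

-- Both measures follow from one comparison, the time of B against the queries of `A`: the cost of B
-- is at most its time, and the cost of `A` is at least its queries. One horizon `K` serves every
-- `k`.
bidirectionalBFS-optimal : ∀ κ (A : Algorithm κ) → Correct A → ∀ {n} (G : Multigraph n κ) (s t : Fin n) → s ≢ t →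
  ∀ M → complexity M (bidirectionalBFS κ) G s t ≲ (100 * (1 ⊔ Δ G)) · complexity M A G s t
bidirectionalBFS-optimal κ A correct G s t s≢t M k ε 0<ε = K , (begin
  complexity M B G s t k                                    ≤⟨ expected-mono B G (cost≤time M) k (Algorithm.start B s t) ⟩
  complexity time B G s t k                                 ≡⟨ ℚ.+-identityˡ (complexity time B G s t k) ⟨
  ⟦ 0 ⟧ ℚ.+ complexity time B G s t k                       ≤⟨ expectedTime≤ B G {V = Valid G s t} {P = BInv}
                                                                 (λ {m} {σ} → continues {m} σ) (λ {m} {σ} → bound {m} {σ}) k (start-inv s≢t) ⟩
  ⟦ 100 * D ⟧ ℚ.* complexity queries A G s t K              ≤⟨ ℚ.*-monoˡ-≤-nonNeg ⟦ 100 * D ⟧ {{ℚ.normalize-nonNeg (100 * D) 1}}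
                                                                 (expected-mono A G (queries≤cost M) K (Algorithm.start A s t)) ⟩
  ⟦ 100 * D ⟧ ℚ.* complexity M A G s t K                    ≤⟨ x≤x+y (ℚ.<⇒≤ 0<ε) ⟩
  ⟦ 100 * D ⟧ ℚ.* complexity M A G s t K ℚ.+ ε              ∎)
  where
  open ℚ.≤-Reasoning
  open Search G s t
  open Bounds G s t using (D)
  open LowerBound A correct G s t s≢t using (eventually-conclusive)
  B : Algorithm κ
  B = bidirectionalBFS κ
  K : ℕ
  K = proj₁ eventually-conclusive
  bound : ∀ {m σ} → BInv m σ → ⟦ suc m ⟧ ℚ.≤ ⟦ 100 * D ⟧ ℚ.* complexity queries A G s t K
  bound {m} {σ} = Bounds.time≤queries G s t A correct s≢t {K} (proj₂ eventually-conclusive K ℕ.≤-refl) {m} {σ}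

theorem5 : (∀ κ → Correct (bidirectionalBFS κ)) ×
    (∃[ c ] ∀ κ (A : Algorithm κ) → Correct A →
    ∀ {n} (G : Multigraph n κ) (s t : Fin n) → s ≢ t →
    ∀ (M : Measure) →
    complexity M (bidirectionalBFS κ) G s t ≲ (c * (1 ⊔ Δ G)) · complexity M A G s t)
theorem5 = bidirectionalBFS-correct , 100 , bidirectionalBFS-optimal
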